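{- Fix an integer $m\geq1$. For nonnegative integers $r_1,\ldots,r_m$ let $D(r_1,\ldots,r_m)$ be the number of acyclic orientations of the complete multipartite graph having $r_j$ parts of size $j$, for $1\leq j\leq m$. Put $$N=\sum_{j=1}^mjr_j,\qquad A_j=-\frac{j(j-1)}2,\qquad B_j=\frac{j(j-1)(j-2)(3j-5)}{24},\qquad E_j=B_j-\frac{A_j^2}{2},$$ $$\mu_1=\frac1N\sum_{j=1}^mr_jA_j,\qquad \mu_2=\frac1N\sum_{j=1}^mr_jE_j.$$ Then, uniformly for all nonnegative integers $r_1,\ldots,r_m$ with $\sum_jjr_j=N\to\infty$, $$D(r_1,\ldots,r_m)=e^{\mu_1}N!\left(1+\frac{\mu_2+\mu_1^2/2}{N}+O(N^{ -2})\right),$$ where the implicit constant in $O(N^{ -2})$ may depend on $m$ but not on the vector $(r_1,\ldots,r_m)$.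
   Context: All notation is introduced in the claim. -}

module Defs where

open import Algebra.Bundles using (CommutativeRing)
open import Data.Bool using (Bool; true; false; T)
open import Data.Bool.Properties using (T?)
open import Data.Fin using (Fin; zero; suc; toℕ; splitAt)
open import Data.Fin.Properties as Fin using (all?)
open import Data.Integer as ℤ using (ℤ; +_)
import Data.Integer.Properties as ℤ
open import Data.List
  using (List; []; _∷_; length; concat; replicate; tabulate; filter; allFin; cartesianProductWith)
open import Data.List.Membership.Propositional using (_∈_)
open import Data.List.Membership.Propositional.Properties using (∈-allFin)
open import Data.List.Relation.Unary.Any using (here; there)
open import Data.Nat as ℕ using (ℕ; zero; suc; NonZero; _!)
open import Data.Nat.ListAction using (sum)
open import Data.Nat.Properties as ℕ using (_!≢0)
open import Data.Product using (∃-syntax; _×_; _,_)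
open import Data.Rational as ℚ hiding (NonZero)
open import Data.Rational.Properties
open import Data.Rational.Solver using (module +-*-Solver)
import Data.Rational.Unnormalised as ℚᵘ
import Data.Rational.Unnormalised.Properties as ℚᵘ
open import Data.Sum using (_⊎_; inj₁; inj₂; [_,_]′)
open import Data.Vec as Vec using (Vec)
open import Function using (_∘_; const)
open import Level using (0ℓ)
open import Relation.Binary using (Rel; Decidable; Symmetric; Irreflexive)
open import Relation.Binary.Construct.Closure.Transitive
  using (TransClosure; _∷_; _++_) renaming ([_] to [_]⁺)
open import Relation.Binary.PropositionalEquality
  using (_≡_; _≢_; refl; sym; trans; cong; cong₂; subst; subst₂; ≢-sym)
open import Relation.Nullary using (Dec; ¬_; ¬?)
open import Relation.Nullary.Decidable using (map′; _×-dec_; _⊎-dec_; _→-dec_)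

open import Algebra.Properties.Monoid.Sum ℕ.+-0-monoid using () renaming (sum to ∑ℕ)
open import Algebra.Properties.Monoid.Sum +-0-monoid using () renaming (sum to ∑ℚ)
open import Algebra.Properties.Semiring.Exp
  (CommutativeRing.semiring +-*-commutativeRing) using (_^_)

record SimpleGraph (n : ℕ) : Set₁ where
  field
    Adj        : Rel (Fin n) 0ℓ
    adj?       : Decidable Adj
    adj-sym    : Symmetric Adj
    adj-irrefl : Irreflexive _≡_ Adj

-- Digraphs are Boolean adjacency matrices, so that they form a finite type
-- whose propositional equality is extensional.
Digraph : ℕ → Set
Digraph n = Vec (Vec Bool n) n

Arc : ∀ {n} → Digraph n → Rel (Fin n) 0ℓ
Arc o u v = T (Vec.lookup (Vec.lookup o u) v)

IsOrientation : ∀ {n} → SimpleGraph n → Digraph n → Set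
IsOrientation G o =
    (∀ u v → Arc o u v → Adj u v)
  × (∀ u v → Adj u v → Arc o u v ⊎ Arc o v u)
  × (∀ u v → Arc o u v → ¬ Arc o v u)
  where open SimpleGraph G

Acyclic : ∀ {n} → Digraph n → Set
Acyclic o = ∀ v → ¬ TransClosure (Arc o) v v

arc? : ∀ {n} (o : Digraph n) → Decidable (Arc o)
arc? o u v = T? _

isOrientation? : ∀ {n} (G : SimpleGraph n) (o : Digraph n) → Dec (IsOrientation G o)
isOrientation? G o =
        all? (λ u → all? λ v → arc? o u v →-dec adj? u v)
  ×-dec all? (λ u → all? λ v → adj? u v →-dec (arc? o u v ⊎-dec arc? o v u))
  ×-dec all? (λ u → all? λ v → arc? o u v →-dec ¬? (arc? o v u))
  where open SimpleGraph G

-- Warshall's algorithm: Walk ws u v holds when there is a nonempty directed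
-- walk from u to v all of whose interior vertices lie in ws.
module _ {n : ℕ} (o : Digraph n) where

  Walk : List (Fin n) → Rel (Fin n) 0ℓ
  Walk []       u v = Arc o u v
  Walk (w ∷ ws) u v = Walk ws u v ⊎ (Walk ws u w × Walk ws w v)

  walk? : ∀ ws → Decidable (Walk ws)
  walk? []       u v = arc? o u v
  walk? (w ∷ ws) u v = walk? ws u v ⊎-dec (walk? ws u w ×-dec walk? ws w v)

  walk⇒⁺ : ∀ ws {u v} → Walk ws u v → TransClosure (Arc o) u v
  walk⇒⁺ []       a              = [ a ]⁺
  walk⇒⁺ (w ∷ ws) (inj₁ p)       = walk⇒⁺ ws p
  walk⇒⁺ (w ∷ ws) (inj₂ (p , q)) = walk⇒⁺ ws p ++ walk⇒⁺ ws q

  arc⇒walk : ∀ ws {u v} → Arc o u v → Walk ws u v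
  arc⇒walk []       a = a
  arc⇒walk (w ∷ ws) a = inj₁ (arc⇒walk ws a)

  join : ∀ ws {u v w} → w ∈ ws → Walk ws u w → Walk ws w v → Walk ws u v
  join (x ∷ ws) (here refl) p q = inj₂ (to p , from q)
    where
    to : ∀ {u} → Walk (x ∷ ws) u x → Walk ws u x
    to (inj₁ p)       = p
    to (inj₂ (p , _)) = p
    from : ∀ {v} → Walk (x ∷ ws) x v → Walk ws x v
    from (inj₁ p)       = p
    from (inj₂ (_ , p)) = p
  join (x ∷ ws) (there i) (inj₁ p)       (inj₁ q)       = inj₁ (join ws i p q)
  join (x ∷ ws) (there i) (inj₁ p)       (inj₂ (q , s)) = inj₂ (join ws i p q , s)
  join (x ∷ ws) (there i) (inj₂ (p , q)) (inj₁ s)       = inj₂ (p , join ws i q s)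
  join (x ∷ ws) (there i) (inj₂ (p , _)) (inj₂ (_ , s)) = inj₂ (p , s)

  ⁺⇒walk : ∀ {u v} → TransClosure (Arc o) u v → Walk (allFin n) u v
  ⁺⇒walk [ a ]⁺  = arc⇒walk (allFin n) a
  ⁺⇒walk (a ∷ p) = join (allFin n) (∈-allFin _) (arc⇒walk (allFin n) a) (⁺⇒walk p)

  acyclic? : Dec (Acyclic o)
  acyclic? = all? λ v → ¬? (map′ (walk⇒⁺ (allFin n)) ⁺⇒walk (walk? (allFin n) v v))

allVecs : ∀ {A : Set} → List A → ∀ n → List (Vec A n)
allVecs xs zero    = Vec.[] ∷ []
allVecs xs (suc n) = cartesianProductWith Vec._∷_ xs (allVecs xs n)

allDigraphs : ∀ n → List (Digraph n)
allDigraphs n = allVecs (allVecs (true ∷ false ∷ []) n) n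

#acyclicOrientations : ∀ {n} → SimpleGraph n → ℕ
#acyclicOrientations {n} G =
  length (filter (λ o → isOrientation? G o ×-dec acyclic? o) (allDigraphs n))

-- The vertices are numbered part by part; part ks v is the part containing v.
part : ∀ ks → Fin (sum ks) → Fin (length ks)
part (k ∷ ks) v = [ const zero , suc ∘ part ks ]′ (splitAt k v)

completeMultipartite : (ks : List ℕ) → SimpleGraph (sum ks)
completeMultipartite ks = record
  { Adj        = λ u v → part ks u ≢ part ks v
  ; adj?       = λ u v → ¬? (part ks u Fin.≟ part ks v)
  ; adj-sym    = ≢-sym
  ; adj-irrefl = λ u≡v p≢p → p≢p (cong (part ks) u≡v)
  }

-- An index j : Fin m stands for the size suc (toℕ j), so that r j is the number
-- of parts of that size.
size : ∀ {m} → Fin m → ℕ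
size j = suc (toℕ j)

partSizes : ∀ {m} → (Fin m → ℕ) → List ℕ
partSizes r = concat (tabulate λ j → replicate (r j) (size j))

D : ∀ {m} → (Fin m → ℕ) → ℕ
D r = #acyclicOrientations (completeMultipartite (partSizes r))

N : ∀ {m} → (Fin m → ℕ) → ℕ
N r = ∑ℕ λ j → size j ℕ.* r j

-- The factors j - 2 and 3 j - 5 can be negative, hence integer arithmetic.
A B E : ℕ → ℚ
A k = (ℤ.- (j ℤ.* (j ℤ.- + 1))) / 2
  where j = + k
B k = (j ℤ.* (j ℤ.- + 1) ℤ.* (j ℤ.- + 2) ℤ.* (+ 3 ℤ.* j ℤ.- + 5)) / 24
  where j = + k
E k = B k - A k ^ 2 * ½

μ₁ μ₂ : ∀ {m} (r : Fin m → ℕ) .{{_ : NonZero (N r)}} → ℚ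
μ₁ r = (+ 1 / N r) * ∑ℚ λ j → (+ r j / 1) * A (size j)
μ₂ r = (+ 1 / N r) * ∑ℚ λ j → (+ r j / 1) * E (size j)

private
  open +-*-Solver using (solve; _:+_; _:*_; _:-_; :-_; _:=_; con)

  fromℚᵘ-homo-* : ∀ p q → fromℚᵘ (p ℚᵘ.* q) ≡ fromℚᵘ p * fromℚᵘ q
  fromℚᵘ-homo-* p q = toℚᵘ-injective (ℚᵘ.≃-trans (toℚᵘ-fromℚᵘ (p ℚᵘ.* q))
    (ℚᵘ.≃-sym (ℚᵘ.≃-trans (toℚᵘ-homo-* (fromℚᵘ p) (fromℚᵘ q))
      (ℚᵘ.*-cong (toℚᵘ-fromℚᵘ p) (toℚᵘ-fromℚᵘ q)))))

  fromℚᵘ-homo-+ : ∀ p q → fromℚᵘ (p ℚᵘ.+ q) ≡ fromℚᵘ p + fromℚᵘ q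
  fromℚᵘ-homo-+ p q = toℚᵘ-injective (ℚᵘ.≃-trans (toℚᵘ-fromℚᵘ (p ℚᵘ.+ q))
    (ℚᵘ.≃-sym (ℚᵘ.≃-trans (toℚᵘ-homo-+ (fromℚᵘ p) (fromℚᵘ q))
      (ℚᵘ.+-cong (toℚᵘ-fromℚᵘ p) (toℚᵘ-fromℚᵘ q)))))

  ι : ℕ → ℚ
  ι n = + n / 1

  ι-suc : ∀ n → ι (suc n) ≡ ι n + 1ℚ
  ι-suc n = trans (fromℚᵘ-cong {ℚᵘ.mkℚᵘ (+ suc n) 0} {ℚᵘ.mkℚᵘ (+ n) 0 ℚᵘ.+ ℚᵘ.1ℚᵘ}
      (ℚᵘ.*≡* (cong (ℤ._* + 1) (trans (cong +_ (ℕ.+-comm 1 n))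
        (cong (ℤ._+ + 1) (sym (ℤ.*-identityʳ (+ n))))))))
    (fromℚᵘ-homo-+ (ℚᵘ.mkℚᵘ (+ n) 0) ℚᵘ.1ℚᵘ)

  1/-homo-* : ∀ a b .{{_ : NonZero a}} .{{_ : NonZero b}} .{{_ : NonZero (a ℕ.* b)}} →
              + 1 / (a ℕ.* b) ≡ (+ 1 / a) * (+ 1 / b)
  1/-homo-* (suc a) (suc b) = fromℚᵘ-homo-* (ℚᵘ.mkℚᵘ (+ 1) a) (ℚᵘ.mkℚᵘ (+ 1) b)

  1/-inverse : ∀ n → (+ 1 / suc n) * ι (suc n) ≡ 1ℚ
  1/-inverse n = trans (sym (fromℚᵘ-homo-* u v)) (fromℚᵘ-cong {u ℚᵘ.* v} {ℚᵘ.1ℚᵘ}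
    (ℚᵘ.*≡* (trans (ℤ.*-identityʳ (+ 1 ℤ.* + suc n))
      (trans (ℤ.*-identityˡ (+ suc n)) (sym (trans (ℤ.*-identityˡ _) (ℤ.*-identityʳ (+ suc n))))))))
    where
    u = ℚᵘ.mkℚᵘ (+ 1) n
    v = ℚᵘ.mkℚᵘ (+ suc n) 0

  0≤ι : ∀ n → 0ℚ ≤ ι n
  0≤ι n = nonNegative⁻¹ (ι n) {{normalize-nonNeg n 1}}

  0≤1/ : ∀ n → 0ℚ ≤ + 1 / suc n
  0≤1/ n = nonNegative⁻¹ (+ 1 / suc n) {{normalize-nonNeg 1 (suc n)}}

  ι-mono : ∀ d k → ι k ≤ ι (d ℕ.+ k)
  ι-mono zero    k = ≤-refl
  ι-mono (suc d) k = ≤-trans (ι-mono d k) (subst₂ _≤_ (+-identityʳ _) (sym (ι-suc (d ℕ.+ k)))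
    (+-monoʳ-≤ (ι (d ℕ.+ k)) (nonNegative⁻¹ 1ℚ)))

  archimedean : ∀ p → ∃[ k ] p ≤ ι k
  archimedean p@(mkℚ (+ a) d _) = a , toℚᵘ-cancel-≤ (ℚᵘ.≤-respʳ-≃
    (ℚᵘ.≃-sym (toℚᵘ-fromℚᵘ (ℚᵘ.mkℚᵘ (+ a) 0)))
    (ℚᵘ.*≤* (ℤ.*-monoˡ-≤-nonNeg (+ a) (ℤ.+≤+ (ℕ.s≤s ℕ.z≤n)))))
  archimedean p@(mkℚ ℤ.-[1+ a ] d _) = 0 , <⇒≤ (negative⁻¹ p)

  *-monoˡ-≤ : ∀ {r p q} → 0ℚ ≤ r → p ≤ q → r * p ≤ r * q
  *-monoˡ-≤ {r} 0≤r = *-monoˡ-≤-nonNeg r {{nonNegative 0≤r}}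

  ∣-∣-swap : ∀ p q → ∣ p - q ∣ ≡ ∣ q - p ∣
  ∣-∣-swap p q = trans (sym (∣-p∣≡∣p∣ (p - q)))
    (cong ∣_∣ (solve 2 (λ p q → :- (p :- q) := q :- p) refl p q))

  ∣p∣≤∣p-q∣+∣q∣ : ∀ p q → ∣ p ∣ ≤ ∣ p - q ∣ + ∣ q ∣
  ∣p∣≤∣p-q∣+∣q∣ p q = subst (λ z → ∣ z ∣ ≤ ∣ p - q ∣ + ∣ q ∣)
    (solve 2 (λ p q → (p :- q) :+ q := p) refl p q) (∣p+q∣≤∣p∣+∣q∣ (p - q) q)

  ∣p∣-∣q∣≤∣p-q∣ : ∀ p q → ∣ p ∣ - ∣ q ∣ ≤ ∣ p - q ∣
  ∣p∣-∣q∣≤∣p-q∣ p q = subst (∣ p ∣ - ∣ q ∣ ≤_)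
    (solve 2 (λ a b → (a :+ b) :- b := a) refl ∣ p - q ∣ ∣ q ∣)
    (+-monoˡ-≤ (- ∣ q ∣) (∣p∣≤∣p-q∣+∣q∣ p q))

  ∣∣p∣-∣q∣∣≤∣p-q∣ : ∀ p q → ∣ ∣ p ∣ - ∣ q ∣ ∣ ≤ ∣ p - q ∣
  ∣∣p∣-∣q∣∣≤∣p-q∣ p q with ∣p∣≡p∨∣p∣≡-p (∣ p ∣ - ∣ q ∣)
  ... | inj₁ eq = subst (_≤ ∣ p - q ∣) (sym eq) (∣p∣-∣q∣≤∣p-q∣ p q)
  ... | inj₂ eq = subst₂ _≤_
    (sym (trans eq (solve 2 (λ a b → :- (a :- b) := b :- a) refl ∣ p ∣ ∣ q ∣)))
    (∣-∣-swap q p) (∣p∣-∣q∣≤∣p-q∣ q p)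

-- Real numbers are Cauchy sequences of rationals; they are compared by _≈ᴿ_.
IsCauchy : (ℕ → ℚ) → Set
IsCauchy x = ∀ ε → 0ℚ < ε → ∃[ K ] ∀ i j → K ℕ.≤ i → K ℕ.≤ j → ∣ x i - x j ∣ < ε

record ℝ : Set where
  constructor mkℝ
  field
    seq    : ℕ → ℚ
    cauchy : IsCauchy seq

open ℝ public

infix  4 _≈ᴿ_ _≤ᴿ_
infixl 6 _+ᴿ_
infixl 7 _*ᴿ_

_≈ᴿ_ : Rel ℝ 0ℓ
x ≈ᴿ y = ∀ ε → 0ℚ < ε → ∃[ K ] ∀ i → K ℕ.≤ i → ∣ seq x i - seq y i ∣ < ε

_≤ᴿ_ : Rel ℝ 0ℓ
x ≤ᴿ y = ∀ ε → 0ℚ < ε → ∃[ K ] ∀ i → K ℕ.≤ i → seq x i ≤ seq y i + ε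

private
  cauchy-const : ∀ p → IsCauchy (const p)
  cauchy-const p ε 0<ε = 0 , λ _ _ _ _ → subst (_< ε) (cong ∣_∣ (sym (+-inverseʳ p))) 0<ε

  0<½ε : ∀ {ε} → 0ℚ < ε → 0ℚ < ε * ½
  0<½ε {ε} 0<ε = subst (_< ε * ½) (*-zeroˡ ½) (*-monoˡ-<-pos ½ 0<ε)

  cauchy-+ : ∀ x y → IsCauchy x → IsCauchy y → IsCauchy (λ i → x i + y i)
  cauchy-+ x y cx cy ε 0<ε with cx (ε * ½) (0<½ε 0<ε) | cy (ε * ½) (0<½ε 0<ε)
  ... | K , hx | L , hy = K ℕ.⊔ L , λ i j Ki Kj →
    ≤-<-trans
      (subst (_≤ ∣ x i - x j ∣ + ∣ y i - y j ∣)
        (cong ∣_∣ (solve 4 (λ a b c d → (a :- b) :+ (c :- d) := (a :+ c) :- (b :+ d))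
                     refl (x i) (x j) (y i) (y j)))
        (∣p+q∣≤∣p∣+∣q∣ (x i - x j) (y i - y j)))
      (subst (∣ x i - x j ∣ + ∣ y i - y j ∣ <_)
        (solve 1 (λ e → e :* con ½ :+ e :* con ½ := e) refl ε)
        (+-mono-< (hx i j (ℕ.m⊔n≤o⇒m≤o K L Ki) (ℕ.m⊔n≤o⇒m≤o K L Kj))
                  (hy i j (ℕ.m⊔n≤o⇒n≤o K L Ki) (ℕ.m⊔n≤o⇒n≤o K L Kj))))

  cauchy-∣∣ : ∀ x → IsCauchy x → IsCauchy (λ i → ∣ x i ∣)
  cauchy-∣∣ x cx ε 0<ε with cx ε 0<ε
  ... | K , hx = K , λ i j Ki Kj → ≤-<-trans (∣∣p∣-∣q∣∣≤∣p-q∣ (x i) (x j)) (hx i j Ki Kj)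

  eventually-bounded : ∀ x → IsCauchy x →
    ∃[ b ] 0ℚ < b × ∃[ K ] ∀ i → K ℕ.≤ i → ∣ x i ∣ ≤ b
  eventually-bounded x cx with cx 1ℚ (positive⁻¹ 1ℚ)
  ... | K , hx = 1ℚ + ∣ x K ∣
    , <-≤-trans (positive⁻¹ 1ℚ) (subst (_≤ 1ℚ + ∣ x K ∣) (+-identityʳ 1ℚ)
                                   (+-monoʳ-≤ 1ℚ (0≤∣p∣ (x K))))
    , K
    , λ i Ki → ≤-trans (∣p∣≤∣p-q∣+∣q∣ (x i) (x K))
                 (+-monoˡ-≤ ∣ x K ∣ (<⇒≤ (hx i K Ki ℕ.≤-refl)))

  divide : ∀ ε s → 0ℚ < ε → 0ℚ < s → ∃[ δ ] 0ℚ < δ × s * δ ≡ ε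
  divide ε s 0<ε 0<s = s⁻¹ * ε
    , positive⁻¹ (s⁻¹ * ε) {{pos*pos⇒pos s⁻¹ {{1/pos⇒pos s {{s>0}}}} ε {{positive 0<ε}}}}
    , trans (sym (*-assoc s s⁻¹ ε))
        (trans (cong (_* ε) (*-inverseʳ s {{pos⇒nonZero s {{s>0}}}})) (*-identityˡ ε))
    where
    s>0 : Positive s
    s>0 = positive 0<s
    s⁻¹ : ℚ
    s⁻¹ = (1/ s) {{pos⇒nonZero s {{s>0}}}}

  0<p+q : ∀ {p q} → 0ℚ < p → 0ℚ < q → 0ℚ < p + q
  0<p+q {p} {q} = +-mono-< {0ℚ} {p} {0ℚ} {q}

  split-* : ∀ a b c d → a * c - b * d ≡ a * (c - d) + d * (a - b)
  split-* = solve 4 (λ a b c d → a :* c :- b :* d := a :* (c :- d) :+ d :* (a :- b)) refl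

  cauchy-* : ∀ x y → IsCauchy x → IsCauchy y → IsCauchy (λ i → x i * y i)
  cauchy-* x y cx cy ε 0<ε =
    let a , 0<a , K , hx = eventually-bounded x cx
        b , 0<b , L , hy = eventually-bounded y cy
        δ , 0<δ , eq = divide ε (a + b) 0<ε (0<p+q 0<a 0<b)
    in go K L a b δ 0<a 0<b hx hy eq (cx δ 0<δ) (cy δ 0<δ)
    where
    go : ∀ K L a b δ → 0ℚ < a → 0ℚ < b →
         (∀ i → K ℕ.≤ i → ∣ x i ∣ ≤ a) → (∀ i → L ℕ.≤ i → ∣ y i ∣ ≤ b) →
         (a + b) * δ ≡ ε →
         (∃[ K ] ∀ i j → K ℕ.≤ i → K ℕ.≤ j → ∣ x i - x j ∣ < δ) →
         (∃[ K ] ∀ i j → K ℕ.≤ i → K ℕ.≤ j → ∣ y i - y j ∣ < δ) →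
         ∃[ K ] ∀ i j → K ℕ.≤ i → K ℕ.≤ j → ∣ x i * y i - x j * y j ∣ < ε
    go K L a b δ 0<a 0<b hx hy [a+b]δ≡ε (K′ , hx′) (L′ , hy′) = K ℕ.⊔ L ℕ.⊔ (K′ ℕ.⊔ L′) , bound
      where
      bound : ∀ i j → K ℕ.⊔ L ℕ.⊔ (K′ ℕ.⊔ L′) ℕ.≤ i → K ℕ.⊔ L ℕ.⊔ (K′ ℕ.⊔ L′) ℕ.≤ j →
              ∣ x i * y i - x j * y j ∣ < ε
      bound i j Mi Mj = ≤-<-trans (≤-reflexive (cong ∣_∣ split))
        (≤-<-trans (∣p+q∣≤∣p∣+∣q∣ (x i * (y i - y j)) (y j * (x i - x j)))
          (subst₂ _<_
            (cong₂ _+_ (sym (∣p*q∣≡∣p∣*∣q∣ (x i) (y i - y j)))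
                       (sym (∣p*q∣≡∣p∣*∣q∣ (y j) (x i - x j))))
            (trans (sym (*-distribʳ-+ δ a b)) [a+b]δ≡ε)
            (+-mono-< (<bound 0<a (hx i Ki) (hy′ i j L′i L′j))
                      (<bound 0<b (hy j Lj) (hx′ i j K′i K′j)))))
        where
        Ki  = ℕ.m⊔n≤o⇒m≤o K L (ℕ.m⊔n≤o⇒m≤o (K ℕ.⊔ L) (K′ ℕ.⊔ L′) Mi)
        Lj  = ℕ.m⊔n≤o⇒n≤o K L (ℕ.m⊔n≤o⇒m≤o (K ℕ.⊔ L) (K′ ℕ.⊔ L′) Mj)
        K′i = ℕ.m⊔n≤o⇒m≤o K′ L′ (ℕ.m⊔n≤o⇒n≤o (K ℕ.⊔ L) (K′ ℕ.⊔ L′) Mi)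
        K′j = ℕ.m⊔n≤o⇒m≤o K′ L′ (ℕ.m⊔n≤o⇒n≤o (K ℕ.⊔ L) (K′ ℕ.⊔ L′) Mj)
        L′i = ℕ.m⊔n≤o⇒n≤o K′ L′ (ℕ.m⊔n≤o⇒n≤o (K ℕ.⊔ L) (K′ ℕ.⊔ L′) Mi)
        L′j = ℕ.m⊔n≤o⇒n≤o K′ L′ (ℕ.m⊔n≤o⇒n≤o (K ℕ.⊔ L) (K′ ℕ.⊔ L′) Mj)
        split : x i * y i - x j * y j ≡ x i * (y i - y j) + y j * (x i - x j)
        split = split-* (x i) (x j) (y i) (y j)
        <bound : ∀ {p q c} → 0ℚ < c → ∣ p ∣ ≤ c → ∣ q ∣ < δ → ∣ p ∣ * ∣ q ∣ < c * δ
        <bound {p} {q} {c} 0<c p≤c q<δ = ≤-<-trans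
          (*-monoʳ-≤-nonNeg ∣ q ∣ {{∣-∣-nonNeg q}} p≤c) (*-monoʳ-<-pos c {{positive 0<c}} q<δ)

⟦_⟧ : ℚ → ℝ
⟦ p ⟧ = mkℝ (const p) (cauchy-const p)

_+ᴿ_ _*ᴿ_ : ℝ → ℝ → ℝ
mkℝ x cx +ᴿ mkℝ y cy = mkℝ (λ i → x i + y i) (cauchy-+ x y cx cy)
mkℝ x cx *ᴿ mkℝ y cy = mkℝ (λ i → x i * y i) (cauchy-* x y cx cy)

∣_∣ᴿ : ℝ → ℝ
∣ mkℝ x cx ∣ᴿ = mkℝ (λ i → ∣ x i ∣) (cauchy-∣∣ x cx)

expTerm : ℚ → ℕ → ℚ
expTerm p i = p ^ i * (+ 1 / i !) {{i !≢0}}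

-- The sum of expTerm p i over i < n.
expSum : ℚ → ℕ → ℚ
expSum p zero    = 0ℚ
expSum p (suc n) = expSum p n + expTerm p n

private
  module ExpCauchy (p : ℚ) where

    t : ℕ → ℚ
    t n = ∣ expTerm p n ∣

    0≤t : ∀ n → 0ℚ ≤ t n
    0≤t n = 0≤∣p∣ (expTerm p n)

    expTerm-suc : ∀ n → expTerm p (suc n) ≡ (+ 1 / suc n) * p * expTerm p n
    expTerm-suc n = trans
      (cong (p * p ^ n *_) (1/-homo-* (suc n) (n !) {{_}} {{n !≢0}} {{suc n !≢0}}))
      (solve 4 (λ a b c d → a :* b :* (c :* d) := c :* a :* (b :* d)) refl
        p (p ^ n) (+ 1 / suc n) ((+ 1 / n !) {{n !≢0}}))

    ratio : ∀ n → t (suc n) ≡ (+ 1 / suc n) * ∣ p ∣ * t n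
    ratio n = trans (cong ∣_∣ (expTerm-suc n))
      (trans (∣p*q∣≡∣p∣*∣q∣ ((+ 1 / suc n) * p) (expTerm p n))
        (cong (_* t n) (trans (∣p*q∣≡∣p∣*∣q∣ (+ 1 / suc n) p)
          (cong (_* ∣ p ∣) (0≤p⇒∣p∣≡p {+ 1 / suc n} (0≤1/ n))))))

    module _ (k : ℕ) (2∣p∣≤k : ∣ p ∣ + ∣ p ∣ ≤ ι k) where

      halving : ∀ d → t (suc (d ℕ.+ k)) + t (suc (d ℕ.+ k)) ≤ t (d ℕ.+ k)
      halving d = subst₂ _≤_
        (sym (trans (cong (λ z → z + z) (ratio n))
          (solve 3 (λ i q s → i :* q :* s :+ i :* q :* s := s :* (i :* (q :+ q))) refl
            (+ 1 / suc n) ∣ p ∣ (t n))))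
        (trans (cong (t n *_) (1/-inverse n)) (*-identityʳ (t n)))
        (*-monoˡ-≤ (0≤t n) (*-monoˡ-≤ {+ 1 / suc n} (0≤1/ n)
          (≤-trans 2∣p∣≤k (ι-mono (suc d) k))))
        where n = d ℕ.+ k

      decay : ∀ j → ι (suc j) * t (j ℕ.+ k) ≤ t k
      decay zero    = ≤-reflexive (*-identityˡ (t k))
      decay (suc j) = ≤-trans
        (subst (λ z → z * t′ ≤ ι (suc j) * (t′ + t′)) (sym (ι-suc (suc j)))
          (subst₂ _≤_ (sym (*-distribʳ-+ t′ (ι (suc j)) 1ℚ)) (sym (*-distribˡ-+ (ι (suc j)) t′ t′))
            (+-monoʳ-≤ (ι (suc j) * t′)
              (*-monoʳ-≤-nonNeg t′ {{nonNegative (0≤t (suc j ℕ.+ k))}}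
                (subst (λ z → 1ℚ ≤ ι z) (ℕ.+-comm j 1) (ι-mono j 1))))))
        (≤-trans (*-monoˡ-≤ (0≤ι (suc j)) (halving j)) (decay j))
        where t′ = t (suc j ℕ.+ k)

      telescope : ∀ e d → let m = e ℕ.+ k in
        ∣ expSum p (d ℕ.+ m) - expSum p m ∣ ≤ (t m + t m) - (t (d ℕ.+ m) + t (d ℕ.+ m))
      telescope e zero    = ≤-reflexive (trans (cong ∣_∣ (+-inverseʳ (expSum p m)))
        (sym (+-inverseʳ (t m + t m))))
        where m = e ℕ.+ k
      telescope e (suc d) = ≤-trans
        (subst (λ z → ∣ z ∣ ≤ ∣ S - expSum p m ∣ + t n)
          (solve 3 (λ a b c → (a :- b) :+ c := (a :+ c) :- b) refl S (expSum p m) (expTerm p n))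
          (∣p+q∣≤∣p∣+∣q∣ (S - expSum p m) (expTerm p n)))
        (≤-trans (+-monoˡ-≤ (t n) (telescope e d))
          (subst (_≤ (t m + t m) - (t (suc n) + t (suc n)))
            (solve 2 (λ a b → a :- b := (a :- (b :+ b)) :+ b) refl (t m + t m) (t n))
            (+-monoʳ-≤ (t m + t m) (neg-antimono-≤
              (subst (λ z → t (suc z) + t (suc z) ≤ t z) (ℕ.+-assoc d e k) (halving (d ℕ.+ e)))))))
        where
        m = e ℕ.+ k
        n = d ℕ.+ m
        S = expSum p n

      tail : ∀ e i → e ℕ.+ k ℕ.≤ i →
        ∣ expSum p i - expSum p (e ℕ.+ k) ∣ ≤ t (e ℕ.+ k) + t (e ℕ.+ k)
      tail e i m≤i = subst (λ z → ∣ expSum p z - expSum p m ∣ ≤ t m + t m) (ℕ.m∸n+n≡m m≤i)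
        (≤-trans (telescope e d) (subst ((t m + t m) - (t n + t n) ≤_) (+-identityʳ (t m + t m))
          (+-monoʳ-≤ (t m + t m) (neg-antimono-≤ (+-mono-≤ (0≤t n) (0≤t n))))))
        where
        m = e ℕ.+ k
        d = i ℕ.∸ m
        n = d ℕ.+ m

      cauchy-from : ∀ ε → 0ℚ < ε → ∀ J → (t k + t k) + (t k + t k) ≤ ε * ι J →
        ∀ i j → J ℕ.+ k ℕ.≤ i → J ℕ.+ k ℕ.≤ j → ∣ expSum p i - expSum p j ∣ < ε
      cauchy-from ε 0<ε J 4t≤εJ i j m≤i m≤j = ≤-<-trans
        (≤-trans
          (subst (λ z → ∣ z ∣ ≤ ∣ S i - S m ∣ + ∣ S m - S j ∣)
            (solve 3 (λ a b c → (a :- b) :+ (b :- c) := a :- c) refl (S i) (S m) (S j))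
            (∣p+q∣≤∣p∣+∣q∣ (S i - S m) (S m - S j)))
          (+-mono-≤ (tail J i m≤i)
            (subst (_≤ t m + t m) (∣-∣-swap (S j) (S m)) (tail J j m≤j))))
        (*-cancelˡ-<-nonNeg (ι (suc J)) {{nonNegative (0≤ι (suc J))}}
          (≤-<-trans
            (subst (_≤ (t k + t k) + (t k + t k))
              (solve 2 (λ a b → (a :* b :+ a :* b) :+ (a :* b :+ a :* b)
                             := a :* ((b :+ b) :+ (b :+ b))) refl (ι (suc J)) (t m))
              (+-mono-≤ (+-mono-≤ (decay J) (decay J)) (+-mono-≤ (decay J) (decay J))))
            (≤-<-trans 4t≤εJ
              (subst₂ _<_ (*-comm (ι J) ε) (cong (_* ε) (sym (ι-suc J)))
                (*-monoˡ-<-pos ε {{positive 0<ε}}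
                  (subst (_< ι J + 1ℚ) (+-identityʳ (ι J))
                    (+-monoʳ-< (ι J) (positive⁻¹ 1ℚ))))))))
        where
        S = expSum p
        m = J ℕ.+ k

    expSum-cauchy : IsCauchy (expSum p)
    expSum-cauchy ε 0<ε = go (archimedean (∣ p ∣ + ∣ p ∣))
      where
      ε≢0 : ℚ.NonZero ε
      ε≢0 = pos⇒nonZero ε {{positive 0<ε}}
      ε⁻¹ : ℚ
      ε⁻¹ = (1/ ε) {{ε≢0}}
      scale : ∀ c → ε * (c * ε⁻¹) ≡ c
      scale c = trans (solve 3 (λ e c i → e :* (c :* i) := c :* (e :* i)) refl ε c ε⁻¹)
        (trans (cong (c *_) (*-inverseʳ ε {{ε≢0}})) (*-identityʳ c))
      go : ∃[ k ] ∣ p ∣ + ∣ p ∣ ≤ ι k →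
           ∃[ K ] ∀ i j → K ℕ.≤ i → K ℕ.≤ j → ∣ expSum p i - expSum p j ∣ < ε
      go (k , h) = let c = (t k + t k) + (t k + t k) ; J , h′ = archimedean (c * ε⁻¹) in
        J ℕ.+ k , cauchy-from k h ε 0<ε J (subst (_≤ ε * ι J) (scale c) (*-monoˡ-≤ (<⇒≤ 0<ε) h′))

exp : ℚ → ℝ
exp p = mkℝ (expSum p) (ExpCauchy.expSum-cauchy p)

{-# OPTIONS --safe #-}

-- The sources of an acyclic orientation of G[X] form a nonempty independent set, so
-- inclusion-exclusion over the sets S of sources gives
--   Σ_{S ⊆ X independent} (-1)^|S| a(X ∖ S) = 0   (X ≠ ∅)
-- for the number a(X) of acyclic orientations. For a complete multipartite graph this is
-- solved by a = L(∏ᵢ P_(nᵢ)), where nᵢ are the part sizes, L is the functional t^k ↦ k!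
-- and P_n(t) = Σⱼ (-1)^(n-j) S(n,j) t^j, because Σ_s C(n,s) (-1)^s P_(n-s) = P_n - P_n′
-- and L(f - f′) = f(0).
--
-- Put ν = 1/N and x^n P_n(1/x) = 1 + A_n x + B_n x² + ⋯. Then D/N! is obtained from
-- ∏ᵢ (1 + A_(nᵢ) νx + B_(nᵢ) ν²x² + ⋯) by replacing x^k with v_k = N^k (N-k)!/N!.
-- Each factor is e^(A νx) (1 + E ν²x² + O(ν³)) in the operator norm on sequences of growth
-- 4^k, where x acts as the shift; 4^k is a bound for v_k. There are at most N factors, so
-- the product is e^(μ₁x) (1 + μ₂ν x²) + O(ν²), and it remains to insert
-- v_k = 1 + k(k-1)ν/2 + O(16^k ν²).

module Submission where

open import Defs
open import Algebra.Bundles using (CommutativeRing)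
open import Data.Bool using (Bool; true; false; T; not; _∧_; _∨_; if_then_else_)
open import Data.Bool.Properties as Bool using (T?)
open import Data.Empty using (⊥; ⊥-elim)
open import Data.Fin as Fin using (Fin; zero; suc; toℕ; splitAt)
open import Data.Fin.Induction using (spo-wellFounded)
open import Data.Fin.Properties as Fin using (all?; any?)
open import Data.Integer as ℤ using (ℤ; +_)
import Data.Integer.Properties as ℤ
open import Data.List as List
  using (List; []; _∷_; length; filter; map; _++_; cartesianProductWith; replicate; concat)
open import Data.List.Relation.Unary.All as All using (All; []; _∷_)
import Data.List.Relation.Unary.All.Properties as All
open import Data.Nat as ℕ using (ℕ; zero; suc; NonZero; _!)
open import Data.Nat.Induction using (<-wellFounded)
open import Data.Nat.ListAction using (sum)
open import Data.Nat.ListAction.Properties using (sum-++)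
import Data.Nat.Properties as ℕ
open import Data.Nat.Tactic.RingSolver using () renaming (solve-∀ to ℕ-solve-∀)
open import Data.Product using (∃-syntax; _×_; _,_; proj₁; proj₂; uncurry)
open import Data.Rational as ℚ hiding (NonZero)
open import Data.Rational.Properties
import Data.Rational.Unnormalised as ℚᵘ
import Data.Rational.Unnormalised.Properties as ℚᵘ
open import Data.Sum using (_⊎_; inj₁; inj₂; [_,_]′)
open import Data.Unit using (tt)
open import Data.Vec as Vec using (Vec; []; _∷_; lookup; tabulate; zipWith; take; drop)
import Data.Vec.Properties as Vec
open import Function using (_∘_; const)
open import Induction.WellFounded using (Acc; acc)
open import Level using (0ℓ)
open import Relation.Binary using (IsStrictPartialOrder; Decidable)
open import Relation.Binary.Construct.Closure.Transitive
  using (TransClosure) renaming ([_] to [_]⁺; _∷_ to _∷⁺_; _++_ to _++⁺_)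
open import Relation.Binary.PropositionalEquality
open import Relation.Nullary using (Dec; yes; no; does; ¬_; ¬?; contradiction)
open import Relation.Nullary.Decidable
  using (_×-dec_; _⊎-dec_; _→-dec_; decidable-stable; dec⇒maybe)
open import Tactic.RingSolver using (solve-∀)
open import Tactic.RingSolver.Core.AlmostCommutativeRing
  using (AlmostCommutativeRing; fromCommutativeRing)

open import Algebra.Properties.Monoid.Sum ℕ.+-0-monoid using () renaming (sum to ∑ℕ)
open import Algebra.Properties.Monoid.Sum +-0-monoid using () renaming (sum to ∑ℚ)
open import Algebra.Properties.Semiring.Exp
  (CommutativeRing.semiring +-*-commutativeRing) using (_^_)

-- The recurrence for L is proved by induction over the parts. Expanding one factor P_n multiplies
-- what is left by powers of t, so every statement about L carries an arbitrary extra factor t^k.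
--
-- The analysis is arithmetic with finite rational sums. Since v_k is continued by 0 beyond N, power
-- series in the shift may be truncated there and still compose without error; limits enter only at
-- the end, through partial sums of e^(μ₁).
--
-- An error O(ν³) per factor adds up to O(ν²) only while the partial products stay bounded, and that
-- bound follows from the error estimate for the factors treated before. Both are therefore obtained
-- in one induction. The error feeds back into itself with a factor ν, which a large N absorbs.
--
-- Uniformity in r: all constants are built from finitely many quantities attached to sizes n ≤ m,
-- and from a bound for the partial sums of e^(16a), where a ≥ |A_n| for all n ≤ m. The 16 is the
-- growth rate of the second-order error of v_k. Means over the parts, of which there are at most N,
-- obey the same bounds as single sizes.

ℚ-ring : AlmostCommutativeRing 0ℓ 0ℓ
ℚ-ring = fromCommutativeRing +-*-commutativeRing (λ x → dec⇒maybe (0ℚ ≟ x))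

-- Embedding of the integers

fromℚᵘ-homo-+ : ∀ p q → fromℚᵘ (p ℚᵘ.+ q) ≡ fromℚᵘ p + fromℚᵘ q
fromℚᵘ-homo-+ p q = toℚᵘ-injective (ℚᵘ.≃-trans (toℚᵘ-fromℚᵘ (p ℚᵘ.+ q))
  (ℚᵘ.≃-sym (ℚᵘ.≃-trans (toℚᵘ-homo-+ (fromℚᵘ p) (fromℚᵘ q))
    (ℚᵘ.+-cong (toℚᵘ-fromℚᵘ p) (toℚᵘ-fromℚᵘ q)))))

fromℚᵘ-homo-* : ∀ p q → fromℚᵘ (p ℚᵘ.* q) ≡ fromℚᵘ p * fromℚᵘ q
fromℚᵘ-homo-* p q = toℚᵘ-injective (ℚᵘ.≃-trans (toℚᵘ-fromℚᵘ (p ℚᵘ.* q))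
  (ℚᵘ.≃-sym (ℚᵘ.≃-trans (toℚᵘ-homo-* (fromℚᵘ p) (fromℚᵘ q))
    (ℚᵘ.*-cong (toℚᵘ-fromℚᵘ p) (toℚᵘ-fromℚᵘ q)))))

-- Opaque, since unification would otherwise unfold the gcd computation in i / 1.
opaque
  ιℤ : ℤ → ℚ
  ιℤ i = i / 1

ι : ℕ → ℚ
ι n = ιℤ (+ n)

opaque
  unfolding ιℤ

  ιℤ≡/1 : ∀ i → ιℤ i ≡ i / 1
  ιℤ≡/1 i = refl

  ι-0 : ι 0 ≡ 0ℚ
  ι-0 = refl

  ι-1 : ι 1 ≡ 1ℚ
  ι-1 = refl

  ιℤ-+ : ∀ i j → ιℤ (i ℤ.+ j) ≡ ιℤ i + ιℤ j
  ιℤ-+ i j = trans (fromℚᵘ-cong {ℚᵘ.mkℚᵘ (i ℤ.+ j) 0} {ℚᵘ.mkℚᵘ i 0 ℚᵘ.+ ℚᵘ.mkℚᵘ j 0}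
    (ℚᵘ.*≡* (cong (ℤ._* + 1) (sym (cong₂ ℤ._+_ (ℤ.*-identityʳ i) (ℤ.*-identityʳ j))))))
    (fromℚᵘ-homo-+ (ℚᵘ.mkℚᵘ i 0) (ℚᵘ.mkℚᵘ j 0))

  ιℤ-* : ∀ i j → ιℤ (i ℤ.* j) ≡ ιℤ i * ιℤ j
  ιℤ-* i j = fromℚᵘ-homo-* (ℚᵘ.mkℚᵘ i 0) (ℚᵘ.mkℚᵘ j 0)

  /≡ιℤ* : ∀ i d .{{_ : ℕ.NonZero d}} → i / d ≡ ιℤ i * (+ 1 / d)
  /≡ιℤ* i (suc d) = trans
    (fromℚᵘ-cong {ℚᵘ.mkℚᵘ i d} {ℚᵘ.mkℚᵘ i 0 ℚᵘ.* ℚᵘ.mkℚᵘ (+ 1) d}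
      (ℚᵘ.*≡* (cong₂ ℤ._*_ (sym (ℤ.*-identityʳ i)) (cong (λ z → + suc z) (ℕ.+-identityʳ d)))))
    (fromℚᵘ-homo-* (ℚᵘ.mkℚᵘ i 0) (ℚᵘ.mkℚᵘ (+ 1) d))

  1/-* : ∀ a b .{{_ : ℕ.NonZero a}} .{{_ : ℕ.NonZero b}} .{{_ : ℕ.NonZero (a ℕ.* b)}} →
         + 1 / (a ℕ.* b) ≡ (+ 1 / a) * (+ 1 / b)
  1/-* (suc a) (suc b) = fromℚᵘ-homo-* (ℚᵘ.mkℚᵘ (+ 1) a) (ℚᵘ.mkℚᵘ (+ 1) b)

  0≤ι : ∀ n → 0ℚ ≤ ι n
  0≤ι n = nonNegative⁻¹ (ι n) {{normalize-nonNeg n 1}}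

  archimedean : ∀ p → ∃[ k ] p ≤ ι k
  archimedean p@(mkℚ (+ a) d _) = a , toℚᵘ-cancel-≤ (ℚᵘ.≤-respʳ-≃
    (ℚᵘ.≃-sym (toℚᵘ-fromℚᵘ (ℚᵘ.mkℚᵘ (+ a) 0)))
    (ℚᵘ.*≤* (ℤ.*-monoˡ-≤-nonNeg (+ a) (ℤ.+≤+ (ℕ.s≤s ℕ.z≤n)))))
  archimedean p@(mkℚ ℤ.-[1+ a ] d _) = 0 , <⇒≤ (negative⁻¹ p)

ιℤ-neg : ∀ i → ιℤ (ℤ.- i) ≡ - ιℤ i
ιℤ-neg i = begin
  ιℤ (ℤ.- i)                       ≡⟨ lem (ιℤ (ℤ.- i)) (ιℤ i) ⟩
  (ιℤ (ℤ.- i) + ιℤ i) - ιℤ i       ≡⟨ cong (_- ιℤ i) (ιℤ-+ (ℤ.- i) i) ⟨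
  ιℤ (ℤ.- i ℤ.+ i) - ιℤ i          ≡⟨ cong (_- ιℤ i) (trans (cong ιℤ (ℤ.+-inverseˡ i)) ι-0) ⟩
  0ℚ - ιℤ i                        ≡⟨ +-identityˡ (- ιℤ i) ⟩
  - ιℤ i                           ∎
  where
  open ≡-Reasoning
  lem : ∀ a b → a ≡ (a + b) - b
  lem = solve-∀ ℚ-ring

ι-+ : ∀ m n → ι (m ℕ.+ n) ≡ ι m + ι n
ι-+ m n = ιℤ-+ (+ m) (+ n)

ι-* : ∀ m n → ι (m ℕ.* n) ≡ ι m * ι n
ι-* m n = trans (cong ιℤ (ℤ.pos-* m n)) (ιℤ-* (+ m) (+ n))

ι-suc : ∀ n → ι (suc n) ≡ 1ℚ + ι n
ι-suc n = trans (ι-+ 1 n) (cong (_+ ι n) ι-1)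

ι-∸ : ∀ {m n} → n ℕ.≤ m → ι (m ℕ.∸ n) ≡ ι m - ι n
ι-∸ {m} {n} n≤m = begin
  ι (m ℕ.∸ n)               ≡⟨ lem (ι (m ℕ.∸ n)) (ι n) ⟩
  (ι (m ℕ.∸ n) + ι n) - ι n ≡⟨ cong (_- ι n) (ι-+ (m ℕ.∸ n) n) ⟨
  ι (m ℕ.∸ n ℕ.+ n) - ι n   ≡⟨ cong (λ z → ι z - ι n) (ℕ.m∸n+n≡m n≤m) ⟩
  ι m - ι n                 ∎
  where
  open ≡-Reasoning
  lem : ∀ a b → a ≡ (a + b) - b
  lem = solve-∀ ℚ-ring

0≤1/ : ∀ n .{{_ : ℕ.NonZero n}} → 0ℚ ≤ + 1 / n
0≤1/ n = nonNegative⁻¹ (+ 1 / n) {{normalize-nonNeg 1 n}}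

ι-mono : ∀ {m n} → m ℕ.≤ n → ι m ≤ ι n
ι-mono {m} {n} m≤n = subst₂ _≤_ (+-identityʳ (ι m))
  (trans (sym (ι-+ m (n ℕ.∸ m))) (cong ι (ℕ.m+[n∸m]≡n m≤n)))
  (+-monoʳ-≤ (ι m) (0≤ι (n ℕ.∸ m)))

1/-inverse : ∀ n .{{_ : ℕ.NonZero n}} → ι n * (+ 1 / n) ≡ 1ℚ
1/-inverse n = trans (sym (/≡ιℤ* (+ n) n)) (n/n≡1 n)
  where
  n/n≡1 : ∀ n .{{_ : ℕ.NonZero n}} → + n / n ≡ 1ℚ
  n/n≡1 (suc n) = fromℚᵘ-cong {ℚᵘ.mkℚᵘ (+ suc n) n} {ℚᵘ.1ℚᵘ}
    (ℚᵘ.*≡* (trans (ℤ.*-identityʳ (+ suc n)) (sym (ℤ.*-identityˡ (+ suc n)))))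

-- Ordered-field inequalities

*-monoˡ-≤ : ∀ {r p q} → 0ℚ ≤ r → p ≤ q → r * p ≤ r * q
*-monoˡ-≤ {r} 0≤r = *-monoˡ-≤-nonNeg r {{nonNegative 0≤r}}

*-monoʳ-≤ : ∀ {r p q} → 0ℚ ≤ r → p ≤ q → p * r ≤ q * r
*-monoʳ-≤ {r} 0≤r = *-monoʳ-≤-nonNeg r {{nonNegative 0≤r}}

*-mono-≤ : ∀ {p q r s} → 0ℚ ≤ r → 0ℚ ≤ q → p ≤ q → r ≤ s → p * r ≤ q * s
*-mono-≤ 0≤r 0≤q p≤q r≤s = ≤-trans (*-monoʳ-≤ 0≤r p≤q) (*-monoˡ-≤ 0≤q r≤s)

0≤p*q : ∀ {p q} → 0ℚ ≤ p → 0ℚ ≤ q → 0ℚ ≤ p * q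
0≤p*q {p} {q} 0≤p 0≤q = subst (_≤ p * q) (*-zeroʳ p) (*-monoˡ-≤ 0≤p 0≤q)

0≤p+q : ∀ {p q} → 0ℚ ≤ p → 0ℚ ≤ q → 0ℚ ≤ p + q
0≤p+q = +-mono-≤ {0ℚ} {_} {0ℚ}

0≤p^n : ∀ {p} n → 0ℚ ≤ p → 0ℚ ≤ p ^ n
0≤p^n zero    0≤p = nonNegative⁻¹ 1ℚ
0≤p^n (suc n) 0≤p = 0≤p*q 0≤p (0≤p^n n 0≤p)

p≤p+q : ∀ {p q} → 0ℚ ≤ q → p ≤ p + q
p≤p+q {p} {q} 0≤q = subst (_≤ p + q) (+-identityʳ p) (+-monoʳ-≤ p 0≤q)

p≤q+p : ∀ {p q} → 0ℚ ≤ q → p ≤ q + p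
p≤q+p {p} {q} 0≤q = subst (_≤ q + p) (+-identityˡ p) (+-monoˡ-≤ p 0≤q)

p≤∣p∣ : ∀ p → p ≤ ∣ p ∣
p≤∣p∣ p with ≤-total 0ℚ p
... | inj₁ 0≤p = ≤-reflexive (sym (0≤p⇒∣p∣≡p 0≤p))
... | inj₂ p≤0 = ≤-trans p≤0 (0≤∣p∣ p)

∣*∣-mono : ∀ {p q a b} → ∣ p ∣ ≤ a → ∣ q ∣ ≤ b → ∣ p * q ∣ ≤ a * b
∣*∣-mono {p} {q} p≤a q≤b = subst (_≤ _) (sym (∣p*q∣≡∣p∣*∣q∣ p q))
  (*-mono-≤ (0≤∣p∣ q) (≤-trans (0≤∣p∣ p) p≤a) p≤a q≤b)

∣+∣-mono : ∀ {p q a b} → ∣ p ∣ ≤ a → ∣ q ∣ ≤ b → ∣ p + q ∣ ≤ a + b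
∣+∣-mono {p} {q} p≤a q≤b = ≤-trans (∣p+q∣≤∣p∣+∣q∣ p q) (+-mono-≤ p≤a q≤b)

^-distribˡ-* : ∀ p q n → (p * q) ^ n ≡ p ^ n * q ^ n
^-distribˡ-* p q zero    = refl
^-distribˡ-* p q (suc n) = trans (cong (p * q *_) (^-distribˡ-* p q n)) (lem p q (p ^ n) (q ^ n))
  where
  lem : ∀ a b c d → a * b * (c * d) ≡ a * c * (b * d)
  lem = solve-∀ ℚ-ring

^-+ : ∀ p m n → p ^ (m ℕ.+ n) ≡ p ^ m * p ^ n
^-+ p zero    n = sym (*-identityˡ (p ^ n))
^-+ p (suc m) n = trans (cong (p *_) (^-+ p m n)) (sym (*-assoc p (p ^ m) (p ^ n)))

∣^∣ : ∀ p n → ∣ p ^ n ∣ ≡ ∣ p ∣ ^ n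
∣^∣ p zero    = refl
∣^∣ p (suc n) = trans (∣p*q∣≡∣p∣*∣q∣ p (p ^ n)) (cong (∣ p ∣ *_) (∣^∣ p n))

^-monoˡ-≤ : ∀ {p q} n → 0ℚ ≤ p → p ≤ q → p ^ n ≤ q ^ n
^-monoˡ-≤ zero    0≤p p≤q = ≤-refl
^-monoˡ-≤ (suc n) 0≤p p≤q =
  *-mono-≤ (0≤p^n n 0≤p) (≤-trans 0≤p p≤q) p≤q (^-monoˡ-≤ n 0≤p p≤q)

ι-^ : ∀ a n → ι (a ℕ.^ n) ≡ ι a ^ n
ι-^ a zero    = ι-1
ι-^ a (suc n) = trans (ι-* a (a ℕ.^ n)) (cong (ι a *_) (ι-^ a n))

-- Sums over initial segments

∑< : ℕ → (ℕ → ℚ) → ℚ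
∑< zero    f = 0ℚ
∑< (suc n) f = f 0 + ∑< n (f ∘ suc)

∑<-cong : ∀ n {f g} → (∀ i → f i ≡ g i) → ∑< n f ≡ ∑< n g
∑<-cong zero    h = refl
∑<-cong (suc n) h = cong₂ _+_ (h 0) (∑<-cong n (h ∘ suc))

∑<-cong< : ∀ n {f g} → (∀ i → i ℕ.< n → f i ≡ g i) → ∑< n f ≡ ∑< n g
∑<-cong< zero    h = refl
∑<-cong< (suc n) h = cong₂ _+_ (h 0 (ℕ.s≤s ℕ.z≤n)) (∑<-cong< n λ i i<n → h (suc i) (ℕ.s≤s i<n))

∑<-zero : ∀ n {f} → (∀ i → f i ≡ 0ℚ) → ∑< n f ≡ 0ℚ
∑<-zero zero    h = refl
∑<-zero (suc n) h = trans (cong₂ _+_ (h 0) (∑<-zero n (h ∘ suc))) (+-identityˡ 0ℚ)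

∑<-+ : ∀ n f g → ∑< n (λ i → f i + g i) ≡ ∑< n f + ∑< n g
∑<-+ zero    f g = sym (+-identityˡ 0ℚ)
∑<-+ (suc n) f g = trans (cong (_+_ (f 0 + g 0)) (∑<-+ n (f ∘ suc) (g ∘ suc)))
  (lem (f 0) (g 0) (∑< n (f ∘ suc)) (∑< n (g ∘ suc)))
  where
  lem : ∀ a b c d → (a + b) + (c + d) ≡ (a + c) + (b + d)
  lem = solve-∀ ℚ-ring

∑<-*ˡ : ∀ n c f → ∑< n (λ i → c * f i) ≡ c * ∑< n f
∑<-*ˡ zero    c f = sym (*-zeroʳ c)
∑<-*ˡ (suc n) c f = trans (cong (_+_ (c * f 0)) (∑<-*ˡ n c (f ∘ suc)))
  (sym (*-distribˡ-+ c (f 0) (∑< n (f ∘ suc))))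

∑<-*ʳ : ∀ n c f → ∑< n (λ i → f i * c) ≡ ∑< n f * c
∑<-*ʳ n c f = trans (∑<-cong n (λ i → *-comm (f i) c)) (trans (∑<-*ˡ n c f) (*-comm c (∑< n f)))

∑<-comm : ∀ m n (f : ℕ → ℕ → ℚ) → ∑< m (λ i → ∑< n (f i)) ≡ ∑< n (λ j → ∑< m (λ i → f i j))
∑<-comm zero    n f = sym (∑<-zero n (λ _ → refl))
∑<-comm (suc m) n f = trans (cong (_+_ (∑< n (f 0))) (∑<-comm m n (f ∘ suc)))
  (sym (∑<-+ n (f 0) (λ j → ∑< m (λ i → f (suc i) j))))

∑<-mono : ∀ n {f g} → (∀ i → f i ≤ g i) → ∑< n f ≤ ∑< n g
∑<-mono zero    h = ≤-refl
∑<-mono (suc n) h = +-mono-≤ (h 0) (∑<-mono n (h ∘ suc))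

∑<-nonNeg : ∀ n {f} → (∀ i → 0ℚ ≤ f i) → 0ℚ ≤ ∑< n f
∑<-nonNeg zero    h = ≤-refl
∑<-nonNeg (suc n) h = 0≤p+q (h 0) (∑<-nonNeg n (h ∘ suc))

∣∑<∣ : ∀ n f → ∣ ∑< n f ∣ ≤ ∑< n (∣_∣ ∘ f)
∣∑<∣ zero    f = ≤-refl
∣∑<∣ (suc n) f = ∣+∣-mono {f 0} ≤-refl (∣∑<∣ n (f ∘ suc))

∑<-last : ∀ n f → ∑< (suc n) f ≡ ∑< n f + f n
∑<-last zero    f = +-comm (f 0) 0ℚ
∑<-last (suc n) f = trans (cong (_+_ (f 0)) (∑<-last n (f ∘ suc))) (sym (+-assoc (f 0) (∑< n (f ∘ suc)) (f (suc n))))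

∑<-extend : ∀ m n f → (∀ i → m ℕ.≤ i → f i ≡ 0ℚ) → m ℕ.≤ n → ∑< n f ≡ ∑< m f
∑<-extend zero    n       f h ℕ.z≤n       = ∑<-zero n (λ i → h i ℕ.z≤n)
∑<-extend (suc m) (suc n) f h (ℕ.s≤s m≤n) =
  cong (_+_ (f 0)) (∑<-extend m n (f ∘ suc) (λ i m≤i → h (suc i) (ℕ.s≤s m≤i)) m≤n)

∑<-reverse : ∀ n (f : ℕ → ℚ) → ∑< (suc n) f ≡ ∑< (suc n) (λ i → f (n ℕ.∸ i))
∑<-reverse zero    f = refl
∑<-reverse (suc n) f = begin
  ∑< (suc (suc n)) f                                   ≡⟨ ∑<-last (suc n) f ⟩
  ∑< (suc n) f + f (suc n)                             ≡⟨ +-comm (∑< (suc n) f) (f (suc n)) ⟩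
  f (suc n) + ∑< (suc n) f                             ≡⟨ cong (_+_ (f (suc n))) (∑<-reverse n f) ⟩
  f (suc n) + ∑< (suc n) (λ i → f (n ℕ.∸ i))           ∎
  where open ≡-Reasoning

-- Counting by summing indicators

[_]ᵇ : Bool → ℚ
[ b ]ᵇ = if b then 1ℚ else 0ℚ

𝟙 : ∀ {P : Set} → Dec P → ℚ
𝟙 P? = [ does P? ]ᵇ

𝟙-yes : ∀ {P : Set} (P? : Dec P) → P → 𝟙 P? ≡ 1ℚ
𝟙-yes (yes _) _ = refl
𝟙-yes (no ¬p) p = contradiction p ¬p

𝟙-no : ∀ {P : Set} (P? : Dec P) → ¬ P → 𝟙 P? ≡ 0ℚ
𝟙-no (yes p) ¬p = contradiction p ¬p
𝟙-no (no _)  _  = refl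

𝟙-cong : ∀ {P Q : Set} (P? : Dec P) (Q? : Dec Q) → (P → Q) → (Q → P) → 𝟙 P? ≡ 𝟙 Q?
𝟙-cong (yes p) Q? P⇒Q Q⇒P = sym (𝟙-yes Q? (P⇒Q p))
𝟙-cong (no ¬p) Q? P⇒Q Q⇒P = sym (𝟙-no Q? (¬p ∘ Q⇒P))

𝟙-× : ∀ {P Q : Set} (P? : Dec P) (Q? : Dec Q) → 𝟙 (P? ×-dec Q?) ≡ 𝟙 P? * 𝟙 Q?
𝟙-× (yes _) Q? = sym (*-identityˡ (𝟙 Q?))
𝟙-× (no _)  Q? = sym (*-zeroˡ (𝟙 Q?))

module _ {A : Set} where

  ∑ᴸ : List A → (A → ℚ) → ℚ
  ∑ᴸ []       f = 0ℚ
  ∑ᴸ (x ∷ xs) f = f x + ∑ᴸ xs f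

  ∑ᴸ-cong : ∀ xs {f g} → (∀ x → f x ≡ g x) → ∑ᴸ xs f ≡ ∑ᴸ xs g
  ∑ᴸ-cong []       h = refl
  ∑ᴸ-cong (x ∷ xs) h = cong₂ _+_ (h x) (∑ᴸ-cong xs h)

  ∑ᴸ-zero : ∀ xs → ∑ᴸ xs (const 0ℚ) ≡ 0ℚ
  ∑ᴸ-zero []       = refl
  ∑ᴸ-zero (x ∷ xs) = trans (+-identityˡ _) (∑ᴸ-zero xs)

  ∑ᴸ-++ : ∀ xs ys f → ∑ᴸ (xs ++ ys) f ≡ ∑ᴸ xs f + ∑ᴸ ys f
  ∑ᴸ-++ []       ys f = sym (+-identityˡ (∑ᴸ ys f))
  ∑ᴸ-++ (x ∷ xs) ys f = trans (cong (_+_ (f x)) (∑ᴸ-++ xs ys f))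
    (sym (+-assoc (f x) (∑ᴸ xs f) (∑ᴸ ys f)))

  ∑ᴸ-+ : ∀ xs f g → ∑ᴸ xs (λ x → f x + g x) ≡ ∑ᴸ xs f + ∑ᴸ xs g
  ∑ᴸ-+ []       f g = sym (+-identityˡ 0ℚ)
  ∑ᴸ-+ (x ∷ xs) f g = trans (cong (_+_ (f x + g x)) (∑ᴸ-+ xs f g))
    (lem (f x) (g x) (∑ᴸ xs f) (∑ᴸ xs g))
    where
    lem : ∀ a b c d → (a + b) + (c + d) ≡ (a + c) + (b + d)
    lem = solve-∀ ℚ-ring

  ∑ᴸ-*ˡ : ∀ xs c f → ∑ᴸ xs (λ x → c * f x) ≡ c * ∑ᴸ xs f
  ∑ᴸ-*ˡ []       c f = sym (*-zeroʳ c)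
  ∑ᴸ-*ˡ (x ∷ xs) c f = trans (cong (_+_ (c * f x)) (∑ᴸ-*ˡ xs c f))
    (sym (*-distribˡ-+ c (f x) (∑ᴸ xs f)))

  length-filter : ∀ {P : A → Set} (P? : ∀ x → Dec (P x)) xs →
                  ι (length (filter P? xs)) ≡ ∑ᴸ xs (λ x → 𝟙 (P? x))
  length-filter P? []       = ι-0
  length-filter P? (x ∷ xs) with does (P? x)
  ... | true  = trans (ι-suc _) (cong (_+_ 1ℚ) (length-filter P? xs))
  ... | false = trans (length-filter P? xs) (sym (+-identityˡ _))

∑ᴸ-map : ∀ {A B : Set} (h : A → B) xs f → ∑ᴸ (map h xs) f ≡ ∑ᴸ xs (f ∘ h)
∑ᴸ-map h []       f = refl
∑ᴸ-map h (x ∷ xs) f = cong (_+_ (f (h x))) (∑ᴸ-map h xs f)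

∑ᴸ-cartesian : ∀ {A B C : Set} (h : A → B → C) xs ys f →
               ∑ᴸ (cartesianProductWith h xs ys) f ≡ ∑ᴸ xs (λ x → ∑ᴸ ys (f ∘ h x))
∑ᴸ-cartesian h []       ys f = refl
∑ᴸ-cartesian h (x ∷ xs) ys f = trans (∑ᴸ-++ (map (h x) ys) _ f)
  (cong₂ _+_ (∑ᴸ-map (h x) ys f) (∑ᴸ-cartesian h xs ys f))

∑ᴸ-comm : ∀ {A B : Set} (xs : List A) (ys : List B) (f : A → B → ℚ) →
          ∑ᴸ xs (λ x → ∑ᴸ ys (f x)) ≡ ∑ᴸ ys (λ y → ∑ᴸ xs (λ x → f x y))
∑ᴸ-comm []       ys f = sym (∑ᴸ-zero ys)
∑ᴸ-comm (x ∷ xs) ys f = trans (cong (_+_ (∑ᴸ ys (f x))) (∑ᴸ-comm xs ys f))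
  (sym (∑ᴸ-+ ys (f x) (λ y → ∑ᴸ xs (λ x → f x y))))

-- Every element occurs exactly once. In this form the indicator acts as a Kronecker delta inside
-- sums over `xs`.
Enumerates : ∀ {A : Set} → (∀ (x y : A) → Dec (x ≡ y)) → List A → Set
Enumerates _≟_ xs = ∀ z → ∑ᴸ xs (λ x → 𝟙 (x ≟ z)) ≡ 1ℚ

module _ {A : Set} (_≟_ : ∀ (x y : A) → Dec (x ≡ y)) {xs : List A} (enum : Enumerates _≟_ xs) where

  _≟ᵛ_ : ∀ {n} (v w : Vec A n) → Dec (v ≡ w)
  _≟ᵛ_ = Vec.≡-dec _≟_

  allVecs-enumerates : ∀ n → Enumerates _≟ᵛ_ (allVecs xs n)
  allVecs-enumerates zero    []       = refl
  allVecs-enumerates (suc n) (z ∷ zs) = begin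
    ∑ᴸ (cartesianProductWith _∷_ xs vs) (λ w → 𝟙 (w ≟ᵛ (z ∷ zs)))
      ≡⟨ ∑ᴸ-cartesian _∷_ xs vs _ ⟩
    ∑ᴸ xs (λ x → ∑ᴸ vs (λ v → 𝟙 ((x ∷ v) ≟ᵛ (z ∷ zs))))
      ≡⟨ ∑ᴸ-cong xs (λ x → trans (∑ᴸ-cong vs (λ v → trans
           (𝟙-cong ((x ∷ v) ≟ᵛ (z ∷ zs)) (x ≟ z ×-dec v ≟ᵛ zs) Vec.∷-injective (uncurry (cong₂ _∷_)))
           (𝟙-× (x ≟ z) (v ≟ᵛ zs))))
           (trans (∑ᴸ-*ˡ vs (𝟙 (x ≟ z)) _) (cong (𝟙 (x ≟ z) *_) (allVecs-enumerates n zs)))) ⟩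
    ∑ᴸ xs (λ x → 𝟙 (x ≟ z) * 1ℚ)
      ≡⟨ ∑ᴸ-cong xs (λ x → *-identityʳ (𝟙 (x ≟ z))) ⟩
    ∑ᴸ xs (λ x → 𝟙 (x ≟ z))
      ≡⟨ enum z ⟩
    1ℚ ∎
    where
    open ≡-Reasoning
    vs = allVecs xs n

  -- Both sides count the pairs with P x and y = f x, which are the pairs with Q y and x = g y. The
  -- inverse laws are asked on P and Q alone, because `delete` and `insert` provide them there.
  count-bijection : ∀ {P Q : A → Set} (P? : ∀ x → Dec (P x)) (Q? : ∀ x → Dec (Q x)) (f g : A → A) →
    (∀ x → P x → Q (f x)) → (∀ y → Q y → P (g y)) →
    (∀ x → P x → g (f x) ≡ x) → (∀ y → Q y → f (g y) ≡ y) →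
    ∑ᴸ xs (λ x → 𝟙 (P? x)) ≡ ∑ᴸ xs (λ y → 𝟙 (Q? y))
  count-bijection P? Q? f g fP gQ gf fg = begin
    ∑ᴸ xs (λ x → 𝟙 (P? x))
      ≡⟨ ∑ᴸ-cong xs (λ x → spread (𝟙 (P? x)) (f x)) ⟩
    ∑ᴸ xs (λ x → ∑ᴸ xs (λ y → 𝟙 (P? x) * 𝟙 (y ≟ f x)))
      ≡⟨ ∑ᴸ-comm xs xs _ ⟩
    ∑ᴸ xs (λ y → ∑ᴸ xs (λ x → 𝟙 (P? x) * 𝟙 (y ≟ f x)))
      ≡⟨ ∑ᴸ-cong xs (λ y → ∑ᴸ-cong xs (λ x → trans (sym (𝟙-× (P? x) (y ≟ f x)))
           (trans (𝟙-cong (P? x ×-dec y ≟ f x) (Q? y ×-dec x ≟ g y)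
             (λ { (p , refl) → fP x p , sym (gf x p) })
             (λ { (q , refl) → gQ y q , sym (fg y q) }))
             (𝟙-× (Q? y) (x ≟ g y))))) ⟩
    ∑ᴸ xs (λ y → ∑ᴸ xs (λ x → 𝟙 (Q? y) * 𝟙 (x ≟ g y)))
      ≡⟨ ∑ᴸ-cong xs (λ y → sym (spread (𝟙 (Q? y)) (g y))) ⟩
    ∑ᴸ xs (λ y → 𝟙 (Q? y)) ∎
    where
    open ≡-Reasoning
    spread : ∀ c z → c ≡ ∑ᴸ xs (λ y → c * 𝟙 (y ≟ z))
    spread c z = sym (trans (∑ᴸ-*ˡ xs c _) (trans (cong (c *_) (enum z)) (*-identityʳ c)))

Bool-enumerates : Enumerates Bool._≟_ (true ∷ false ∷ [])
Bool-enumerates true  = refl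
Bool-enumerates false = refl

_≟ᴰ_ : ∀ {n} (o o′ : Digraph n) → Dec (o ≡ o′)
_≟ᴰ_ = Vec.≡-dec (Vec.≡-dec Bool._≟_)

allDigraphs-enumerates : ∀ n → Enumerates _≟ᴰ_ (allDigraphs n)
allDigraphs-enumerates n =
  allVecs-enumerates (Vec.≡-dec Bool._≟_) {allVecs (true ∷ false ∷ []) n}
    (allVecs-enumerates Bool._≟_ {true ∷ false ∷ []} Bool-enumerates n) n

-- Vertex sets, represented by Boolean vectors

-- Subsets of X are vectors of full length, so that S, X and their difference share one type and
-- nothing is re-indexed.
∑⊆ : ∀ {n} → Vec Bool n → (Vec Bool n → ℚ) → ℚ
∑⊆ []          f = f []
∑⊆ (false ∷ X) f = ∑⊆ X (f ∘ (false ∷_))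
∑⊆ (true ∷ X)  f = ∑⊆ X (f ∘ (false ∷_)) + ∑⊆ X (f ∘ (true ∷_))

sign : ∀ {n} → Vec Bool n → ℚ
sign []          = 1ℚ
sign (false ∷ S) = sign S
sign (true ∷ S)  = - sign S

_⊆ᵇ_ : ∀ {n} → Vec Bool n → Vec Bool n → Bool
[]      ⊆ᵇ []      = true
(s ∷ S) ⊆ᵇ (y ∷ Y) = (not s ∨ y) ∧ S ⊆ᵇ Y

disjoint : ∀ {n} → Vec Bool n → Vec Bool n → Bool
disjoint []      []      = true
disjoint (x ∷ X) (y ∷ Y) = not (x ∧ y) ∧ disjoint X Y

_∖_ : ∀ {n} → Vec Bool n → Vec Bool n → Vec Bool n
_∖_ = zipWith (λ x s → x ∧ not s)

∅ : ∀ {n} → Vec Bool n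
∅ = Vec.replicate _ false

∑⊆-cong : ∀ {n} (X : Vec Bool n) {f g} → (∀ S → T (S ⊆ᵇ X) → f S ≡ g S) → ∑⊆ X f ≡ ∑⊆ X g
∑⊆-cong []          h = h [] tt
∑⊆-cong (false ∷ X) h = ∑⊆-cong X (λ S → h (false ∷ S))
∑⊆-cong (true ∷ X)  h =
  cong₂ _+_ (∑⊆-cong X (λ S → h (false ∷ S))) (∑⊆-cong X (λ S → h (true ∷ S)))

∑⊆-zero : ∀ {n} (X : Vec Bool n) → ∑⊆ X (const 0ℚ) ≡ 0ℚ
∑⊆-zero []          = refl
∑⊆-zero (false ∷ X) = ∑⊆-zero X
∑⊆-zero (true ∷ X)  = trans (cong₂ _+_ (∑⊆-zero X) (∑⊆-zero X)) (+-identityˡ 0ℚ)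

∑⊆-+ : ∀ {n} (X : Vec Bool n) f g → ∑⊆ X (λ S → f S + g S) ≡ ∑⊆ X f + ∑⊆ X g
∑⊆-+ []          f g = refl
∑⊆-+ (false ∷ X) f g = ∑⊆-+ X (f ∘ (false ∷_)) (g ∘ (false ∷_))
∑⊆-+ (true ∷ X)  f g = trans
  (cong₂ _+_ (∑⊆-+ X (f ∘ (false ∷_)) (g ∘ (false ∷_))) (∑⊆-+ X (f ∘ (true ∷_)) (g ∘ (true ∷_))))
  (lem (∑⊆ X (f ∘ (false ∷_))) (∑⊆ X (g ∘ (false ∷_))) (∑⊆ X (f ∘ (true ∷_))) (∑⊆ X (g ∘ (true ∷_))))
  where
  lem : ∀ a b c d → (a + b) + (c + d) ≡ (a + c) + (b + d)
  lem = solve-∀ ℚ-ring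

∑⊆-*ˡ : ∀ {n} (X : Vec Bool n) c f → ∑⊆ X (λ S → c * f S) ≡ c * ∑⊆ X f
∑⊆-*ˡ []          c f = refl
∑⊆-*ˡ (false ∷ X) c f = ∑⊆-*ˡ X c (f ∘ (false ∷_))
∑⊆-*ˡ (true ∷ X)  c f = trans
  (cong₂ _+_ (∑⊆-*ˡ X c (f ∘ (false ∷_))) (∑⊆-*ˡ X c (f ∘ (true ∷_))))
  (sym (*-distribˡ-+ c (∑⊆ X (f ∘ (false ∷_))) (∑⊆ X (f ∘ (true ∷_)))))

∑⊆-∑ᴸ : ∀ {n} {A : Set} (X : Vec Bool n) (xs : List A) (f : Vec Bool n → A → ℚ) →
        ∑⊆ X (λ S → ∑ᴸ xs (f S)) ≡ ∑ᴸ xs (λ x → ∑⊆ X (λ S → f S x))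
∑⊆-∑ᴸ X []       f = ∑⊆-zero X
∑⊆-∑ᴸ X (x ∷ xs) f = trans (∑⊆-+ X (λ S → f S x) (λ S → ∑ᴸ xs (f S)))
  (cong (_+_ (∑⊆ X (λ S → f S x))) (∑⊆-∑ᴸ X xs f))

-- An element common to X and Y pairs each S with a set of opposite sign, and everything cancels.
-- Without such an element only S = ∅ lies in both.
∑⊆-sign : ∀ {n} (X Y : Vec Bool n) → ∑⊆ X (λ S → sign S * [ S ⊆ᵇ Y ]ᵇ) ≡ [ disjoint X Y ]ᵇ
∑⊆-sign []          []          = refl
∑⊆-sign (false ∷ X) (y ∷ Y)     = ∑⊆-sign X Y
∑⊆-sign (true ∷ X)  (false ∷ Y) = trans
  (cong₂ _+_ (∑⊆-sign X Y) (trans (∑⊆-cong X (λ S _ → *-zeroʳ (- sign S))) (∑⊆-zero X)))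
  (+-identityʳ [ disjoint X Y ]ᵇ)
∑⊆-sign (true ∷ X)  (true ∷ Y)  = trans
  (sym (∑⊆-+ X (λ S → sign S * [ S ⊆ᵇ Y ]ᵇ) (λ S → - sign S * [ S ⊆ᵇ Y ]ᵇ)))
  (trans (∑⊆-cong X (λ S _ → lem (sign S) [ S ⊆ᵇ Y ]ᵇ)) (∑⊆-zero X))
  where
  lem : ∀ a b → a * b + - a * b ≡ 0ℚ
  lem = solve-∀ ℚ-ring

infix 4 _∈_
_∈_ : ∀ {n} → Fin n → Vec Bool n → Set
v ∈ X = T (lookup X v)

_∈?_ : ∀ {n} (v : Fin n) (X : Vec Bool n) → Dec (v ∈ X)
v ∈? X = T? (lookup X v)

⊆ᵇ⇒ : ∀ {n} (S Y : Vec Bool n) → T (S ⊆ᵇ Y) → ∀ v → v ∈ S → v ∈ Y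
⊆ᵇ⇒ (true ∷ S) (true ∷ Y) h zero    _ = tt
⊆ᵇ⇒ (true ∷ S) (true ∷ Y) h (suc v) p = ⊆ᵇ⇒ S Y h v p
⊆ᵇ⇒ (false ∷ S) (y ∷ Y)   h (suc v) p = ⊆ᵇ⇒ S Y h v p

⇒⊆ᵇ : ∀ {n} (S Y : Vec Bool n) → (∀ v → v ∈ S → v ∈ Y) → T (S ⊆ᵇ Y)
⇒⊆ᵇ []          []          h = tt
⇒⊆ᵇ (false ∷ S) (y ∷ Y)     h = ⇒⊆ᵇ S Y (h ∘ suc)
⇒⊆ᵇ (true ∷ S)  (true ∷ Y)  h = ⇒⊆ᵇ S Y (h ∘ suc)
⇒⊆ᵇ (true ∷ S)  (false ∷ Y) h = h zero tt

disjoint⇒ : ∀ {n} (X Y : Vec Bool n) → T (disjoint X Y) → ∀ v → v ∈ X → ¬ v ∈ Y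
disjoint⇒ (true ∷ X)  (false ∷ Y) h zero    p q = q
disjoint⇒ (true ∷ X)  (false ∷ Y) h (suc v) p q = disjoint⇒ X Y h v p q
disjoint⇒ (false ∷ X) (y ∷ Y)     h (suc v) p q = disjoint⇒ X Y h v p q

⇒disjoint : ∀ {n} (X Y : Vec Bool n) → (∀ v → v ∈ X → ¬ v ∈ Y) → T (disjoint X Y)
⇒disjoint []          []          h = tt
⇒disjoint (false ∷ X) (y ∷ Y)     h = ⇒disjoint X Y (h ∘ suc)
⇒disjoint (true ∷ X)  (false ∷ Y) h = ⇒disjoint X Y (h ∘ suc)
⇒disjoint (true ∷ X)  (true ∷ Y)  h = h zero tt tt

∈∖⇒ : ∀ {n} (X S : Vec Bool n) v → v ∈ X ∖ S → v ∈ X × ¬ v ∈ S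
∈∖⇒ (true ∷ X) (false ∷ S) zero    p = tt , λ ()
∈∖⇒ (x ∷ X)    (s ∷ S)     (suc v) p = ∈∖⇒ X S v p

⇒∈∖ : ∀ {n} (X S : Vec Bool n) v → v ∈ X → ¬ v ∈ S → v ∈ X ∖ S
⇒∈∖ (true ∷ X) (false ∷ S) zero    p q = tt
⇒∈∖ (true ∷ X) (true ∷ S)  zero    p q = q tt
⇒∈∖ (x ∷ X)    (s ∷ S)     (suc v) p q = ⇒∈∖ X S v p q

T⇔⇒≡ : ∀ b c → (T b → T c) → (T c → T b) → b ≡ c
T⇔⇒≡ false false f g = refl
T⇔⇒≡ true  true  f g = refl
T⇔⇒≡ true  false f g = ⊥-elim (f tt)
T⇔⇒≡ false true  f g = ⊥-elim (g tt)

lookup-ext : ∀ {A : Set} {n} (v w : Vec A n) → (∀ i → lookup v i ≡ lookup w i) → v ≡ w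
lookup-ext v w h = trans (sym (Vec.tabulate∘lookup v)) (trans (Vec.tabulate-cong h) (Vec.tabulate∘lookup w))

Digraph-ext : ∀ {n} (o o′ : Digraph n) → (∀ u v → Arc o u v → Arc o′ u v) →
              (∀ u v → Arc o′ u v → Arc o u v) → o ≡ o′
Digraph-ext o o′ f g = lookup-ext o o′ λ u → lookup-ext _ _ λ v → T⇔⇒≡ _ _ (f u v) (g u v)

module _ {n : ℕ} {R : Fin n → Fin n → Set} (R? : Decidable R) where

  digraph : Digraph n
  digraph = tabulate λ u → tabulate λ v → does (R? u v)

  private
    lookup-digraph : ∀ u v → lookup (lookup digraph u) v ≡ does (R? u v)
    lookup-digraph u v = trans (cong (λ w → lookup w v) (Vec.lookup∘tabulate (λ u → tabulate λ v → does (R? u v)) u))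
      (Vec.lookup∘tabulate (λ v → does (R? u v)) v)

  Arc⇒ : ∀ u v → Arc digraph u v → R u v
  Arc⇒ u v a = go (R? u v) (subst T (lookup-digraph u v) a)
    where
    go : ∀ (d : Dec (R u v)) → T (does d) → R u v
    go (yes r) _ = r

  ⇒Arc : ∀ u v → R u v → Arc digraph u v
  ⇒Arc u v r = subst T (sym (lookup-digraph u v)) (go (R? u v))
    where
    go : ∀ (d : Dec (R u v)) → T (does d)
    go (yes _) = tt
    go (no ¬r) = ¬r r

-- Sources of acyclic orientations

Source : ∀ {n} → Digraph n → Fin n → Set
Source o v = ∀ u → ¬ Arc o u v

sources : ∀ {n} → Digraph n → Vec Bool n
sources o = tabulate λ v → does (all? λ u → ¬? (arc? o u v))

∈sources⇒ : ∀ {n} (o : Digraph n) v → v ∈ sources o → Source o v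
∈sources⇒ o v p = go (all? λ u → ¬? (arc? o u v)) (subst T (Vec.lookup∘tabulate (λ v → does (all? λ u → ¬? (arc? o u v))) v) p)
  where
  go : ∀ (d : Dec (Source o v)) → T (does d) → Source o v
  go (yes r) _ = r

⇒∈sources : ∀ {n} (o : Digraph n) v → Source o v → v ∈ sources o
⇒∈sources o v p = subst T (sym (Vec.lookup∘tabulate (λ v → does (all? λ u → ¬? (arc? o u v))) v)) (go (all? λ u → ¬? (arc? o u v)))
  where
  go : ∀ (d : Dec (Source o v)) → T (does d)
  go (yes _) = tt
  go (no ¬p) = ¬p p

-- G[X] keeps all n vertices and only loses edges, so the orientations of all induced subgraphs are
-- digraphs of one type.
restrict : ∀ {n} → SimpleGraph n → Vec Bool n → SimpleGraph n
restrict G X = record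
  { Adj        = λ u v → u ∈ X × v ∈ X × Adj u v
  ; adj?       = λ u v → u ∈? X ×-dec v ∈? X ×-dec adj? u v
  ; adj-sym    = λ (p , q , a) → q , p , adj-sym a
  ; adj-irrefl = λ eq (_ , _ , a) → adj-irrefl eq a
  }
  where open SimpleGraph G

AcyclicOrientation : ∀ {n} → SimpleGraph n → Digraph n → Set
AcyclicOrientation G o = IsOrientation G o × Acyclic o

acyclicOrientation? : ∀ {n} (G : SimpleGraph n) o → Dec (AcyclicOrientation G o)
acyclicOrientation? G o = isOrientation? G o ×-dec acyclic? o

#AO : ∀ {n} → SimpleGraph n → ℚ
#AO {n} G = ∑ᴸ (allDigraphs n) (λ o → 𝟙 (acyclicOrientation? G o))

-- Following arcs backwards from any vertex of X must end in a source, since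
-- acyclicity makes the reachability order of the finite digraph well-founded.
∃-source : ∀ {n} (G : SimpleGraph n) X o → AcyclicOrientation (restrict G X) o →
           ∀ v → v ∈ X → ∃[ s ] s ∈ X × Source o s
∃-source G X o ((arc⇒ , _) , acyc) v v∈X = go v (spo-wellFounded spo v) v∈X
  where
  spo : IsStrictPartialOrder _≡_ (TransClosure (Arc o))
  spo = record
    { isEquivalence = isEquivalence
    ; irrefl        = λ { refl → acyc _ }
    ; trans         = _++⁺_
    ; <-resp-≈      = (λ { refl p → p }) , (λ { refl p → p })
    }
  go : ∀ v → Acc (TransClosure (Arc o)) v → v ∈ X → ∃[ s ] s ∈ X × Source o s
  go v (acc rec) v∈X with any? (λ u → arc? o u v)
  ... | yes (u , a) = go u (rec [ a ]⁺) (proj₁ (arc⇒ u v a))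
  ... | no  ¬∃      = v , v∈X , λ u a → ¬∃ (u , a)

Independent : ∀ {n} → SimpleGraph n → Vec Bool n → Set
Independent G S = ∀ u v → u ∈ S → v ∈ S → ¬ SimpleGraph.Adj G u v

independent? : ∀ {n} (G : SimpleGraph n) S → Dec (Independent G S)
independent? G S = all? λ u → all? λ v → u ∈? S →-dec v ∈? S →-dec ¬? (adj? u v)
  where open SimpleGraph G

-- Acyclic orientations of G[X] in which all of S ⊆ X are sources correspond to
-- acyclic orientations of G[X ∖ S], the arcs at S being forced.
module _ {n : ℕ} (G : SimpleGraph n) (X S : Vec Bool n) (S⊆X : ∀ v → v ∈ S → v ∈ X) where
  open SimpleGraph G

  private
    WithSources : Digraph n → Set
    WithSources o = AcyclicOrientation (restrict G X) o × T (S ⊆ᵇ sources o)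

    withSources? : ∀ o → Dec (WithSources o)
    withSources? o = acyclicOrientation? (restrict G X) o ×-dec T? (S ⊆ᵇ sources o)

    deleteR? : ∀ o → Decidable (λ u v → Arc o u v × ¬ u ∈ S)
    deleteR? o u v = arc? o u v ×-dec ¬? (u ∈? S)

    delete : Digraph n → Digraph n
    delete o = digraph (deleteR? o)

    insertR? : ∀ o → Decidable (λ u v → Arc o u v ⊎ (u ∈ S × v ∈ X ∖ S × Adj u v))
    insertR? o u v = arc? o u v ⊎-dec (u ∈? S ×-dec v ∈? (X ∖ S) ×-dec adj? u v)

    insert : Digraph n → Digraph n
    insert o = digraph (insertR? o)

    isSource : ∀ o → WithSources o → ∀ v → v ∈ S → Source o v
    isSource o (_ , h) v v∈S = ∈sources⇒ o v (⊆ᵇ⇒ S (sources o) h v v∈S)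

    delete-AO : ∀ o → WithSources o → AcyclicOrientation (restrict G (X ∖ S)) (delete o)
    delete-AO o w@(((arc⇒ , ⇒arc , anti) , acyc) , _) =
      ( (λ u v a → let a′ , u∉S = A⇒ u v a ; u∈X , v∈X , adj = arc⇒ u v a′ in
           ⇒∈∖ X S u u∈X u∉S , ⇒∈∖ X S v v∈X (λ v∈S → isSource o w v v∈S u a′) , adj)
      , (λ u v (u∈ , v∈ , adj) →
           let u∈X , u∉S = ∈∖⇒ X S u u∈ ; v∈X , v∉S = ∈∖⇒ X S v v∈ in
           [ (λ a → inj₁ (⇒A u v (a , u∉S))) , (λ a → inj₂ (⇒A v u (a , v∉S))) ]′
             (⇒arc u v (u∈X , v∈X , adj)))
      , (λ u v a b → anti u v (proj₁ (A⇒ u v a)) (proj₁ (A⇒ v u b))))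
      , λ v p → acyc v (path p)
      where
      A⇒ = Arc⇒ (deleteR? o)
      ⇒A = ⇒Arc (deleteR? o)
      path : ∀ {u v} → TransClosure (Arc (delete o)) u v → TransClosure (Arc o) u v
      path [ a ]⁺     = [ proj₁ (A⇒ _ _ a) ]⁺
      path (a ∷⁺ p) = proj₁ (A⇒ _ _ a) ∷⁺ path p

    -- No arc of the enlarged digraph enters S. A closed walk ends where it starts, hence avoids S
    -- altogether and is a closed walk of `o`.
    insert-AO : Independent G S → ∀ o → AcyclicOrientation (restrict G (X ∖ S)) o → WithSources (insert o)
    insert-AO ind o ((arc⇒ , ⇒arc , anti) , acyc) =
      ( ( (λ u v a → [ (λ a′ → let u∈ , v∈ , adj = arc⇒ u v a′ in
                        proj₁ (∈∖⇒ X S u u∈) , proj₁ (∈∖⇒ X S v v∈) , adj)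
                     , (λ (u∈S , v∈ , adj) → S⊆X u u∈S , proj₁ (∈∖⇒ X S v v∈) , adj) ]′ (A⇒ u v a))
        , orient
        , antisym)
      , (λ v p → acyc v (path (start∉S p) p)))
      , ⇒⊆ᵇ S (sources (insert o)) (λ v v∈S → ⇒∈sources (insert o) v λ u a → head∉S u v a v∈S)
      where
      A⇒ = Arc⇒ (insertR? o)
      ⇒A = ⇒Arc (insertR? o)
      head∉S : ∀ u v → Arc (insert o) u v → ¬ v ∈ S
      head∉S u v a with A⇒ u v a
      ... | inj₁ a′           = proj₂ (∈∖⇒ X S v (proj₁ (proj₂ (arc⇒ u v a′))))
      ... | inj₂ (_ , v∈ , _) = proj₂ (∈∖⇒ X S v v∈)
      orient : ∀ u v → u ∈ X × v ∈ X × Adj u v → Arc (insert o) u v ⊎ Arc (insert o) v u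
      orient u v (u∈X , v∈X , adj) with u ∈? S | v ∈? S
      ... | yes u∈S | yes v∈S = contradiction adj (ind u v u∈S v∈S)
      ... | yes u∈S | no  v∉S = inj₁ (⇒A u v (inj₂ (u∈S , ⇒∈∖ X S v v∈X v∉S , adj)))
      ... | no  u∉S | yes v∈S = inj₂ (⇒A v u (inj₂ (v∈S , ⇒∈∖ X S u u∈X u∉S , adj-sym adj)))
      ... | no  u∉S | no  v∉S = [ inj₁ ∘ ⇒A u v ∘ inj₁ , inj₂ ∘ ⇒A v u ∘ inj₁ ]′
        (⇒arc u v (⇒∈∖ X S u u∈X u∉S , ⇒∈∖ X S v v∈X v∉S , adj))
      old : ∀ u v → ¬ u ∈ S → Arc (insert o) u v → Arc o u v
      old u v u∉S a with A⇒ u v a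
      ... | inj₁ a′          = a′
      ... | inj₂ (u∈S , _)   = contradiction u∈S u∉S
      antisym : ∀ u v → Arc (insert o) u v → ¬ Arc (insert o) v u
      antisym u v a b = anti u v (old u v (head∉S v u b) a) (old v u (head∉S u v a) b)
      path : ∀ {u v} → ¬ u ∈ S → TransClosure (Arc (insert o)) u v → TransClosure (Arc o) u v
      path u∉S [ a ]⁺   = [ old _ _ u∉S a ]⁺
      path u∉S (a ∷⁺ p) = old _ _ u∉S a ∷⁺ path (head∉S _ _ a) p
      start∉S : ∀ {u v} → TransClosure (Arc (insert o)) u v → ¬ v ∈ S
      start∉S [ a ]⁺   = head∉S _ _ a
      start∉S (_ ∷⁺ p) = start∉S p

    insert-delete : ∀ o → WithSources o → insert (delete o) ≡ o
    insert-delete o w@(((arc⇒ , ⇒arc , anti) , acyc) , _) = Digraph-ext _ _ to from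
      where
      to : ∀ u v → Arc (insert (delete o)) u v → Arc o u v
      to u v a with Arc⇒ (insertR? (delete o)) u v a
      ... | inj₁ a′ = proj₁ (Arc⇒ (deleteR? o) u v a′)
      ... | inj₂ (u∈S , v∈ , adj) with ⇒arc u v (S⊆X u u∈S , proj₁ (∈∖⇒ X S v v∈) , adj)
      ...   | inj₁ a″ = a″
      ...   | inj₂ b  = contradiction b (isSource o w u u∈S v)
      from : ∀ u v → Arc o u v → Arc (insert (delete o)) u v
      from u v a with u ∈? S
      ... | no u∉S  = ⇒Arc (insertR? (delete o)) u v (inj₁ (⇒Arc (deleteR? o) u v (a , u∉S)))
      ... | yes u∈S = let _ , v∈X , adj = arc⇒ u v a in
        ⇒Arc (insertR? (delete o)) u v
          (inj₂ (u∈S , ⇒∈∖ X S v v∈X (λ v∈S → isSource o w v v∈S u a) , adj))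

    delete-insert : ∀ o → AcyclicOrientation (restrict G (X ∖ S)) o → delete (insert o) ≡ o
    delete-insert o ((arc⇒ , _) , _) = Digraph-ext _ _ to
      λ u v a → ⇒Arc (deleteR? (insert o)) u v
        (⇒Arc (insertR? o) u v (inj₁ a) , proj₂ (∈∖⇒ X S u (proj₁ (arc⇒ u v a))))
      where
      to : ∀ u v → Arc (delete (insert o)) u v → Arc o u v
      to u v a with Arc⇒ (deleteR? (insert o)) u v a
      ... | a′ , u∉S with Arc⇒ (insertR? o) u v a′
      ...   | inj₁ a″        = a″
      ...   | inj₂ (u∈S , _) = contradiction u∈S u∉S

    -- An edge inside S would be directed into one of its two ends, but both are sources.
    independent : ∀ o → WithSources o → Independent G S
    independent o w@(((_ , ⇒arc , _) , _) , _) u v u∈S v∈S adj =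
      [ isSource o w v v∈S u , isSource o w u u∈S v ]′ (⇒arc u v (S⊆X u u∈S , S⊆X v v∈S , adj))

  count-withSources :
    ∑ᴸ (allDigraphs n) (λ o → 𝟙 (acyclicOrientation? (restrict G X) o) * [ S ⊆ᵇ sources o ]ᵇ)
      ≡ 𝟙 (independent? G S) * #AO (restrict G (X ∖ S))
  count-withSources = trans
    (∑ᴸ-cong (allDigraphs n) λ o → sym (𝟙-× (acyclicOrientation? (restrict G X) o) (T? (S ⊆ᵇ sources o))))
    (go (independent? G S))
    where
    go : ∀ (d : Dec (Independent G S)) →
         ∑ᴸ (allDigraphs n) (λ o → 𝟙 (withSources? o)) ≡ 𝟙 d * #AO (restrict G (X ∖ S))
    go (yes ind) = trans
      (count-bijection _≟ᴰ_ {allDigraphs n} (allDigraphs-enumerates n) withSources?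
        (acyclicOrientation? (restrict G (X ∖ S))) delete insert
        delete-AO (insert-AO ind) insert-delete delete-insert)
      (sym (*-identityˡ _))
    go (no ¬ind) = trans
      (∑ᴸ-cong (allDigraphs n) λ o → 𝟙-no (withSources? o) (¬ind ∘ independent o))
      (trans (∑ᴸ-zero (allDigraphs n)) (sym (*-zeroˡ (#AO (restrict G (X ∖ S))))))

#AO-∅ : ∀ {n} (G : SimpleGraph n) → #AO (restrict G ∅) ≡ 1ℚ
#AO-∅ {n} G = trans
  (∑ᴸ-cong (allDigraphs n) λ o → 𝟙-cong (acyclicOrientation? (restrict G ∅) o) (o ≟ᴰ empty)
    (λ ((arc⇒ , _) , _) → Digraph-ext o empty (λ u v a → ⊥-elim (∉∅ u (proj₁ (arc⇒ u v a))))
                                            (λ u v a → ⊥-elim (noArc u v a)))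
    (λ { refl → ( (λ u v a → ⊥-elim (noArc u v a)) , (λ u v a → ⊥-elim (∉∅ u (proj₁ a)))
                , (λ u v a _ → noArc u v a))
              , λ v p → noPath p }))
  (allDigraphs-enumerates n empty)
  where
  ∉∅ : ∀ {n} (v : Fin n) → ¬ v ∈ ∅
  ∉∅ v p = subst T (Vec.lookup-replicate v false) p
  never? : Decidable {A = Fin n} {B = Fin n} (λ u v → ⊥)
  never? u v = no λ ()
  empty : Digraph n
  empty = digraph never?
  noArc : ∀ u v → ¬ Arc empty u v
  noArc = Arc⇒ never?
  noPath : ∀ {u v} → ¬ TransClosure (Arc empty) u v
  noPath [ a ]⁺   = noArc _ _ a
  noPath (a ∷⁺ _) = noArc _ _ a

-- Cardinalities, and uniqueness of the solution of the recurrence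

isEmpty : ∀ {n} → Vec Bool n → Bool
isEmpty []      = true
isEmpty (x ∷ X) = not x ∧ isEmpty X

card : ∀ {n} → Vec Bool n → ℕ
card []          = 0
card (false ∷ X) = card X
card (true ∷ X)  = suc (card X)

card≤n : ∀ {n} (X : Vec Bool n) → card X ℕ.≤ n
card≤n []          = ℕ.z≤n
card≤n (false ∷ X) = ℕ.m≤n⇒m≤1+n (card≤n X)
card≤n (true ∷ X)  = ℕ.s≤s (card≤n X)

isEmpty⇒∅ : ∀ {n} (X : Vec Bool n) → T (isEmpty X) → X ≡ ∅
isEmpty⇒∅ []          h = refl
isEmpty⇒∅ (false ∷ X) h = cong (false ∷_) (isEmpty⇒∅ X h)

∈⇒¬isEmpty : ∀ {n} (X : Vec Bool n) v → v ∈ X → ¬ T (isEmpty X)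
∈⇒¬isEmpty (false ∷ X) (suc v) p h = ∈⇒¬isEmpty X v p h

¬isEmpty⇒∈ : ∀ {n} (X : Vec Bool n) → ¬ T (isEmpty X) → ∃[ v ] v ∈ X
¬isEmpty⇒∈ []          h = ⊥-elim (h tt)
¬isEmpty⇒∈ (true ∷ X)  h = zero , tt
¬isEmpty⇒∈ (false ∷ X) h = let v , p = ¬isEmpty⇒∈ X h in suc v , p

X∖∅≡X : ∀ {n} (X : Vec Bool n) → X ∖ ∅ ≡ X
X∖∅≡X []          = refl
X∖∅≡X (false ∷ X) = cong (false ∷_) (X∖∅≡X X)
X∖∅≡X (true ∷ X)  = cong (true ∷_) (X∖∅≡X X)

card-∖ : ∀ {n} (X S : Vec Bool n) → card (X ∖ S) ℕ.≤ card X
card-∖ []          []          = ℕ.z≤n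
card-∖ (false ∷ X) (_ ∷ S)     = card-∖ X S
card-∖ (true ∷ X)  (false ∷ S) = ℕ.s≤s (card-∖ X S)
card-∖ (true ∷ X)  (true ∷ S)  = ℕ.m≤n⇒m≤1+n (card-∖ X S)

card-∖< : ∀ {n} (X S : Vec Bool n) → T (S ⊆ᵇ X) → ¬ T (isEmpty S) → card (X ∖ S) ℕ.< card X
card-∖< []          []          _   h = ⊥-elim (h tt)
card-∖< (false ∷ X) (false ∷ S) S⊆X h = card-∖< X S S⊆X h
card-∖< (true ∷ X)  (false ∷ S) S⊆X h = ℕ.s≤s (card-∖< X S S⊆X h)
card-∖< (true ∷ X)  (true ∷ S)  S⊆X h = ℕ.s≤s (card-∖ X S)

∑⊆-∅ : ∀ {n} (X : Vec Bool n) (f : Vec Bool n → ℚ) → (∀ S → T (S ⊆ᵇ X) → ¬ T (isEmpty S) → f S ≡ 0ℚ) → ∑⊆ X f ≡ f ∅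
∑⊆-∅ []          f h = refl
∑⊆-∅ (false ∷ X) f h = ∑⊆-∅ X (f ∘ (false ∷_)) (λ S → h (false ∷ S))
∑⊆-∅ (true ∷ X)  f h = trans
  (cong₂ _+_ (∑⊆-∅ X (f ∘ (false ∷_)) (λ S → h (false ∷ S)))
    (trans (∑⊆-cong X (λ S S⊆X → h (true ∷ S) S⊆X (λ ()))) (∑⊆-zero X)))
  (+-identityʳ (f (false ∷ ∅)))

sign-∅ : ∀ n → sign (∅ {n}) ≡ 1ℚ
sign-∅ zero    = refl
sign-∅ (suc n) = sign-∅ n

isEmpty-∅ : ∀ n → isEmpty (∅ {n}) ≡ true
isEmpty-∅ zero    = refl
isEmpty-∅ (suc n) = isEmpty-∅ n

¬T⇒≡false : ∀ {b} → ¬ T b → b ≡ false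
¬T⇒≡false {false} h = refl
¬T⇒≡false {true}  h = ⊥-elim (h tt)

T⇒≡true : ∀ {b} → T b → b ≡ true
T⇒≡true {true} h = refl

-- Strong induction on |X|: terms with S nonempty involve smaller sets, where f and g already agree,
-- and the term S = ∅ has coefficient 1. A recurrence of this kind thus has at most one solution.
∑⊆-∖-injective : ∀ {n} (w f g : Vec Bool n → ℚ) → w ∅ ≡ 1ℚ →
  (∀ X → ∑⊆ X (λ S → w S * f (X ∖ S)) ≡ ∑⊆ X (λ S → w S * g (X ∖ S))) → ∀ X → f X ≡ g X
∑⊆-∖-injective w f g w∅≡1 eq X = go X (<-wellFounded (card X))
  where
  go : ∀ X → Acc ℕ._<_ (card X) → f X ≡ g X
  go X (acc rec) = begin
    f X           ≡⟨ lem₁ (f X) (g X) ⟩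
    (f X - g X) + g X   ≡⟨ cong (_+ g X) diff ⟩
    0ℚ + g X      ≡⟨ +-identityˡ (g X) ⟩
    g X           ∎
    where
    open ≡-Reasoning
    lem₁ : ∀ a b → a ≡ (a - b) + b
    lem₁ = solve-∀ ℚ-ring
    lem₂ : ∀ w a b → w * (a - b) + w * b ≡ w * a
    lem₂ = solve-∀ ℚ-ring
    lem₃ : ∀ a b → a + b - b ≡ a
    lem₃ = solve-∀ ℚ-ring
    t : Vec Bool _ → ℚ
    t S = w S * (f (X ∖ S) - g (X ∖ S))
    f∖ g∖ : Vec Bool _ → ℚ
    f∖ S = w S * f (X ∖ S)
    g∖ S = w S * g (X ∖ S)
    t∅ : t ∅ ≡ f X - g X
    t∅ = trans (cong₂ _*_ w∅≡1 (cong (λ Y → f Y - g Y) (X∖∅≡X X))) (*-identityˡ (f X - g X))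
    vanish : ∀ S → T (S ⊆ᵇ X) → ¬ T (isEmpty S) → t S ≡ 0ℚ
    vanish S S⊆X S≢∅ = trans
      (cong (λ z → w S * (z - g (X ∖ S))) (go (X ∖ S) (rec (card-∖< X S S⊆X S≢∅))))
      (trans (cong (w S *_) (+-inverseʳ (g (X ∖ S)))) (*-zeroʳ (w S)))
    diff : f X - g X ≡ 0ℚ
    diff = begin
      f X - g X                   ≡⟨ t∅ ⟨
      t ∅                         ≡⟨ ∑⊆-∅ X t vanish ⟨
      ∑⊆ X t                      ≡⟨ lem₃ (∑⊆ X t) (∑⊆ X g∖) ⟨
      ∑⊆ X t + ∑⊆ X g∖ - ∑⊆ X g∖  ≡⟨ cong (_- ∑⊆ X g∖) (∑⊆-+ X t g∖) ⟨
      ∑⊆ X (λ S → t S + g∖ S) - ∑⊆ X g∖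
        ≡⟨ cong (_- ∑⊆ X g∖) (∑⊆-cong X (λ S _ → lem₂ (w S) (f (X ∖ S)) (g (X ∖ S)))) ⟩
      ∑⊆ X f∖ - ∑⊆ X g∖           ≡⟨ cong (_- ∑⊆ X g∖) (eq X) ⟩
      ∑⊆ X g∖ - ∑⊆ X g∖           ≡⟨ +-inverseʳ (∑⊆ X g∖) ⟩
      0ℚ                          ∎

-- Inclusion-exclusion over the sets of sources, of which there is at least one.
∑⊆-#AO : ∀ {n} (G : SimpleGraph n) X →
  ∑⊆ X (λ S → (sign S * 𝟙 (independent? G S)) * #AO (restrict G (X ∖ S))) ≡ [ isEmpty X ]ᵇ
∑⊆-#AO {n} G X = begin
  ∑⊆ X (λ S → (sign S * 𝟙 (independent? G S)) * #AO (restrict G (X ∖ S)))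
    ≡⟨ ∑⊆-cong X (λ S S⊆X → trans (*-assoc (sign S) (𝟙 (independent? G S)) _)
         (trans (cong (sign S *_) (sym (count-withSources G X S (⊆ᵇ⇒ S X S⊆X))))
           (sym (∑ᴸ-*ˡ 𝒟 (sign S) (λ o → ao o * [ S ⊆ᵇ sources o ]ᵇ))))) ⟩
  ∑⊆ X (λ S → ∑ᴸ 𝒟 (λ o → sign S * (ao o * [ S ⊆ᵇ sources o ]ᵇ)))
    ≡⟨ ∑⊆-∑ᴸ X 𝒟 (λ S o → sign S * (ao o * [ S ⊆ᵇ sources o ]ᵇ)) ⟩
  ∑ᴸ 𝒟 (λ o → ∑⊆ X (λ S → sign S * (ao o * [ S ⊆ᵇ sources o ]ᵇ)))
    ≡⟨ ∑ᴸ-cong 𝒟 (λ o → trans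
         (∑⊆-cong X (λ S _ → lem (sign S) (ao o) [ S ⊆ᵇ sources o ]ᵇ))
         (trans (∑⊆-*ˡ X (ao o) (λ S → sign S * [ S ⊆ᵇ sources o ]ᵇ))
           (cong (ao o *_) (∑⊆-sign X (sources o))))) ⟩
  ∑ᴸ 𝒟 (λ o → ao o * [ disjoint X (sources o) ]ᵇ)
    ≡⟨ ∑ᴸ-cong 𝒟 (λ o → trans (no-source o (acyclicOrientation? (restrict G X) o)) (*-comm (ao o) [ isEmpty X ]ᵇ)) ⟩
  ∑ᴸ 𝒟 (λ o → [ isEmpty X ]ᵇ * ao o)
    ≡⟨ ∑ᴸ-*ˡ 𝒟 [ isEmpty X ]ᵇ ao ⟩
  [ isEmpty X ]ᵇ * #AO (restrict G X)
    ≡⟨ empty (T? (isEmpty X)) ⟩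
  [ isEmpty X ]ᵇ ∎
  where
  open ≡-Reasoning
  𝒟 = allDigraphs n
  ao : Digraph n → ℚ
  ao o = 𝟙 (acyclicOrientation? (restrict G X) o)
  lem : ∀ a b c → a * (b * c) ≡ b * (a * c)
  lem = solve-∀ ℚ-ring
  no-source : ∀ o (d : Dec (AcyclicOrientation (restrict G X) o)) →
    𝟙 d * [ disjoint X (sources o) ]ᵇ ≡ 𝟙 d * [ isEmpty X ]ᵇ
  no-source o (no _)   = trans (*-zeroˡ [ disjoint X (sources o) ]ᵇ) (sym (*-zeroˡ [ isEmpty X ]ᵇ))
  no-source o (yes ao) = cong (λ b → 1ℚ * [ b ]ᵇ) (T⇔⇒≡ _ _
    (λ dis → decidable-stable (T? (isEmpty X)) λ X≢∅ →
      let v , v∈X = ¬isEmpty⇒∈ X X≢∅ ; s , s∈X , src = ∃-source G X o ao v v∈X in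
      disjoint⇒ X (sources o) dis s s∈X (⇒∈sources o s src))
    (λ X≡∅ → ⇒disjoint X (sources o) λ v v∈X _ → ∈⇒¬isEmpty X v v∈X X≡∅))
  empty : Dec (T (isEmpty X)) → [ isEmpty X ]ᵇ * #AO (restrict G X) ≡ [ isEmpty X ]ᵇ
  empty (yes h) = trans
    (cong₂ _*_ (cong [_]ᵇ (T⇒≡true h)) (trans (cong (λ Y → #AO (restrict G Y)) (isEmpty⇒∅ X h)) (#AO-∅ G)))
    (trans (*-identityˡ 1ℚ) (sym (cong [_]ᵇ (T⇒≡true h))))
  empty (no h)  = trans (cong (λ b → [ b ]ᵇ * #AO (restrict G X)) (¬T⇒≡false h))
    (trans (*-zeroˡ (#AO (restrict G X))) (sym (cong [_]ᵇ (¬T⇒≡false h))))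

-- Signed Stirling numbers and alternating sums

-- P n j = (-1)^(n-j) S(n, j), a signed Stirling number of the second kind.
P : ℕ → ℕ → ℚ
P zero    zero    = 1ℚ
P zero    (suc j) = 0ℚ
P (suc n) zero    = 0ℚ
P (suc n) (suc j) = P n j - ι (suc j) * P n (suc j)

P-vanishes : ∀ n j → n ℕ.< j → P n j ≡ 0ℚ
P-vanishes zero    (suc j) _           = refl
P-vanishes (suc n) (suc j) (ℕ.s≤s n<j) = trans
  (cong₂ (λ a b → a - ι (suc j) * b) (P-vanishes n j n<j) (P-vanishes n (suc j) (ℕ.m≤n⇒m≤1+n n<j)))
  (lem (ι (suc j)))
  where
  lem : ∀ a → 0ℚ - a * 0ℚ ≡ 0ℚ
  lem = solve-∀ ℚ-ring

-- The n-th forward difference at 0, that is, the sum over s of (-1)^s C(n,s) f(n-s); the recursion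
-- is Pascal's rule.
alternate : (ℕ → ℚ) → ℕ → ℚ
alternate f zero    = f 0
alternate f (suc n) = alternate (f ∘ suc) n - alternate f n

∑⊆-alternate : ∀ {n} (X : Vec Bool n) f → ∑⊆ X (λ S → sign S * f (card (X ∖ S))) ≡ alternate f (card X)
∑⊆-alternate []          f = *-identityˡ (f 0)
∑⊆-alternate (false ∷ X) f = ∑⊆-alternate X f
∑⊆-alternate (true ∷ X)  f = cong₂ _+_ (∑⊆-alternate X (f ∘ suc)) (trans
  (∑⊆-cong X (λ S _ → lem (sign S) (f (card (X ∖ S)))))
  (trans (∑⊆-*ˡ X (- 1ℚ) (λ S → sign S * f (card (X ∖ S))))
    (trans (cong (- 1ℚ *_) (∑⊆-alternate X f)) (lem′ (alternate f (card X))))))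
  where
  lem : ∀ a b → - a * b ≡ - 1ℚ * (a * b)
  lem = solve-∀ ℚ-ring
  lem′ : ∀ a → - 1ℚ * a ≡ - a
  lem′ = solve-∀ ℚ-ring

alternate-zero : ∀ n → alternate (const 0ℚ) n ≡ 0ℚ
alternate-zero zero    = refl
alternate-zero (suc n) = trans (cong₂ _-_ (alternate-zero n) (alternate-zero n)) (+-inverseʳ 0ℚ)

alternate-linear : ∀ f g c n → alternate (λ n → f n - c * g n) n ≡ alternate f n - c * alternate g n
alternate-linear f g c zero    = refl
alternate-linear f g c (suc n) = trans
  (cong₂ _-_ (alternate-linear (f ∘ suc) (g ∘ suc) c n) (alternate-linear f g c n))
  (lem (alternate (f ∘ suc) n) (alternate (g ∘ suc) n) (alternate f n) (alternate g n) c)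
  where
  lem : ∀ a b a′ b′ c → (a - c * b) - (a′ - c * b′) ≡ (a - a′) - c * (b - b′)
  lem = solve-∀ ℚ-ring

-- Umbrally (P - 1)^n t = P_(n+1): the coefficientwise form of
-- e^(-x) = (1 - d/dt) for the generating function exp (t (1 - e^(-x))).
alternate-P : ∀ n j → alternate (λ n → P n j) n ≡ P (suc n) (suc j)
alternate-P zero    j = lem (P 0 j) (ι (suc j))
  where
  lem : ∀ a b → a ≡ a - b * 0ℚ
  lem = solve-∀ ℚ-ring
alternate-P (suc n) zero = trans
  (cong₂ _-_ (alternate-zero n) (alternate-P n 0))
  (trans (cong (λ z → 0ℚ - z) (sym (*-identityˡ (P (suc n) 1))))
    (cong (λ z → 0ℚ - z * P (suc n) 1) (sym ι-1)))
alternate-P (suc n) (suc j) = trans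
  (cong₂ _-_ (trans (alternate-linear (λ n → P n j) (λ n → P n (suc j)) (ι (suc j)) n)
               (cong₂ (λ a b → a - ι (suc j) * b) (alternate-P n j) (alternate-P n (suc j))))
    (alternate-P n (suc j)))
  (trans (lem (P (suc n) (suc j)) (P (suc n) (suc (suc j))) (ι (suc j)))
    (cong (λ z → P (suc n) (suc j) - z * P (suc n) (suc (suc j))) (sym (ι-suc (suc j)))))
  where
  lem : ∀ a b c → a - c * b - b ≡ a - (1ℚ + c) * b
  lem = solve-∀ ℚ-ring

P-zero : ∀ {n} (X : Vec Bool n) → P (card X) 0 ≡ [ isEmpty X ]ᵇ
P-zero []          = refl
P-zero (false ∷ X) = P-zero X
P-zero (true ∷ X)  = refl

-- The functional L on complete multipartite graphs

-- Φ ks X 0 is the image of ∏ᵢ P_(|X ∩ part i|)(t) under the functional t^k ↦ k!,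
-- where P_n(t) = Σⱼ P n j t^j; the last argument multiplies by a power of t.
Φ : ∀ ks → Vec Bool (sum ks) → ℕ → ℚ
Φ []       X k = ι (k !)
Φ (n ∷ ks) X k = ∑< (suc n) (λ j → P (card (take n X)) j * Φ ks (drop n X) (k ℕ.+ j))

-- The independent sets of a complete multipartite graph, decided along the recursion that numbers
-- the vertices.
inOnePart : ∀ ks → Vec Bool (sum ks) → Bool
inOnePart []       S = true
inOnePart (n ∷ ks) S = if isEmpty (take n S) then inOnePart ks (drop n S) else isEmpty (drop n S)

∑⊆-split : ∀ n {m} (X : Vec Bool (n ℕ.+ m)) (f : Vec Bool n → Vec Bool m → ℚ) →
  ∑⊆ X (λ S → f (take n S) (drop n S)) ≡ ∑⊆ (take n X) (λ S → ∑⊆ (drop n X) (f S))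
∑⊆-split zero    X           f = refl
∑⊆-split (suc n) (false ∷ X) f = ∑⊆-split n X (f ∘ (false ∷_))
∑⊆-split (suc n) (true ∷ X)  f = cong₂ _+_ (∑⊆-split n X (f ∘ (false ∷_))) (∑⊆-split n X (f ∘ (true ∷_)))

sign-split : ∀ n {m} (S : Vec Bool (n ℕ.+ m)) → sign S ≡ sign (take n S) * sign (drop n S)
sign-split zero    S           = sym (*-identityˡ (sign S))
sign-split (suc n) (false ∷ S) = sign-split n S
sign-split (suc n) (true ∷ S)  = trans (cong -_ (sign-split n S))
  (neg-distribˡ-* (sign (take n S)) (sign (drop n S)))

isEmpty-split : ∀ n {m} (S : Vec Bool (n ℕ.+ m)) → [ isEmpty S ]ᵇ ≡ [ isEmpty (take n S) ]ᵇ * [ isEmpty (drop n S) ]ᵇ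
isEmpty-split zero    S           = sym (*-identityˡ [ isEmpty S ]ᵇ)
isEmpty-split (suc n) (false ∷ S) = isEmpty-split n S
isEmpty-split (suc n) (true ∷ S)  = sym (*-zeroˡ [ isEmpty (drop n S) ]ᵇ)

∑⊆-isEmpty : ∀ {n} (X : Vec Bool n) (f : Vec Bool n → ℚ) → ∑⊆ X (λ S → sign S * ([ isEmpty S ]ᵇ * f S)) ≡ f ∅
∑⊆-isEmpty {n} X f = trans
  (∑⊆-∅ X (λ S → sign S * ([ isEmpty S ]ᵇ * f S)) (λ S _ S≢∅ → trans
    (cong (λ b → sign S * ([ b ]ᵇ * f S)) (¬T⇒≡false S≢∅)) (lem (sign S) (f S))))
  (trans (cong₂ (λ a b → a * ([ b ]ᵇ * f ∅)) (sign-∅ n) (isEmpty-∅ n)) (lem′ (f ∅)))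
  where
  lem : ∀ a b → a * (0ℚ * b) ≡ 0ℚ
  lem = solve-∀ ℚ-ring
  lem′ : ∀ a → 1ℚ * (1ℚ * a) ≡ a
  lem′ = solve-∀ ℚ-ring

∑⊆-∑< : ∀ {n} (X : Vec Bool n) m (f : Vec Bool n → ℕ → ℚ) →
        ∑⊆ X (λ S → ∑< m (f S)) ≡ ∑< m (λ j → ∑⊆ X (λ S → f S j))
∑⊆-∑< X zero    f = ∑⊆-zero X
∑⊆-∑< X (suc m) f = trans (∑⊆-+ X (λ S → f S 0) (λ S → ∑< m (f S ∘ suc)))
  (cong (_+_ (∑⊆ X (λ S → f S 0))) (∑⊆-∑< X m (λ S j → f S (suc j))))

δ₀ : ℕ → ℚ
δ₀ zero    = 1ℚ
δ₀ (suc _) = 0ℚ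

-- The left side of the recurrence for the candidate solution, with an extra factor t^k. At k = 0 it
-- has to be the indicator of X = ∅.
weighted : ∀ ks → Vec Bool (sum ks) → ℕ → ℚ
weighted ks X k = ∑⊆ X (λ S → (sign S * [ inOnePart ks S ]ᵇ) * Φ ks (X ∖ S) k)

-- The functional L : t^k ↦ k! satisfies L f = L f′ + f(0); for f = t^k ∏ᵢ P_(nᵢ)(t)
-- the weighted sum is L (f - (∏ᵢ P_(nᵢ))′ t^k).
weighted-Φ : ∀ ks X k → weighted ks X k ≡ ι k * Φ ks X (ℕ.pred k) + [ isEmpty X ]ᵇ * δ₀ k
weighted-Φ []       [] zero    = trans (lem (ι 1)) (trans ι-1 (sym (trans (cong (λ z → z * ι 1 + 1ℚ * 1ℚ) ι-0) (lem′ (ι 1)))))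
  where
  lem : ∀ a → 1ℚ * 1ℚ * a ≡ a
  lem = solve-∀ ℚ-ring
  lem′ : ∀ a → 0ℚ * a + 1ℚ * 1ℚ ≡ 1ℚ
  lem′ = solve-∀ ℚ-ring
weighted-Φ []       [] (suc k) = trans (cong (1ℚ * 1ℚ *_) (ι-* (suc k) (k !))) (lem (ι (suc k)) (ι (k !)))
  where
  lem : ∀ a b → 1ℚ * 1ℚ * (a * b) ≡ a * b + 1ℚ * 0ℚ
  lem = solve-∀ ℚ-ring
weighted-Φ (n ∷ ks) X k = begin
  weighted (n ∷ ks) X k
    ≡⟨ ∑⊆-cong X (λ S _ → split S) ⟩
  ∑⊆ X (λ S → g (take n S) (drop n S))
    ≡⟨ ∑⊆-split n X g ⟩
  ∑⊆ X₁ (λ S → ∑⊆ X₂ (g S))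
    ≡⟨ ∑⊆-cong X₁ (λ S _ → sumX₂ S) ⟩
  ∑⊆ X₁ (λ S → sign S * ([ isEmpty S ]ᵇ * (W S - F S)) + sign S * F S)
    ≡⟨ ∑⊆-+ X₁ (λ S → sign S * ([ isEmpty S ]ᵇ * (W S - F S))) (λ S → sign S * F S) ⟩
  ∑⊆ X₁ (λ S → sign S * ([ isEmpty S ]ᵇ * (W S - F S))) + ∑⊆ X₁ (λ S → sign S * F S)
    ≡⟨ cong₂ _+_ (∑⊆-isEmpty X₁ (λ S → W S - F S)) sumX₁ ⟩
  (W ∅ - F ∅) + ∑< (suc n) (λ j → P (suc c) (suc j) * Φ ks X₂ (k ℕ.+ j))
    ≡⟨ cong (λ Y → (∑< (suc n) (λ j → P (card Y) j * weighted ks X₂ (k ℕ.+ j))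
                    - ∑< (suc n) (λ j → P (card Y) j * Φ ks X₂ (k ℕ.+ j)))
                   + ∑< (suc n) (λ j → P (suc c) (suc j) * Φ ks X₂ (k ℕ.+ j))) (X∖∅≡X X₁) ⟩
  (∑< (suc n) (λ j → P c j * weighted ks X₂ (k ℕ.+ j)) - ∑< (suc n) (λ j → P c j * Φ ks X₂ (k ℕ.+ j)))
    + ∑< (suc n) (λ j → P (suc c) (suc j) * Φ ks X₂ (k ℕ.+ j))
    ≡⟨ combine ⟩
  ∑< (suc n) (λ j → (ι k * (P c j * Φ ks X₂ (ℕ.pred k ℕ.+ j)) + [ isEmpty X₂ ]ᵇ * (P c j * δ₀ (k ℕ.+ j)))
                    + (t j - t (suc j)))
    ≡⟨ ∑<-+ (suc n) (λ j → b₁ j + b₂ j) (λ j → t j - t (suc j)) ⟩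
  ∑< (suc n) (λ j → ι k * (P c j * Φ ks X₂ (ℕ.pred k ℕ.+ j)) + [ isEmpty X₂ ]ᵇ * (P c j * δ₀ (k ℕ.+ j)))
    + ∑< (suc n) (λ j → t j - t (suc j))
    ≡⟨ cong₂ _+_ (trans (∑<-+ (suc n) b₁ b₂) (cong₂ _+_
           (∑<-*ˡ (suc n) (ι k) (λ j → P c j * Φ ks X₂ (ℕ.pred k ℕ.+ j)))
           (∑<-*ˡ (suc n) [ isEmpty X₂ ]ᵇ (λ j → P c j * δ₀ (k ℕ.+ j)))))
         (trans (telescope (suc n) t) boundary) ⟩
  (ι k * Φ (n ∷ ks) X (ℕ.pred k) + [ isEmpty X₂ ]ᵇ * ∑< (suc n) (λ j → P c j * δ₀ (k ℕ.+ j))) + 0ℚ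
    ≡⟨ +-identityʳ _ ⟩
  ι k * Φ (n ∷ ks) X (ℕ.pred k) + [ isEmpty X₂ ]ᵇ * ∑< (suc n) (λ j → P c j * δ₀ (k ℕ.+ j))
    ≡⟨ cong (_+_ (ι k * Φ (n ∷ ks) X (ℕ.pred k))) constant ⟩
  ι k * Φ (n ∷ ks) X (ℕ.pred k) + [ isEmpty X ]ᵇ * δ₀ k ∎
  where
  open ≡-Reasoning
  X₁ = take n X
  X₂ = drop n X
  c = card X₁

  b₁ b₂ : ℕ → ℚ
  b₁ j = ι k * (P c j * Φ ks X₂ (ℕ.pred k ℕ.+ j))
  b₂ j = [ isEmpty X₂ ]ᵇ * (P c j * δ₀ (k ℕ.+ j))

  F W : Vec Bool n → ℚ
  F S = ∑< (suc n) (λ j → P (card (X₁ ∖ S)) j * Φ ks X₂ (k ℕ.+ j))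
  W S = ∑< (suc n) (λ j → P (card (X₁ ∖ S)) j * weighted ks X₂ (k ℕ.+ j))

  f : Vec Bool n → Vec Bool (sum ks) → ℚ
  f S₁ S₂ = ∑< (suc n) (λ j → P (card (X₁ ∖ S₁)) j * Φ ks (X₂ ∖ S₂) (k ℕ.+ j))

  g : Vec Bool n → Vec Bool (sum ks) → ℚ
  g S₁ S₂ = ((sign S₁ * sign S₂) * [ if isEmpty S₁ then inOnePart ks S₂ else isEmpty S₂ ]ᵇ) * f S₁ S₂

  split : ∀ S → (sign S * [ inOnePart (n ∷ ks) S ]ᵇ) * Φ (n ∷ ks) (X ∖ S) k ≡ g (take n S) (drop n S)
  split S = cong₂ _*_ (cong (_* [ inOnePart (n ∷ ks) S ]ᵇ) (sign-split n S))
    (cong₂ (λ Y Z → ∑< (suc n) (λ j → P (card Y) j * Φ ks Z (k ℕ.+ j)))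
      (Vec.take-zipWith {m = n} (λ x s → x ∧ not s) X S) (Vec.drop-zipWith {m = n} (λ x s → x ∧ not s) X S))

  if-ᵇ : ∀ e x y → [ if e then x else y ]ᵇ ≡ [ e ]ᵇ * [ x ]ᵇ + (1ℚ - [ e ]ᵇ) * [ y ]ᵇ
  if-ᵇ true  x y = lem [ x ]ᵇ [ y ]ᵇ
    where
    lem : ∀ a b → a ≡ 1ℚ * a + (1ℚ - 1ℚ) * b
    lem = solve-∀ ℚ-ring
  if-ᵇ false x y = lem [ x ]ᵇ [ y ]ᵇ
    where
    lem : ∀ a b → b ≡ 0ℚ * a + (1ℚ - 0ℚ) * b
    lem = solve-∀ ℚ-ring

  -- If S is empty on the first part, the later parts are unconstrained by it and give W; if not, S₂
  -- must be ∅, which gives F. Writing this as F everywhere plus W - F at S = ∅ leaves an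
  -- unrestricted alternating sum of F.
  sumX₂ : ∀ S → ∑⊆ X₂ (g S) ≡ sign S * ([ isEmpty S ]ᵇ * (W S - F S)) + sign S * F S
  sumX₂ S = begin
    ∑⊆ X₂ (g S)
      ≡⟨ ∑⊆-cong X₂ (λ S₂ _ → trans
           (cong (λ z → ((sign S * sign S₂) * z) * f S S₂) (if-ᵇ (isEmpty S) (inOnePart ks S₂) (isEmpty S₂)))
           (lem (sign S) (sign S₂) e [ inOnePart ks S₂ ]ᵇ [ isEmpty S₂ ]ᵇ (f S S₂))) ⟩
    ∑⊆ X₂ (λ S₂ → (sign S * e) * ((sign S₂ * [ inOnePart ks S₂ ]ᵇ) * f S S₂)
                  + (sign S * (1ℚ - e)) * (sign S₂ * ([ isEmpty S₂ ]ᵇ * f S S₂)))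
      ≡⟨ ∑⊆-+ X₂ (λ S₂ → (sign S * e) * ((sign S₂ * [ inOnePart ks S₂ ]ᵇ) * f S S₂))
                 (λ S₂ → (sign S * (1ℚ - e)) * (sign S₂ * ([ isEmpty S₂ ]ᵇ * f S S₂))) ⟩
    ∑⊆ X₂ (λ S₂ → (sign S * e) * ((sign S₂ * [ inOnePart ks S₂ ]ᵇ) * f S S₂))
      + ∑⊆ X₂ (λ S₂ → (sign S * (1ℚ - e)) * (sign S₂ * ([ isEmpty S₂ ]ᵇ * f S S₂)))
      ≡⟨ cong₂ _+_
           (trans (∑⊆-*ˡ X₂ (sign S * e) (λ S₂ → (sign S₂ * [ inOnePart ks S₂ ]ᵇ) * f S S₂)) (cong ((sign S * e) *_) inner))
           (trans (∑⊆-*ˡ X₂ (sign S * (1ℚ - e)) (λ S₂ → sign S₂ * ([ isEmpty S₂ ]ᵇ * f S S₂)))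
             (cong ((sign S * (1ℚ - e)) *_)
             (trans (∑⊆-isEmpty X₂ (f S))
               (cong (λ Z → ∑< (suc n) (λ j → P (card (X₁ ∖ S)) j * Φ ks Z (k ℕ.+ j))) (X∖∅≡X X₂))))) ⟩
    (sign S * e) * W S + (sign S * (1ℚ - e)) * F S
      ≡⟨ lem′ (sign S) e (W S) (F S) ⟩
    sign S * (e * (W S - F S)) + sign S * F S ∎
    where
    e = [ isEmpty S ]ᵇ
    lem : ∀ s s₂ e x y z → ((s * s₂) * (e * x + (1ℚ - e) * y)) * z
                           ≡ (s * e) * ((s₂ * x) * z) + (s * (1ℚ - e)) * (s₂ * (y * z))
    lem = solve-∀ ℚ-ring
    lem′ : ∀ s e w f → (s * e) * w + (s * (1ℚ - e)) * f ≡ s * (e * (w - f)) + s * f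
    lem′ = solve-∀ ℚ-ring
    lem″ : ∀ a b c → a * (b * c) ≡ b * (a * c)
    lem″ = solve-∀ ℚ-ring
    inner : ∑⊆ X₂ (λ S₂ → (sign S₂ * [ inOnePart ks S₂ ]ᵇ) * f S S₂) ≡ W S
    inner = trans
      (∑⊆-cong X₂ (λ S₂ _ → trans (sym (∑<-*ˡ (suc n) (sign S₂ * [ inOnePart ks S₂ ]ᵇ) (λ j → P (card (X₁ ∖ S)) j * Φ ks (X₂ ∖ S₂) (k ℕ.+ j))))
        (∑<-cong (suc n) λ j → lem″ (sign S₂ * [ inOnePart ks S₂ ]ᵇ) (P (card (X₁ ∖ S)) j) (Φ ks (X₂ ∖ S₂) (k ℕ.+ j)))))
      (trans (∑⊆-∑< X₂ (suc n) (λ S₂ j → P (card (X₁ ∖ S)) j * ((sign S₂ * [ inOnePart ks S₂ ]ᵇ) * Φ ks (X₂ ∖ S₂) (k ℕ.+ j))))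
        (∑<-cong (suc n) λ j → ∑⊆-*ˡ X₂ (P (card (X₁ ∖ S)) j) (λ S₂ → (sign S₂ * [ inOnePart ks S₂ ]ᵇ) * Φ ks (X₂ ∖ S₂) (k ℕ.+ j))))

  sumX₁ : ∑⊆ X₁ (λ S → sign S * F S) ≡ ∑< (suc n) (λ j → P (suc c) (suc j) * Φ ks X₂ (k ℕ.+ j))
  sumX₁ = trans
    (∑⊆-cong X₁ (λ S _ → trans (sym (∑<-*ˡ (suc n) (sign S) (λ j → P (card (X₁ ∖ S)) j * Φ ks X₂ (k ℕ.+ j))))
      (∑<-cong (suc n) λ j → lem (sign S) (P (card (X₁ ∖ S)) j) (Φ ks X₂ (k ℕ.+ j)))))
    (trans (∑⊆-∑< X₁ (suc n) (λ S j → Φ ks X₂ (k ℕ.+ j) * (sign S * P (card (X₁ ∖ S)) j)))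
      (∑<-cong (suc n) λ j → trans (∑⊆-*ˡ X₁ (Φ ks X₂ (k ℕ.+ j)) (λ S → sign S * P (card (X₁ ∖ S)) j))
        (trans (cong (Φ ks X₂ (k ℕ.+ j) *_) (trans (∑⊆-alternate X₁ (λ i → P i j)) (alternate-P c j)))
          (*-comm (Φ ks X₂ (k ℕ.+ j)) (P (suc c) (suc j))))))
    where
    lem : ∀ a b c → a * (b * c) ≡ c * (a * b)
    lem = solve-∀ ℚ-ring

  -- The j-th term of P_c′(t) t^k times the later factors, under L. Such terms arise once from the
  -- product rule and once, with index shifted, from `P (suc c)`, hence the telescoping.
  t : ℕ → ℚ
  t j = ι j * P c j * Φ ks X₂ (ℕ.pred (k ℕ.+ j))

  telescope : ∀ m (t : ℕ → ℚ) → ∑< m (λ j → t j - t (suc j)) ≡ t 0 - t m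
  telescope zero    t = sym (+-inverseʳ (t 0))
  telescope (suc m) t = trans (cong (_+_ (t 0 - t 1)) (telescope m (t ∘ suc))) (lem (t 0) (t 1) (t (suc m)))
    where
    lem : ∀ a b c → (a - b) + (b - c) ≡ a - c
    lem = solve-∀ ℚ-ring

  -- A derivative has no contribution from j = 0, and j = n + 1 exceeds the degree of P_c.
  boundary : t 0 - t (suc n) ≡ 0ℚ
  boundary = trans
    (cong₂ (λ a b → a * P c 0 * Φ ks X₂ (ℕ.pred (k ℕ.+ 0)) - ι (suc n) * b * Φ ks X₂ (ℕ.pred (k ℕ.+ suc n)))
      ι-0 (P-vanishes c (suc n) (ℕ.s≤s (card≤n X₁))))
    (lem (P c 0) (Φ ks X₂ (ℕ.pred (k ℕ.+ 0))) (ι (suc n)) (Φ ks X₂ (ℕ.pred (k ℕ.+ suc n))))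
    where
    lem : ∀ a b c d → 0ℚ * a * b - c * 0ℚ * d ≡ 0ℚ
    lem = solve-∀ ℚ-ring

  -- At k = 0 the truncated predecessors disagree, but both sides carry the factor `ι 0`.
  shift : ∀ k j → ι k * Φ ks X₂ (ℕ.pred (k ℕ.+ j)) ≡ ι k * Φ ks X₂ (ℕ.pred k ℕ.+ j)
  shift zero    j = trans (cong (_* Φ ks X₂ (ℕ.pred j)) ι-0) (trans (trans (*-zeroˡ (Φ ks X₂ (ℕ.pred j)))
    (sym (*-zeroˡ (Φ ks X₂ j)))) (cong (_* Φ ks X₂ j) (sym ι-0)))
  shift (suc k) j = refl

  -- The induction hypothesis at exponent k + j brings a factor k + j. Its share k rebuilds the
  -- derivative of t^k. Its share j joins the recursion of `P (suc c)` to form `t j - t (suc j)`,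
  -- while the undifferentiated terms cancel.
  combine :
    (∑< (suc n) (λ j → P c j * weighted ks X₂ (k ℕ.+ j)) - ∑< (suc n) (λ j → P c j * Φ ks X₂ (k ℕ.+ j)))
      + ∑< (suc n) (λ j → P (suc c) (suc j) * Φ ks X₂ (k ℕ.+ j))
    ≡ ∑< (suc n) (λ j → (ι k * (P c j * Φ ks X₂ (ℕ.pred k ℕ.+ j)) + [ isEmpty X₂ ]ᵇ * (P c j * δ₀ (k ℕ.+ j)))
                        + (t j - t (suc j)))
  combine = trans
    (cong (_+ s₃) (trans (cong (_+_ s₁) (sym minus)) (sym (∑<-+ (suc n) a₁ a₂))))
    (trans (sym (∑<-+ (suc n) (λ j → a₁ j + a₂ j) a₃)) (∑<-cong (suc n) pointwise))
    where
    a₁ a₂ a₃ : ℕ → ℚ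
    a₁ j = P c j * weighted ks X₂ (k ℕ.+ j)
    a₂ j = - 1ℚ * (P c j * Φ ks X₂ (k ℕ.+ j))
    a₃ j = P (suc c) (suc j) * Φ ks X₂ (k ℕ.+ j)
    s₁ = ∑< (suc n) a₁
    s₃ = ∑< (suc n) a₃
    -1* : ∀ a → - 1ℚ * a ≡ - a
    -1* = solve-∀ ℚ-ring
    minus : ∑< (suc n) a₂ ≡ - ∑< (suc n) (λ j → P c j * Φ ks X₂ (k ℕ.+ j))
    minus = trans (∑<-*ˡ (suc n) (- 1ℚ) (λ j → P c j * Φ ks X₂ (k ℕ.+ j))) (-1* _)
    lem : ∀ p q κ i i′ φ e δ → (p * (κ * φ + i * φ + e * δ) + - 1ℚ * (p * q)) + (p - i′) * q
          ≡ (p * (κ * φ) + e * (p * δ)) + (i * p * φ - i′ * q)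
    lem = solve-∀ ℚ-ring
    pointwise : ∀ j → (a₁ j + a₂ j) + a₃ j ≡
      (ι k * (P c j * Φ ks X₂ (ℕ.pred k ℕ.+ j)) + [ isEmpty X₂ ]ᵇ * (P c j * δ₀ (k ℕ.+ j))) + (t j - t (suc j))
    pointwise j = begin
      (P c j * weighted ks X₂ (k ℕ.+ j) + - 1ℚ * (P c j * Φ ks X₂ (k ℕ.+ j)))
        + (P c j - ι (suc j) * P c (suc j)) * Φ ks X₂ (k ℕ.+ j)
        ≡⟨ cong (λ z → (P c j * z + - 1ℚ * (P c j * Φ ks X₂ (k ℕ.+ j))) + (P c j - ι (suc j) * P c (suc j)) * Φ ks X₂ (k ℕ.+ j))
             (trans (weighted-Φ ks X₂ (k ℕ.+ j)) (cong (_+ [ isEmpty X₂ ]ᵇ * δ₀ (k ℕ.+ j))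
               (trans (cong (_* φ) (ι-+ k j)) (*-distribʳ-+ φ (ι k) (ι j))))) ⟩
      (P c j * (ι k * φ + ι j * φ + [ isEmpty X₂ ]ᵇ * δ₀ (k ℕ.+ j)) + - 1ℚ * (P c j * Φ ks X₂ (k ℕ.+ j)))
        + (P c j - ι (suc j) * P c (suc j)) * Φ ks X₂ (k ℕ.+ j)
        ≡⟨ lem (P c j) (Φ ks X₂ (k ℕ.+ j)) (ι k) (ι j) (ι (suc j) * P c (suc j)) φ [ isEmpty X₂ ]ᵇ (δ₀ (k ℕ.+ j)) ⟩
      (P c j * (ι k * φ) + [ isEmpty X₂ ]ᵇ * (P c j * δ₀ (k ℕ.+ j)))
        + (t j - ι (suc j) * P c (suc j) * Φ ks X₂ (k ℕ.+ j))
        ≡⟨ cong₂ (λ a b → (a + [ isEmpty X₂ ]ᵇ * (P c j * δ₀ (k ℕ.+ j))) + (t j - ι (suc j) * P c (suc j) * Φ ks X₂ b))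
             (trans (cong (P c j *_) (shift k j)) (swap (P c j) (ι k) (Φ ks X₂ (ℕ.pred k ℕ.+ j))))
             (cong ℕ.pred (sym (ℕ.+-suc k j))) ⟩
      (ι k * (P c j * Φ ks X₂ (ℕ.pred k ℕ.+ j)) + [ isEmpty X₂ ]ᵇ * (P c j * δ₀ (k ℕ.+ j))) + (t j - t (suc j)) ∎
      where
      φ = Φ ks X₂ (ℕ.pred (k ℕ.+ j))
      swap : ∀ a b c → a * (b * c) ≡ b * (a * c)
      swap = solve-∀ ℚ-ring

  -- The value at t = 0 sees only constant terms, and P_c has a nonzero constant term exactly for c
  -- = 0.
  constant : [ isEmpty X₂ ]ᵇ * ∑< (suc n) (λ j → P c j * δ₀ (k ℕ.+ j)) ≡ [ isEmpty X ]ᵇ * δ₀ k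
  constant = trans
    (cong ([ isEmpty X₂ ]ᵇ *_) (trans
      (cong₂ _+_ (cong₂ _*_ (P-zero X₁) (cong δ₀ (ℕ.+-identityʳ k)))
        (∑<-zero n (λ j → trans (cong (P c (suc j) *_) (cong δ₀ (ℕ.+-suc k j))) (*-zeroʳ (P c (suc j))))))
      (+-identityʳ _)))
    (trans (lem [ isEmpty X₂ ]ᵇ [ isEmpty X₁ ]ᵇ (δ₀ k)) (cong (_* δ₀ k) (sym (isEmpty-split n X))))
    where
    lem : ∀ a b c → a * (b * c) ≡ (b * a) * c
    lem = solve-∀ ℚ-ring

inOnePart⇒ : ∀ ks S → T (inOnePart ks S) → ∀ u v → u ∈ S → v ∈ S → part ks u ≡ part ks v
inOnePart⇒ [] [] h () 
inOnePart⇒ (n ∷ ks) S h u v u∈S v∈S = go (isEmpty (take n S)) refl h (splitAt n u) refl (splitAt n v) refl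
  where
  lookup-split : ∀ v → lookup S v ≡ [ lookup (take n S) , lookup (drop n S) ]′ (splitAt n v)
  lookup-split v = trans (cong (λ Z → lookup Z v) (sym (Vec.take++drop≡id n S))) (Vec.lookup-splitAt n (take n S) (drop n S) v)
  ∈₁ : ∀ {v i} → splitAt n v ≡ inj₁ i → v ∈ S → i ∈ take n S
  ∈₁ {v} eq p = subst T (trans (lookup-split v) (cong [ lookup (take n S) , lookup (drop n S) ]′ eq)) p
  ∈₂ : ∀ {v i} → splitAt n v ≡ inj₂ i → v ∈ S → i ∈ drop n S
  ∈₂ {v} eq p = subst T (trans (lookup-split v) (cong [ lookup (take n S) , lookup (drop n S) ]′ eq)) p
  go : ∀ e → isEmpty (take n S) ≡ e → T (if e then inOnePart ks (drop n S) else isEmpty (drop n S)) →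
       ∀ x → splitAt n u ≡ x → ∀ y → splitAt n v ≡ y →
       [ const zero , suc ∘ part ks ]′ (splitAt n u) ≡ [ const zero , suc ∘ part ks ]′ (splitAt n v)
  go true  eq h (inj₁ i) pu y        pv = ⊥-elim (∈⇒¬isEmpty (take n S) i (∈₁ pu u∈S) (subst T (sym eq) tt))
  go true  eq h (inj₂ i) pu (inj₁ j) pv = ⊥-elim (∈⇒¬isEmpty (take n S) j (∈₁ pv v∈S) (subst T (sym eq) tt))
  go true  eq h (inj₂ i) pu (inj₂ j) pv rewrite pu | pv =
    cong suc (inOnePart⇒ ks (drop n S) h i j (∈₂ pu u∈S) (∈₂ pv v∈S))
  go false eq h (inj₂ i) pu y        pv = ⊥-elim (∈⇒¬isEmpty (drop n S) i (∈₂ pu u∈S) h)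
  go false eq h (inj₁ i) pu (inj₂ j) pv = ⊥-elim (∈⇒¬isEmpty (drop n S) j (∈₂ pv v∈S) h)
  go false eq h (inj₁ i) pu (inj₁ j) pv rewrite pu | pv = refl

⇒inOnePart : ∀ ks S → (∀ u v → u ∈ S → v ∈ S → part ks u ≡ part ks v) → T (inOnePart ks S)
⇒inOnePart []       S h = tt
⇒inOnePart (n ∷ ks) S h = go (isEmpty (take n S)) refl
  where
  lookup₁ : ∀ i → lookup S (i Fin.↑ˡ sum ks) ≡ lookup (take n S) i
  lookup₁ i = trans (cong (λ Z → lookup Z (i Fin.↑ˡ sum ks)) (sym (Vec.take++drop≡id n S))) (Vec.lookup-++ˡ (take n S) (drop n S) i)
  lookup₂ : ∀ i → lookup S (n Fin.↑ʳ i) ≡ lookup (drop n S) i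
  lookup₂ i = trans (cong (λ Z → lookup Z (n Fin.↑ʳ i)) (sym (Vec.take++drop≡id n S))) (Vec.lookup-++ʳ (take n S) (drop n S) i)
  part₁ : ∀ i → part (n ∷ ks) (i Fin.↑ˡ sum ks) ≡ zero
  part₁ i = cong [ const zero , suc ∘ part ks ]′ (Fin.splitAt-↑ˡ n i (sum ks))
  part₂ : ∀ i → part (n ∷ ks) (n Fin.↑ʳ i) ≡ suc (part ks i)
  part₂ i = cong [ const zero , suc ∘ part ks ]′ (Fin.splitAt-↑ʳ n (sum ks) i)
  go : ∀ e → isEmpty (take n S) ≡ e → T (if e then inOnePart ks (drop n S) else isEmpty (drop n S))
  go true  eq = ⇒inOnePart ks (drop n S) λ u v u∈ v∈ → Fin.suc-injective
    (trans (sym (part₂ u)) (trans (h _ _ (subst T (sym (lookup₂ u)) u∈) (subst T (sym (lookup₂ v)) v∈)) (part₂ v)))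
  go false eq = decidable-stable (T? _) λ ne →
    let u , u∈ = ¬isEmpty⇒∈ (take n S) (subst T eq)
        v , v∈ = ¬isEmpty⇒∈ (drop n S) ne
    in Fin.0≢1+n (trans (sym (part₁ u)) (trans (h _ _ (subst T (sym (lookup₁ u)) u∈) (subst T (sym (lookup₂ v)) v∈)) (part₂ v)))

independent-inOnePart : ∀ ks S → 𝟙 (independent? (completeMultipartite ks) S) ≡ [ inOnePart ks S ]ᵇ
independent-inOnePart ks S = 𝟙-cong (independent? (completeMultipartite ks) S) (T? (inOnePart ks S))
  (λ ind → ⇒inOnePart ks S λ u v u∈ v∈ → decidable-stable (part ks u Fin.≟ part ks v) (ind u v u∈ v∈))
  (λ one u v u∈ v∈ u≢v → u≢v (inOnePart⇒ ks S one u v u∈ v∈))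

-- Both sides solve the same recurrence: at k = 0 the derivative term of `weighted-Φ` has the factor
-- `ι 0`, and the indicator of X = ∅ remains.
#AO≡Φ : ∀ ks X → #AO (restrict (completeMultipartite ks) X) ≡ Φ ks X 0
#AO≡Φ ks = ∑⊆-∖-injective (λ S → sign S * [ inOnePart ks S ]ᵇ) (λ X → #AO (restrict G X)) (λ X → Φ ks X 0)
  (cong₂ _*_ (sign-∅ (sum ks)) (inOnePart-∅ ks))
  λ X → begin
    ∑⊆ X (λ S → (sign S * [ inOnePart ks S ]ᵇ) * #AO (restrict G (X ∖ S)))
      ≡⟨ ∑⊆-cong X (λ S _ → cong (λ z → (sign S * z) * #AO (restrict G (X ∖ S))) (independent-inOnePart ks S)) ⟨
    ∑⊆ X (λ S → (sign S * 𝟙 (independent? G S)) * #AO (restrict G (X ∖ S)))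
      ≡⟨ ∑⊆-#AO G X ⟩
    [ isEmpty X ]ᵇ
      ≡⟨ lem [ isEmpty X ]ᵇ (Φ ks X 0) ⟩
    0ℚ * Φ ks X 0 + [ isEmpty X ]ᵇ * 1ℚ
      ≡⟨ cong (λ z → z * Φ ks X 0 + [ isEmpty X ]ᵇ * 1ℚ) ι-0 ⟨
    ι 0 * Φ ks X 0 + [ isEmpty X ]ᵇ * 1ℚ
      ≡⟨ weighted-Φ ks X 0 ⟨
    weighted ks X 0 ∎
  where
  open ≡-Reasoning
  G = completeMultipartite ks
  lem : ∀ a b → a ≡ 0ℚ * b + a * 1ℚ
  lem = solve-∀ ℚ-ring
  inOnePart-∅ : ∀ ks → [ inOnePart ks ∅ ]ᵇ ≡ 1ℚ
  inOnePart-∅ ks = cong [_]ᵇ (T⇒≡true (⇒inOnePart ks ∅ λ u v u∈ _ → ⊥-elim (∈⇒¬isEmpty ∅ u u∈ (subst T (sym (isEmpty-∅ (sum ks))) tt))))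

-- On the full vertex set only the part sizes matter: `φ ks k` is L applied to t^k times the product
-- of P_n over n in `ks`.
φ : List ℕ → ℕ → ℚ
φ []       k = ι (k !)
φ (n ∷ ks) k = ∑< (suc n) (λ j → P n j * φ ks (k ℕ.+ j))

full : ∀ n → Vec Bool n
full n = Vec.replicate n true

Φ-full : ∀ ks k → Φ ks (full (sum ks)) k ≡ φ ks k
Φ-full []       k = refl
Φ-full (n ∷ ks) k = ∑<-cong (suc n) λ j → cong₂ _*_
  (cong (λ c → P c j) (trans (cong card (take-full n (sum ks))) (card-full n)))
  (trans (cong (λ Z → Φ ks Z (k ℕ.+ j)) (drop-full n (sum ks))) (Φ-full ks (k ℕ.+ j)))
  where
  take-full : ∀ n m → take n (full (n ℕ.+ m)) ≡ full n
  take-full zero    m = refl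
  take-full (suc n) m = cong (true ∷_) (take-full n m)
  drop-full : ∀ n m → drop n (full (n ℕ.+ m)) ≡ full m
  drop-full zero    m = refl
  drop-full (suc n) m = drop-full n m
  card-full : ∀ n → card (full n) ≡ n
  card-full zero    = refl
  card-full (suc n) = cong suc (card-full n)

#acyclicOrientations≡φ : ∀ ks → ι (#acyclicOrientations (completeMultipartite ks)) ≡ φ ks 0
#acyclicOrientations≡φ ks = begin
  ι (#acyclicOrientations G)
    ≡⟨ length-filter (acyclicOrientation? G) 𝒟 ⟩
  #AO G
    ≡⟨ ∑ᴸ-cong 𝒟 (λ o → 𝟙-cong (acyclicOrientation? G o) (acyclicOrientation? (restrict G X) o)
         (λ ((a , b , c) , acyc) → ((λ u v → λ p → ∈full u , ∈full v , a u v p) , (λ u v (_ , _ , p) → b u v p) , c) , acyc)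
         (λ ((a , b , c) , acyc) → ((λ u v p → proj₂ (proj₂ (a u v p))) , (λ u v p → b u v (∈full u , ∈full v , p)) , c) , acyc)) ⟩
  #AO (restrict G X)
    ≡⟨ #AO≡Φ ks X ⟩
  Φ ks X 0
    ≡⟨ Φ-full ks 0 ⟩
  φ ks 0 ∎
  where
  open ≡-Reasoning
  G = completeMultipartite ks
  𝒟 = allDigraphs (sum ks)
  X = full (sum ks)
  ∈full : ∀ {n} (v : Fin n) → v ∈ full n
  ∈full v = subst T (sym (Vec.lookup-replicate v true)) tt

-- Formal power series

-- The Cauchy product; peeling off the leading coefficient of f avoids index subtraction.
conv : (ℕ → ℚ) → (ℕ → ℚ) → ℕ → ℚ
conv f g zero    = f 0 * g 0
conv f g (suc k) = f 0 * g (suc k) + conv (f ∘ suc) g k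

conv-cong : ∀ {f f′ g g′} k → (∀ i → f i ≡ f′ i) → (∀ i → g i ≡ g′ i) → conv f g k ≡ conv f′ g′ k
conv-cong zero    hf hg = cong₂ _*_ (hf 0) (hg 0)
conv-cong (suc k) hf hg = cong₂ _+_ (cong₂ _*_ (hf 0) (hg (suc k))) (conv-cong k (hf ∘ suc) hg)

conv-*ˡ : ∀ a f g k → conv (λ i → a * f i) g k ≡ a * conv f g k
conv-*ˡ a f g zero    = *-assoc a (f 0) (g 0)
conv-*ˡ a f g (suc k) = trans (cong₂ _+_ (*-assoc a (f 0) (g (suc k))) (conv-*ˡ a (f ∘ suc) g k))
  (sym (*-distribˡ-+ a (f 0 * g (suc k)) (conv (f ∘ suc) g k)))

conv-*ʳ : ∀ a f g k → conv f (λ i → a * g i) k ≡ a * conv f g k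
conv-*ʳ a f g zero    = lem (f 0) a (g 0)
  where
  lem : ∀ x a y → x * (a * y) ≡ a * (x * y)
  lem = solve-∀ ℚ-ring
conv-*ʳ a f g (suc k) = trans (cong (_+_ (f 0 * (a * g (suc k)))) (conv-*ʳ a (f ∘ suc) g k))
  (lem (f 0) a (g (suc k)) (conv (f ∘ suc) g k))
  where
  lem : ∀ x a y z → x * (a * y) + a * z ≡ a * (x * y + z)
  lem = solve-∀ ℚ-ring

conv-+ˡ : ∀ f g h k → conv (λ i → f i + g i) h k ≡ conv f h k + conv g h k
conv-+ˡ f g h zero    = *-distribʳ-+ (h 0) (f 0) (g 0)
conv-+ˡ f g h (suc k) = trans (cong (_+_ ((f 0 + g 0) * h (suc k))) (conv-+ˡ (f ∘ suc) (g ∘ suc) h k))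
  (lem (f 0) (g 0) (h (suc k)) (conv (f ∘ suc) h k) (conv (g ∘ suc) h k))
  where
  lem : ∀ a b c x y → (a + b) * c + (x + y) ≡ (a * c + x) + (b * c + y)
  lem = solve-∀ ℚ-ring

conv-sucʳ : ∀ f g k → conv f g (suc k) ≡ conv f (g ∘ suc) k + f (suc k) * g 0
conv-sucʳ f g zero    = refl
conv-sucʳ f g (suc k) = trans (cong (_+_ (f 0 * g (suc (suc k)))) (conv-sucʳ (f ∘ suc) g k))
  (sym (+-assoc (f 0 * g (suc (suc k))) (conv (f ∘ suc) (g ∘ suc) k) (f (suc (suc k)) * g 0)))

conv-scale : ∀ x f g k → conv (λ i → f i * x ^ i) (λ i → g i * x ^ i) k ≡ conv f g k * x ^ k
conv-scale x f g zero    = lem (f 0) (g 0)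
  where
  lem : ∀ a b → a * 1ℚ * (b * 1ℚ) ≡ a * b * 1ℚ
  lem = solve-∀ ℚ-ring
conv-scale x f g (suc k) = trans
  (cong (_+_ (f 0 * 1ℚ * (g (suc k) * (x * x ^ k)))) (trans
    (conv-cong k (λ i → lem₁ (f (suc i)) x (x ^ i)) (λ _ → refl))
    (trans (conv-*ˡ x (λ i → f (suc i) * x ^ i) (λ i → g i * x ^ i) k) (cong (x *_) (conv-scale x (f ∘ suc) g k)))))
  (lem₂ (f 0) (g (suc k)) x (x ^ k) (conv (f ∘ suc) g k))
  where
  lem₁ : ∀ a x y → a * (x * y) ≡ x * (a * y)
  lem₁ = solve-∀ ℚ-ring
  lem₂ : ∀ a b x y c → a * 1ℚ * (b * (x * y)) + x * (c * y) ≡ (a * b + c) * (x * y)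
  lem₂ = solve-∀ ℚ-ring

conv-nonNeg : ∀ f g k → (∀ i → 0ℚ ≤ f i) → (∀ i → 0ℚ ≤ g i) → 0ℚ ≤ conv f g k
conv-nonNeg f g zero    hf hg = 0≤p*q (hf 0) (hg 0)
conv-nonNeg f g (suc k) hf hg = 0≤p+q (0≤p*q (hf 0) (hg (suc k))) (conv-nonNeg (f ∘ suc) g k (hf ∘ suc) hg)

∣conv∣ : ∀ f g k → ∣ conv f g k ∣ ≤ conv (∣_∣ ∘ f) (∣_∣ ∘ g) k
∣conv∣ f g zero    = ≤-reflexive (∣p*q∣≡∣p∣*∣q∣ (f 0) (g 0))
∣conv∣ f g (suc k) = ∣+∣-mono (≤-reflexive (∣p*q∣≡∣p∣*∣q∣ (f 0) (g (suc k)))) (∣conv∣ (f ∘ suc) g k)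

-- The square i, j < K contains all pairs with i + j < K, and `c` kills the remaining ones.
-- Truncated series therefore multiply exactly on sequences that vanish from K on.
cauchy-product : ∀ K f g (c : ℕ → ℚ) → (∀ l → K ℕ.≤ l → c l ≡ 0ℚ) →
  ∑< K (λ i → f i * ∑< K (λ j → g j * c (i ℕ.+ j))) ≡ ∑< K (λ l → conv f g l * c l)
cauchy-product zero    f g c h = refl
cauchy-product (suc K) f g c h = begin
  f 0 * (g 0 * c 0 + s) + ∑< K (λ i → f (suc i) * ∑< (suc K) (λ j → g j * c (suc (i ℕ.+ j))))
    ≡⟨ cong (_+_ (f 0 * (g 0 * c 0 + s))) (trans
         (∑<-cong K (λ i → cong (f (suc i) *_) (drop-last i)))
         (cauchy-product K (f ∘ suc) g (c ∘ suc) (λ l K≤l → h (suc l) (ℕ.s≤s K≤l)))) ⟩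
  f 0 * (g 0 * c 0 + s) + s′
    ≡⟨ lem (f 0) (g 0) (c 0) s s′ ⟩
  f 0 * g 0 * c 0 + (f 0 * s + s′)
    ≡⟨ cong (_+_ (f 0 * g 0 * c 0)) (trans (cong (_+ s′) (sym (∑<-*ˡ K (f 0) (λ l → g (suc l) * c (suc l)))))
         (trans (sym (∑<-+ K (λ l → f 0 * (g (suc l) * c (suc l))) (λ l → conv (f ∘ suc) g l * c (suc l))))
           (∑<-cong K λ l → lem′ (f 0) (g (suc l)) (conv (f ∘ suc) g l) (c (suc l))))) ⟩
  f 0 * g 0 * c 0 + ∑< K (λ l → conv f g (suc l) * c (suc l)) ∎
  where
  open ≡-Reasoning
  s  = ∑< K (λ j → g (suc j) * c (suc j))
  s′ = ∑< K (λ l → conv (f ∘ suc) g l * c (suc l))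
  lem : ∀ f g c s s′ → f * (g * c + s) + s′ ≡ f * g * c + (f * s + s′)
  lem = solve-∀ ℚ-ring
  lem′ : ∀ f g d c → f * (g * c) + d * c ≡ (f * g + d) * c
  lem′ = solve-∀ ℚ-ring
  drop-last : ∀ i → ∑< (suc K) (λ j → g j * c (suc (i ℕ.+ j))) ≡ ∑< K (λ j → g j * c (suc (i ℕ.+ j)))
  drop-last i = trans (∑<-last K (λ j → g j * c (suc (i ℕ.+ j))))
    (trans (cong (λ z → ∑< K (λ j → g j * c (suc (i ℕ.+ j))) + g K * z) (h (suc (i ℕ.+ K)) (ℕ.s≤s (ℕ.m≤n+m K i))))
      (trans (cong (_+_ (∑< K (λ j → g j * c (suc (i ℕ.+ j))))) (*-zeroʳ (g K)))
        (+-identityʳ (∑< K (λ j → g j * c (suc (i ℕ.+ j)))))))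

-- The indicator of l < K. Used as the vanishing sequence of `cauchy-product`, it turns partial sums
-- of a Cauchy product into cut-off sums over a square.
ind : ℕ → ℕ → ℚ
ind zero    l       = 0ℚ
ind (suc K) zero    = 1ℚ
ind (suc K) (suc l) = ind K l

ind-≥ : ∀ K l → K ℕ.≤ l → ind K l ≡ 0ℚ
ind-≥ zero    l       _           = refl
ind-≥ (suc K) (suc l) (ℕ.s≤s K≤l) = ind-≥ K l K≤l

ind-< : ∀ K l → l ℕ.< K → ind K l ≡ 1ℚ
ind-< (suc K) zero    _           = refl
ind-< (suc K) (suc l) (ℕ.s≤s l<K) = ind-< K l l<K

0≤ind : ∀ K l → 0ℚ ≤ ind K l
0≤ind zero    l       = ≤-refl
0≤ind (suc K) zero    = nonNegative⁻¹ 1ℚ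
0≤ind (suc K) (suc l) = 0≤ind K l

ind≤1 : ∀ K l → ind K l ≤ 1ℚ
ind≤1 zero    l       = nonNegative⁻¹ 1ℚ
ind≤1 (suc K) zero    = ≤-refl
ind≤1 (suc K) (suc l) = ind≤1 K l

∑<-conv : ∀ K f g → ∑< K (conv f g) ≡ ∑< K (λ i → f i * ∑< K (λ j → g j * ind K (i ℕ.+ j)))
∑<-conv K f g = trans
  (∑<-cong< K λ l l<K → trans (sym (*-identityʳ (conv f g l))) (cong (conv f g l *_) (sym (ind-< K l l<K))))
  (sym (cauchy-product K f g (ind K) (ind-≥ K)))

∑<-conv-≤ : ∀ K f g → (∀ i → 0ℚ ≤ f i) → (∀ i → 0ℚ ≤ g i) → ∑< K (conv f g) ≤ ∑< K f * ∑< K g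
∑<-conv-≤ K f g hf hg = subst₂ _≤_ (sym (∑<-conv K f g)) (∑<-*ʳ K (∑< K g) f)
  (∑<-mono K λ i → *-monoˡ-≤ (hf i) (∑<-mono K λ j →
    subst (g j * ind K (i ℕ.+ j) ≤_) (*-identityʳ (g j)) (*-monoˡ-≤ (hg j) (ind≤1 K (i ℕ.+ j)))))

-- Exponential series

expTerm-suc : ∀ p n → ι (suc n) * expTerm p (suc n) ≡ p * expTerm p n
expTerm-suc p n = begin
  ι (suc n) * (p * p ^ n * i!suc)         ≡⟨ cong (λ z → ι (suc n) * (p * p ^ n * z)) i!suc≡ ⟩
  ι (suc n) * (p * p ^ n * (i * i!))      ≡⟨ lem (ι (suc n)) p (p ^ n) i i! ⟩
  (ι (suc n) * i) * (p * (p ^ n * i!))    ≡⟨ cong (_* (p * (p ^ n * i!))) (1/-inverse (suc n)) ⟩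
  1ℚ * (p * (p ^ n * i!))                 ≡⟨ *-identityˡ _ ⟩
  p * (p ^ n * i!)                        ∎
  where
  open ≡-Reasoning
  instance
    _ = n ℕ.!≢0
    _ = suc n ℕ.!≢0
  i     = + 1 / suc n
  i!    = + 1 / n !
  i!suc = + 1 / suc n !
  lem : ∀ s p q i j → s * (p * q * (i * j)) ≡ (s * i) * (p * (q * j))
  lem = solve-∀ ℚ-ring
  i!suc≡ : i!suc ≡ i * i!
  i!suc≡ = 1/-* (suc n) (n !)

-- The hypothesis is y′ = p y coefficient by coefficient, so the initial value determines
-- everything.
expTerm-unique : ∀ p (f : ℕ → ℚ) → f 0 ≡ 1ℚ → (∀ n → ι (suc n) * f (suc n) ≡ p * f n) → ∀ n → f n ≡ expTerm p n
expTerm-unique p f f0 fs zero    = f0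
expTerm-unique p f f0 fs (suc n) = begin
  f (suc n)                                       ≡⟨ cancel (f (suc n)) ⟩
  (+ 1 / suc n) * (ι (suc n) * f (suc n))         ≡⟨ cong ((+ 1 / suc n) *_) (trans (fs n) (cong (p *_) (expTerm-unique p f f0 fs n))) ⟩
  (+ 1 / suc n) * (p * expTerm p n)               ≡⟨ cong ((+ 1 / suc n) *_) (expTerm-suc p n) ⟨
  (+ 1 / suc n) * (ι (suc n) * expTerm p (suc n)) ≡⟨ cancel (expTerm p (suc n)) ⟨
  expTerm p (suc n)                               ∎
  where
  open ≡-Reasoning
  lem : ∀ a b c → a * (b * c) ≡ (b * a) * c
  lem = solve-∀ ℚ-ring
  cancel : ∀ x → x ≡ (+ 1 / suc n) * (ι (suc n) * x)
  cancel x = sym (trans (lem (+ 1 / suc n) (ι (suc n)) x) (trans (cong (_* x) (1/-inverse (suc n))) (*-identityˡ x)))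

-- The Euler operator x d/dx; `conv-θ` is its Leibniz rule.
θ : (ℕ → ℚ) → ℕ → ℚ
θ f i = ι i * f i

conv-θ : ∀ f g k → ι k * conv f g k ≡ conv (θ f) g k + conv f (θ g) k
conv-θ f g zero    = trans (cong (_* (f 0 * g 0)) ι-0) (trans (lem (f 0) (g 0))
  (cong (λ z → z * f 0 * g 0 + f 0 * (z * g 0)) (sym ι-0)))
  where
  lem : ∀ a b → 0ℚ * (a * b) ≡ 0ℚ * a * b + a * (0ℚ * b)
  lem = solve-∀ ℚ-ring
conv-θ f g (suc k) = begin
  ι (suc k) * (f 0 * g (suc k) + c)
    ≡⟨ *-distribˡ-+ (ι (suc k)) (f 0 * g (suc k)) c ⟩
  ι (suc k) * (f 0 * g (suc k)) + ι (suc k) * c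
    ≡⟨ cong (λ z → ι (suc k) * (f 0 * g (suc k)) + z) (trans (cong (_* c) (ι-suc k))
         (trans (lem₁ (ι k) c) (cong (_+_ c) (conv-θ (f ∘ suc) g k)))) ⟩
  ι (suc k) * (f 0 * g (suc k)) + (c + (conv (θ (f ∘ suc)) g k + conv (f ∘ suc) (θ g) k))
    ≡⟨ lem₂ (ι (suc k)) (f 0) (g (suc k)) c (conv (θ (f ∘ suc)) g k) (conv (f ∘ suc) (θ g) k) ⟩
  (0ℚ * f 0 * g (suc k) + (c + conv (θ (f ∘ suc)) g k)) + (f 0 * (ι (suc k) * g (suc k)) + conv (f ∘ suc) (θ g) k)
    ≡⟨ cong₂ (λ y z → (y * f 0 * g (suc k) + z) + conv f (θ g) (suc k)) (sym ι-0)
         (trans (sym (conv-+ˡ (f ∘ suc) (θ (f ∘ suc)) g k))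
           (conv-cong k (λ i → trans (lem₃ (f (suc i)) (ι i)) (cong (_* f (suc i)) (sym (ι-suc i)))) (λ _ → refl))) ⟩
  conv (θ f) g (suc k) + conv f (θ g) (suc k) ∎
  where
  open ≡-Reasoning
  c = conv (f ∘ suc) g k
  lem₁ : ∀ k c → (1ℚ + k) * c ≡ c + k * c
  lem₁ = solve-∀ ℚ-ring
  lem₂ : ∀ k f g c x y → k * (f * g) + (c + (x + y)) ≡ (0ℚ * f * g + (c + x)) + (f * (k * g) + y)
  lem₂ = solve-∀ ℚ-ring
  lem₃ : ∀ f i → f + i * f ≡ (1ℚ + i) * f
  lem₃ = solve-∀ ℚ-ring

-- By the Leibniz rule the product satisfies y′ = (p + q) y, which characterises the exponential and
-- bypasses binomial coefficients.
conv-expTerm : ∀ p q k → conv (expTerm p) (expTerm q) k ≡ expTerm (p + q) k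
conv-expTerm p q = expTerm-unique (p + q) (conv e f) refl λ k → begin
  ι (suc k) * conv e f (suc k)
    ≡⟨ conv-θ e f (suc k) ⟩
  conv (θ e) f (suc k) + conv e (θ f) (suc k)
    ≡⟨ cong₂ _+_
         (trans (cong₂ (λ y z → y * 1ℚ * f (suc k) + z) ι-0
                  (trans (conv-cong k (expTerm-suc p) (λ _ → refl)) (conv-*ˡ p e f k)))
           (lem₁ (f (suc k)) (p * conv e f k)))
         (trans (conv-sucʳ e (θ f) k)
           (trans (cong₂ (λ y z → z + e (suc k) * (y * 1ℚ)) ι-0
                    (trans (conv-cong k (λ _ → refl) (expTerm-suc q)) (conv-*ʳ q e f k)))
             (lem₂ (e (suc k)) (q * conv e f k)))) ⟩
  p * conv e f k + q * conv e f k
    ≡⟨ *-distribʳ-+ (conv e f k) p q ⟨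
  (p + q) * conv e f k ∎
  where
  open ≡-Reasoning
  e = expTerm p
  f = expTerm q
  lem₁ : ∀ a b → 0ℚ * 1ℚ * a + b ≡ b
  lem₁ = solve-∀ ℚ-ring
  lem₂ : ∀ a b → b + a * (0ℚ * 1ℚ) ≡ b
  lem₂ = solve-∀ ℚ-ring

expTerm-zero : ∀ n → expTerm 0ℚ (suc n) ≡ 0ℚ
expTerm-zero n = trans (cong (_* ((+ 1 / suc n !) {{suc n ℕ.!≢0}})) (*-zeroˡ (0ℚ ^ n))) (*-zeroˡ ((+ 1 / suc n !) {{suc n ℕ.!≢0}}))

expTerm-* : ∀ p q n → expTerm (p * q) n ≡ expTerm p n * q ^ n
expTerm-* p q n = trans (cong (_* ((+ 1 / n !) {{n ℕ.!≢0}})) (^-distribˡ-* p q n)) (lem (p ^ n) (q ^ n) ((+ 1 / n !) {{n ℕ.!≢0}}))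
  where
  lem : ∀ a b c → a * b * c ≡ a * c * b
  lem = solve-∀ ℚ-ring

∣expTerm∣ : ∀ p n → ∣ expTerm p n ∣ ≡ expTerm ∣ p ∣ n
∣expTerm∣ p n = trans (∣p*q∣≡∣p∣*∣q∣ (p ^ n) i) (cong₂ _*_ (∣^∣ p n) (0≤p⇒∣p∣≡p (0≤1/ (n !) {{n ℕ.!≢0}})))
  where i = (+ 1 / n !) {{n ℕ.!≢0}}

expTerm-mono : ∀ {p q} n → 0ℚ ≤ p → p ≤ q → expTerm p n ≤ expTerm q n
expTerm-mono n 0≤p p≤q = *-monoʳ-≤ (0≤1/ (n !) {{n ℕ.!≢0}}) (^-monoˡ-≤ n 0≤p p≤q)

0≤expTerm : ∀ {p} n → 0ℚ ≤ p → 0ℚ ≤ expTerm p n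
0≤expTerm n 0≤p = 0≤p*q (0≤p^n n 0≤p) (0≤1/ (n !) {{n ℕ.!≢0}})

expSum≡∑< : ∀ p n → expSum p n ≡ ∑< n (expTerm p)
expSum≡∑< p zero    = refl
expSum≡∑< p (suc n) = trans (cong (_+ expTerm p n) (expSum≡∑< p n)) (sym (∑<-last n (expTerm p)))

expSum-mono : ∀ {p} → 0ℚ ≤ p → ∀ {m n} → m ℕ.≤ n → expSum p m ≤ expSum p n
expSum-mono {p} 0≤p m≤n = go (ℕ.≤⇒≤′ m≤n)
  where
  go : ∀ {m n} → m ℕ.≤′ n → expSum p m ≤ expSum p n
  go ℕ.≤′-refl              = ≤-refl
  go (ℕ.≤′-step {n} m≤n)    = ≤-trans (go m≤n) (p≤p+q (0≤expTerm n 0≤p))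

-- Monotonicity carries n up to `n ⊔ K`, where the Cauchy property compares with `x K`.
cauchy-bounded : ∀ x → IsCauchy x → (∀ {m n} → m ℕ.≤ n → x m ≤ x n) → ∃[ M ] ∀ n → x n ≤ M
cauchy-bounded x cx mono with cx 1ℚ (positive⁻¹ 1ℚ)
... | K , h = x K + 1ℚ , λ n → ≤-trans (mono (ℕ.m≤m⊔n n K))
    (subst (_≤ x K + 1ℚ) (lem (x (n ℕ.⊔ K)) (x K))
      (+-monoʳ-≤ (x K) (≤-trans (p≤∣p∣ (x (n ℕ.⊔ K) - x K)) (<⇒≤ (h (n ℕ.⊔ K) K (ℕ.m≤n⊔m n K) ℕ.≤-refl)))))
  where
  lem : ∀ a b → b + (a - b) ≡ a
  lem = solve-∀ ℚ-ring

expSum-bounded : ∀ p → 0ℚ ≤ p → ∃[ M ] ∀ n → ∑< n (expTerm p) ≤ M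
expSum-bounded p 0≤p =
  let M , h = cauchy-bounded (expSum p) (cauchy (exp p)) (expSum-mono 0≤p) in
  M , λ n → subst (_≤ M) (expSum≡∑< p n) (h n)

-- Reversed polynomials and their first coefficients

-- p n i = P n (n - i) are the coefficients of the reversed polynomial x^n P_n(1/x).
p : ℕ → ℕ → ℚ
p zero    zero    = 1ℚ
p zero    (suc i) = 0ℚ
p (suc n) zero    = p n zero
p (suc n) (suc i) = p n (suc i) - ι (n ℕ.∸ i) * p n i

p-vanishes : ∀ n i → n ℕ.< i → p n i ≡ 0ℚ
p-vanishes zero    (suc i) _           = refl
p-vanishes (suc n) (suc i) (ℕ.s≤s n<i) = trans
  (cong₂ (λ a b → a - ι (n ℕ.∸ i) * b) (p-vanishes n (suc i) (ℕ.m≤n⇒m≤1+n n<i)) (p-vanishes n i n<i))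
  (lem (ι (n ℕ.∸ i)))
  where
  lem : ∀ a → 0ℚ - a * 0ℚ ≡ 0ℚ
  lem = solve-∀ ℚ-ring

p≡P : ∀ n i → i ℕ.≤ n → p n i ≡ P n (n ℕ.∸ i)
p≡P zero    zero    _ = refl
p≡P (suc n) zero    _ = trans (p≡P n zero ℕ.z≤n) (sym (trans
  (cong (λ z → P n n - ι (suc n) * z) (P-vanishes n (suc n) ℕ.≤-refl)) (lem (P n n) (ι (suc n)))))
  where
  lem : ∀ a b → a - b * 0ℚ ≡ a
  lem = solve-∀ ℚ-ring
p≡P (suc n) (suc i) (ℕ.s≤s i≤n) with ℕ.m≤n⇒m<n∨m≡n i≤n
-- Constant term: `P (suc n) 0` is 0 by definition, and in the recursion of `p` the factor n - i
-- vanishes.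
... | inj₂ refl = trans
  (cong₂ (λ a b → a - ι b * p n n) (p-vanishes n (suc n) ℕ.≤-refl) (ℕ.n∸n≡0 n))
  (trans (cong (λ z → 0ℚ - z * p n n) ι-0) (trans (lem (p n n)) (cong (P (suc n)) (sym (ℕ.n∸n≡0 n)))))
  where
  lem : ∀ a → 0ℚ - 0ℚ * a ≡ 0ℚ
  lem = solve-∀ ℚ-ring
... | inj₁ i<n = trans
  (cong₂ (λ a b → a - ι (n ℕ.∸ i) * b) (p≡P n (suc i) i<n) (p≡P n i i≤n))
  (trans (cong (λ z → P n (n ℕ.∸ suc i) - ι z * P n z) eq) (cong (P (suc n)) (sym eq)))
  where
  eq : n ℕ.∸ i ≡ suc (n ℕ.∸ suc i)
  eq = ℕ.+-∸-assoc 1 i<n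

p-0 : ∀ n → p n 0 ≡ 1ℚ
p-0 zero    = refl
p-0 (suc n) = p-0 n

-- Turns the integer quotient into a rational polynomial in `ι n`, which the ring solver can handle;
-- likewise for `B≡`.
A≡ : ∀ n → A n ≡ - (ι n * (ι n - 1ℚ)) * ½
A≡ n = trans (/≡ιℤ* (ℤ.- (+ n ℤ.* (+ n ℤ.- + 1))) 2) (cong (_* ½)
  (trans (ιℤ-neg (+ n ℤ.* (+ n ℤ.- + 1))) (cong -_ (trans (ιℤ-* (+ n) (+ n ℤ.- + 1))
    (cong (ι n *_) (trans (ιℤ-+ (+ n) (ℤ.- + 1)) (cong (_+_ (ι n)) (ιℤ≡/1 (ℤ.- + 1)))))))))

B≡ : ∀ n → B n ≡ ι n * (ι n - 1ℚ) * (ι n - (+ 2 / 1)) * ((+ 3 / 1) * ι n - (+ 5 / 1)) * (+ 1 / 24)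
B≡ n = trans (/≡ιℤ* (j ℤ.* (j ℤ.- + 1) ℤ.* (j ℤ.- + 2) ℤ.* (+ 3 ℤ.* j ℤ.- + 5)) 24) (cong (_* (+ 1 / 24))
  (trans (ιℤ-* (j ℤ.* (j ℤ.- + 1) ℤ.* (j ℤ.- + 2)) (+ 3 ℤ.* j ℤ.- + 5)) (cong₂ _*_
    (trans (ιℤ-* (j ℤ.* (j ℤ.- + 1)) (j ℤ.- + 2)) (cong₂ _*_
      (trans (ιℤ-* j (j ℤ.- + 1)) (cong (ι n *_) (minus j 1)))
      (minus j 2)))
    (trans (minus (+ 3 ℤ.* j) 5) (cong (_- (+ 5 / 1)) (trans (ιℤ-* (+ 3) j) (cong (_* ι n) (ιℤ≡/1 (+ 3)))))))))
  where
  j = + n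
  minus : ∀ i m → ιℤ (i ℤ.- + m) ≡ ιℤ i - (+ m / 1)
  minus i m = trans (ιℤ-+ i (ℤ.- + m)) (cong (_+_ (ιℤ i)) (trans (ιℤ-neg (+ m)) (cong -_ (ιℤ≡/1 (+ m)))))

p-1 : ∀ n → p n 1 ≡ A n
p-1 zero    = sym (trans (A≡ 0) (cong (λ z → - (z * (z - 1ℚ)) * ½) ι-0))
p-1 (suc n) = trans (cong₂ (λ a b → a - ι n * b) (trans (p-1 n) (A≡ n)) (p-0 n))
  (trans (lem (ι n)) (trans (cong (λ z → - (z * (z - 1ℚ)) * ½) (sym (ι-suc n))) (sym (A≡ (suc n)))))
  where
  lem : ∀ x → - (x * (x - 1ℚ)) * ½ - x * 1ℚ ≡ - ((1ℚ + x) * ((1ℚ + x) - 1ℚ)) * ½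
  lem = solve-∀ ℚ-ring

-- The value at 1 is a base case of its own, since there the factor n - 1 of the recursion is a
-- truncated difference.
p-2 : ∀ n → p n 2 ≡ B n
p-2 zero          = sym (trans (B≡ 0) (cong (λ z → z * (z - 1ℚ) * (z - (+ 2 / 1)) * ((+ 3 / 1) * z - (+ 5 / 1)) * (+ 1 / 24)) ι-0))
p-2 (suc zero)    = sym (trans (B≡ 1) (trans (cong (λ z → z * (z - 1ℚ) * (z - (+ 2 / 1)) * ((+ 3 / 1) * z - (+ 5 / 1)) * (+ 1 / 24)) ι-1) (sym (trans (cong (λ z → 0ℚ - z * 0ℚ) ι-0) refl))))
p-2 (suc (suc n)) = trans
  (cong₂ (λ a b → a - ι n * b) (trans (p-2 (suc n)) (B≡ (suc n))) (trans (p-1 (suc n)) (A≡ (suc n))))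
  (trans (cong (λ x → x * (x - 1ℚ) * (x - (+ 2 / 1)) * ((+ 3 / 1) * x - (+ 5 / 1)) * (+ 1 / 24) - ι n * (- (x * (x - 1ℚ)) * ½)) (ι-suc n))
  (trans (lem (ι n))
  (trans (cong (λ x → x * (x - 1ℚ) * (x - (+ 2 / 1)) * ((+ 3 / 1) * x - (+ 5 / 1)) * (+ 1 / 24)) (sym (trans (ι-suc (suc n)) (cong (_+_ 1ℚ) (ι-suc n)))))
    (sym (B≡ (suc (suc n)))))))
  where
  lem : ∀ y → (1ℚ + y) * ((1ℚ + y) - 1ℚ) * ((1ℚ + y) - (+ 2 / 1)) * ((+ 3 / 1) * (1ℚ + y) - (+ 5 / 1)) * (+ 1 / 24) - y * (- ((1ℚ + y) * ((1ℚ + y) - 1ℚ)) * ½)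
    ≡ (1ℚ + (1ℚ + y)) * ((1ℚ + (1ℚ + y)) - 1ℚ) * ((1ℚ + (1ℚ + y)) - (+ 2 / 1)) * ((+ 3 / 1) * (1ℚ + (1ℚ + y)) - (+ 5 / 1)) * (+ 1 / 24)
  lem = solve-∀ ℚ-ring

-- The coefficients of e^(-A x) x^n P_n(1/x) = 1 + E x² + ⋯
g : ℕ → ℕ → ℚ
g n = conv (expTerm (- A n)) (p n)

g-0 : ∀ n → g n 0 ≡ 1ℚ
g-0 n = trans (cong (1ℚ *_) (p-0 n)) (*-identityˡ 1ℚ)

-- The purpose of splitting off e^(A x): each remaining factor deviates from 1 only at order ν², so
-- that N of them deviate by O(ν).
g-1 : ∀ n → g n 1 ≡ 0ℚ
g-1 n = trans (cong₂ (λ a b → 1ℚ * a + - A n * 1ℚ * 1ℚ * b) (p-1 n) (p-0 n)) (lem (A n))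
  where
  lem : ∀ a → 1ℚ * a + - a * 1ℚ * 1ℚ * 1ℚ ≡ 0ℚ
  lem = solve-∀ ℚ-ring

g-2 : ∀ n → g n 2 ≡ E n
g-2 n = trans (cong₂ (λ a b → 1ℚ * a + (- A n * 1ℚ * 1ℚ * b + - A n * (- A n * 1ℚ) * ½ * p n 0)) (p-2 n) (p-1 n))
  (trans (cong (λ c → 1ℚ * B n + (- A n * 1ℚ * 1ℚ * A n + - A n * (- A n * 1ℚ) * ½ * c)) (p-0 n)) (lem (A n) (B n)))
  where
  lem : ∀ a b → 1ℚ * b + (- a * 1ℚ * 1ℚ * a + - a * (- a * 1ℚ) * ½ * 1ℚ) ≡ b - a * (a * 1ℚ) * ½
  lem = solve-∀ ℚ-ring

-- Weighted norms

4ℚ 4ℚ² : ℚ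
4ℚ  = ι 4
4ℚ² = 4ℚ * 4ℚ

0≤4^ : ∀ k → 0ℚ ≤ 4ℚ ^ k
0≤4^ k = 0≤p^n k (0≤ι 4)

Bounded : ℚ → (ℕ → ℚ) → Set
Bounded b c = ∀ k → ∣ c k ∣ ≤ b * 4ℚ ^ k

-- On sequences bounded by b 4^k the i-fold shift costs a factor 4^i, so this weighted sum bounds
-- the operator given by the first K coefficients of f.
norm : ℕ → (ℕ → ℚ) → ℚ
norm K f = ∑< K (λ i → ∣ f i ∣ * 4ℚ ^ i)

norm-conv : ∀ K f g → norm K (conv f g) ≤ norm K f * norm K g
norm-conv K f g = ≤-trans
  (∑<-mono K λ l → ≤-trans (*-monoʳ-≤ (0≤4^ l) (∣conv∣ f g l))
    (≤-reflexive (sym (conv-scale 4ℚ (∣_∣ ∘ f) (∣_∣ ∘ g) l))))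
  (∑<-conv-≤ K (λ i → ∣ f i ∣ * 4ℚ ^ i) (λ i → ∣ g i ∣ * 4ℚ ^ i)
    (λ i → 0≤p*q (0≤∣p∣ (f i)) (0≤4^ i)) (λ i → 0≤p*q (0≤∣p∣ (g i)) (0≤4^ i)))

0≤norm : ∀ K f → 0ℚ ≤ norm K f
0≤norm K f = ∑<-nonNeg K λ i → 0≤p*q (0≤∣p∣ (f i)) (0≤4^ i)

∑ᴬ : (ℕ → ℚ) → List ℕ → ℚ
∑ᴬ f []       = 0ℚ
∑ᴬ f (n ∷ ks) = f n + ∑ᴬ f ks

∣∑ᴬ∣ : ∀ f a ks → All (λ n → ∣ f n ∣ ≤ a) ks → ∣ ∑ᴬ f ks ∣ ≤ ι (length ks) * a
∣∑ᴬ∣ f a []       []       = ≤-reflexive (sym (trans (cong (_* a) ι-0) (*-zeroˡ a)))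
∣∑ᴬ∣ f a (n ∷ ks) (h ∷ hs) = ≤-trans (∣+∣-mono h (∣∑ᴬ∣ f a ks hs))
  (≤-reflexive (trans (lem a (ι (length ks))) (cong (_* a) (sym (ι-suc (length ks))))))
  where
  lem : ∀ a b → a + b * a ≡ (1ℚ + b) * a
  lem = solve-∀ ℚ-ring

-- Action of the power series f(νx) on sequences, x being the shift c ↦ c ∘ suc.
module Action (ν : ℚ) (K : ℕ) where

  op : (ℕ → ℚ) → (ℕ → ℚ) → ℕ → ℚ
  op f c k = ∑< K (λ i → f i * ν ^ i * c (k ℕ.+ i))

  Supported : (ℕ → ℚ) → Set
  Supported c = ∀ l → K ℕ.≤ l → c l ≡ 0ℚ

  op-cong : ∀ f {c c′} → (∀ k → c k ≡ c′ k) → ∀ k → op f c k ≡ op f c′ k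
  op-cong f h k = ∑<-cong K λ i → cong (f i * ν ^ i *_) (h (k ℕ.+ i))

  op-supported : ∀ f c → Supported c → Supported (op f c)
  op-supported f c h l K≤l = ∑<-zero K λ i → trans
    (cong (f i * ν ^ i *_) (h (l ℕ.+ i) (ℕ.≤-trans K≤l (ℕ.m≤m+n l i)))) (*-zeroʳ (f i * ν ^ i))

  op-op : ∀ f g c k → op f (op g c) k ≡ ∑< K (λ i → f i * ν ^ i * ∑< K (λ j → g j * ν ^ j * c (k ℕ.+ (i ℕ.+ j))))
  op-op f g c k = ∑<-cong K λ i → cong (f i * ν ^ i *_) (∑<-cong K λ j →
    cong (λ z → g j * ν ^ j * c z) (ℕ.+-assoc k i j))

  op-comm : ∀ f g c k → op f (op g c) k ≡ op g (op f c) k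
  op-comm f g c k = begin
    op f (op g c) k
      ≡⟨ op-op f g c k ⟩
    ∑< K (λ i → f i * ν ^ i * ∑< K (λ j → g j * ν ^ j * c (k ℕ.+ (i ℕ.+ j))))
      ≡⟨ ∑<-cong K (λ i → sym (∑<-*ˡ K (f i * ν ^ i) (λ j → g j * ν ^ j * c (k ℕ.+ (i ℕ.+ j))))) ⟩
    ∑< K (λ i → ∑< K (λ j → f i * ν ^ i * (g j * ν ^ j * c (k ℕ.+ (i ℕ.+ j)))))
      ≡⟨ ∑<-comm K K (λ i j → f i * ν ^ i * (g j * ν ^ j * c (k ℕ.+ (i ℕ.+ j)))) ⟩
    ∑< K (λ j → ∑< K (λ i → f i * ν ^ i * (g j * ν ^ j * c (k ℕ.+ (i ℕ.+ j)))))
      ≡⟨ ∑<-cong K (λ j → trans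
           (∑<-cong K λ i → trans (lem (f i * ν ^ i) (g j * ν ^ j) (c (k ℕ.+ (i ℕ.+ j))))
             (cong (λ z → g j * ν ^ j * (f i * ν ^ i * c (k ℕ.+ z))) (ℕ.+-comm i j)))
           (∑<-*ˡ K (g j * ν ^ j) (λ i → f i * ν ^ i * c (k ℕ.+ (j ℕ.+ i))))) ⟩
    ∑< K (λ j → g j * ν ^ j * ∑< K (λ i → f i * ν ^ i * c (k ℕ.+ (j ℕ.+ i))))
      ≡⟨ op-op g f c k ⟨
    op g (op f c) k ∎
    where
    open ≡-Reasoning
    lem : ∀ a b c → a * (b * c) ≡ b * (a * c)
    lem = solve-∀ ℚ-ring

  op-conv : ∀ f g c → Supported c → ∀ k → op f (op g c) k ≡ op (conv f g) c k
  op-conv f g c h k = trans (op-op f g c k) (trans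
    (cauchy-product K (λ i → f i * ν ^ i) (λ j → g j * ν ^ j) (λ l → c (k ℕ.+ l))
      (λ l K≤l → h (k ℕ.+ l) (ℕ.≤-trans K≤l (ℕ.m≤n+m l k))))
    (∑<-cong K λ l → cong (_* c (k ℕ.+ l)) (conv-scale ν f g l)))

  op-congˡ : ∀ {f g} c → (∀ i → f i ≡ g i) → ∀ k → op f c k ≡ op g c k
  op-congˡ c h k = ∑<-cong K λ i → cong (λ z → z * ν ^ i * c (k ℕ.+ i)) (h i)

  op-exp-exp : ∀ a b c → Supported c → ∀ k → op (expTerm a) (op (expTerm b) c) k ≡ op (expTerm (a + b)) c k
  op-exp-exp a b c h k = trans (op-conv (expTerm a) (expTerm b) c h k) (op-congˡ c (conv-expTerm a b) k)

  op-exp-0 : ∀ c → Supported c → ∀ k → op (expTerm 0ℚ) c k ≡ c k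
  op-exp-0 c h k = go K h
    where
    go : ∀ K → (∀ l → K ℕ.≤ l → c l ≡ 0ℚ) → ∑< K (λ i → expTerm 0ℚ i * ν ^ i * c (k ℕ.+ i)) ≡ c k
    go zero    h = sym (h k ℕ.z≤n)
    go (suc n) h = trans (cong (_+_ (expTerm 0ℚ 0 * 1ℚ * c (k ℕ.+ 0))) (∑<-zero n λ i →
        trans (cong (λ z → z * ν ^ suc i * c (k ℕ.+ suc i)) (expTerm-zero i)) (lem (ν ^ suc i) (c (k ℕ.+ suc i)))))
      (trans (lem′ (c (k ℕ.+ 0))) (cong c (ℕ.+-identityʳ k)))
      where
      lem : ∀ a b → 0ℚ * a * b ≡ 0ℚ
      lem = solve-∀ ℚ-ring
      lem′ : ∀ a → 1ℚ * 1ℚ * a + 0ℚ ≡ a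
      lem′ = solve-∀ ℚ-ring

  ∏ : (ℕ → ℕ → ℚ) → List ℕ → (ℕ → ℚ) → ℕ → ℚ
  ∏ f []       c = c
  ∏ f (n ∷ ks) c = op (f n) (∏ f ks c)

  ∏-cong : ∀ f ks {c c′} → (∀ k → c k ≡ c′ k) → ∀ k → ∏ f ks c k ≡ ∏ f ks c′ k
  ∏-cong f []       h = h
  ∏-cong f (n ∷ ks) h = op-cong (f n) (∏-cong f ks h)

  ∏-supported : ∀ f ks c → Supported c → Supported (∏ f ks c)
  ∏-supported f []       c h = h
  ∏-supported f (n ∷ ks) c h = op-supported (f n) (∏ f ks c) (∏-supported f ks c h)

  op-∏ : ∀ f h ks c k → op h (∏ f ks c) k ≡ ∏ f ks (op h c) k
  op-∏ f h []       c k = refl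
  op-∏ f h (n ∷ ks) c k = trans (op-comm h (f n) (∏ f ks c) k) (op-cong (f n) (op-∏ f h ks c) k)

  -- 1 = e^(-A x) e^(A x) is inserted, and the first factor is absorbed into `p n`, giving `g n`.
  op-p : ∀ n c → Supported c → ∀ k → op (p n) c k ≡ op (g n) (op (expTerm (A n)) c) k
  op-p n c h k = begin
    op (p n) c k
      ≡⟨ op-cong (p n) (λ k → sym (trans (op-exp-exp (- A n) (A n) c h k)
           (trans (cong (λ a → op (expTerm a) c k) (+-inverseˡ (A n))) (op-exp-0 c h k)))) k ⟩
    op (p n) (op (expTerm (- A n)) (op (expTerm (A n)) c)) k
      ≡⟨ op-comm (p n) (expTerm (- A n)) (op (expTerm (A n)) c) k ⟩
    op (expTerm (- A n)) (op (p n) (op (expTerm (A n)) c)) k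
      ≡⟨ op-conv (expTerm (- A n)) (p n) (op (expTerm (A n)) c) (op-supported (expTerm (A n)) c h) k ⟩
    op (g n) (op (expTerm (A n)) c) k ∎
    where open ≡-Reasoning

  -- The operators commute, so the exponentials can be moved inwards past every `g` and merged into
  -- a single one.
  ∏-p : ∀ ks c → Supported c → ∀ k → ∏ p ks c k ≡ ∏ g ks (op (expTerm (∑ᴬ A ks)) c) k
  ∏-p []       c h k = sym (op-exp-0 c h k)
  ∏-p (n ∷ ks) c h k = begin
    op (p n) (∏ p ks c) k
      ≡⟨ op-p n (∏ p ks c) (∏-supported p ks c h) k ⟩
    op (g n) (op (expTerm (A n)) (∏ p ks c)) k
      ≡⟨ op-cong (g n) (λ k → trans (op-cong (expTerm (A n)) (∏-p ks c h) k)
           (trans (op-∏ g (expTerm (A n)) ks (op (expTerm (∑ᴬ A ks)) c) k)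
             (∏-cong g ks (op-exp-exp (A n) (∑ᴬ A ks) c h) k))) k ⟩
    op (g n) (∏ g ks (op (expTerm (A n + ∑ᴬ A ks)) c)) k ∎
    where open ≡-Reasoning

-- Products of operators close to the identity

module Perturbation (ν : ℚ) (0≤ν : 0ℚ ≤ ν) (ν≤1 : ν ≤ 1ℚ) (K : ℕ) where
  -- With the length in this form, the coefficients 0, 1 and 2 split off by computation.
  open Action ν (3 ℕ.+ K)

  ν^≤1 : ∀ i → ν ^ i ≤ 1ℚ
  ν^≤1 zero    = ≤-refl
  ν^≤1 (suc i) = subst (ν * ν ^ i ≤_) (*-identityˡ 1ℚ) (*-mono-≤ (0≤p^n i 0≤ν) (nonNegative⁻¹ 1ℚ) ν≤1 (ν^≤1 i))

  0≤ν² : 0ℚ ≤ ν * ν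
  0≤ν² = 0≤p*q 0≤ν 0≤ν

  0≤ν³ : 0ℚ ≤ ν * (ν * ν)
  0≤ν³ = 0≤p*q 0≤ν 0≤ν²

  -- The coefficients 1, 0 and E account for what is subtracted. Every other term has ν^(3+i) ≤ ν³,
  -- and the norm bounds the rest.
  op-expand : ∀ n c b k → 0ℚ ≤ b → Bounded b c →
    ∣ op (g n) c k - (c k + E n * (ν * ν) * c (k ℕ.+ 2)) ∣ ≤ ν * (ν * ν) * (norm (3 ℕ.+ K) (g n) * b * 4ℚ ^ k)
  op-expand n c b k 0≤b hc = subst (_≤ ν * (ν * ν) * (norm (3 ℕ.+ K) (g n) * b * 4ℚ ^ k)) (sym (cong ∣_∣ main)) tail-bound
    where
    t : ℕ → ℚ
    t i = g n (3 ℕ.+ i) * ν ^ (3 ℕ.+ i) * c (k ℕ.+ (3 ℕ.+ i))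
    lem : ∀ e ν a₀ a₁ a₂ s → (1ℚ * 1ℚ * a₀ + (0ℚ * (ν * 1ℚ) * a₁ + (e * (ν * (ν * 1ℚ)) * a₂ + s))) - (a₀ + e * (ν * ν) * a₂) ≡ s
    lem = solve-∀ ℚ-ring
    main : op (g n) c k - (c k + E n * (ν * ν) * c (k ℕ.+ 2)) ≡ ∑< K t
    main = trans (cong₂ (λ u w → (u * 1ℚ * w + (g n 1 * (ν * 1ℚ) * c (k ℕ.+ 1) + (g n 2 * (ν * (ν * 1ℚ)) * c (k ℕ.+ 2) + ∑< K t)))
                                 - (c k + E n * (ν * ν) * c (k ℕ.+ 2)))
             (g-0 n) (cong c (ℕ.+-identityʳ k)))
      (trans (cong₂ (λ u w → (1ℚ * 1ℚ * c k + (u * (ν * 1ℚ) * c (k ℕ.+ 1) + (w * (ν * (ν * 1ℚ)) * c (k ℕ.+ 2) + ∑< K t)))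
                                 - (c k + E n * (ν * ν) * c (k ℕ.+ 2)))
             (g-1 n) (g-2 n))
        (lem (E n) ν (c k) (c (k ℕ.+ 1)) (c (k ℕ.+ 2)) (∑< K t)))
    u : ℕ → ℚ
    u i = ∣ g n i ∣ * 4ℚ ^ i
    0≤u : ∀ i → 0ℚ ≤ u i
    0≤u i = 0≤p*q (0≤∣p∣ (g n i)) (0≤4^ i)
    s = ν * (ν * ν) * (b * 4ℚ ^ k)
    0≤s : 0ℚ ≤ s
    0≤s = 0≤p*q 0≤ν³ (0≤p*q 0≤b (0≤4^ k))
    ν^-bound : ∀ i → ∣ ν ^ (3 ℕ.+ i) ∣ ≤ ν * (ν * ν)
    ν^-bound i = subst (_≤ ν * (ν * ν)) (sym (0≤p⇒∣p∣≡p (0≤p^n (3 ℕ.+ i) 0≤ν)))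
      (*-monoˡ-≤ 0≤ν (*-monoˡ-≤ 0≤ν (subst (ν * ν ^ i ≤_) (*-identityʳ ν) (*-monoˡ-≤ 0≤ν (ν^≤1 i)))))
    t-bound : ∀ i → ∣ t i ∣ ≤ s * u (3 ℕ.+ i)
    t-bound i = ≤-trans
      (∣*∣-mono {g n (3 ℕ.+ i) * ν ^ (3 ℕ.+ i)} (∣*∣-mono {g n (3 ℕ.+ i)} ≤-refl (ν^-bound i)) (hc (k ℕ.+ (3 ℕ.+ i))))
      (≤-reflexive (trans (cong (λ z → ∣ g n (3 ℕ.+ i) ∣ * (ν * (ν * ν)) * (b * z)) (^-+ 4ℚ k (3 ℕ.+ i)))
        (rearrange ∣ g n (3 ℕ.+ i) ∣ (ν * (ν * ν)) b (4ℚ ^ k) (4ℚ ^ (3 ℕ.+ i)))))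
      where
      rearrange : ∀ a v b x y → a * v * (b * (x * y)) ≡ v * (b * x) * (a * y)
      rearrange = solve-∀ ℚ-ring
    tail-bound : ∣ ∑< K t ∣ ≤ ν * (ν * ν) * (norm (3 ℕ.+ K) (g n) * b * 4ℚ ^ k)
    tail-bound = begin
      ∣ ∑< K t ∣                          ≤⟨ ∣∑<∣ K t ⟩
      ∑< K (λ i → ∣ t i ∣)                ≤⟨ ∑<-mono K t-bound ⟩
      ∑< K (λ i → s * u (3 ℕ.+ i))        ≡⟨ ∑<-*ˡ K s (λ i → u (3 ℕ.+ i)) ⟩
      s * ∑< K (λ i → u (3 ℕ.+ i))        ≤⟨ *-monoˡ-≤ 0≤s (≤-trans (p≤q+p (0≤u 2)) (≤-trans (p≤q+p (0≤u 1)) (p≤q+p (0≤u 0)))) ⟩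
      s * norm (3 ℕ.+ K) (g n)            ≡⟨ rearrange (ν * (ν * ν)) b (4ℚ ^ k) (norm (3 ℕ.+ K) (g n)) ⟩
      ν * (ν * ν) * (norm (3 ℕ.+ K) (g n) * b * 4ℚ ^ k) ∎
      where
      open ≤-Reasoning
      rearrange : ∀ v b x y → v * (b * x) * y ≡ v * (y * b * x)
      rearrange = solve-∀ ℚ-ring

  -- `Q-large` closes the induction: its left side is the error, in units of ν³ 4^k, caused by one
  -- further factor. Q occurs there too, because the partial product is bounded with the help of its
  -- own error, but only with a factor ν.
  module _ (m : ℕ) (M b Q : ℚ) (0≤M : 0ℚ ≤ M) (0≤b : 0ℚ ≤ b) (0≤Q : 0ℚ ≤ Q)
    (g≤M : ∀ n → n ℕ.≤ m → norm (3 ℕ.+ K) (g n) ≤ M)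
    (E≤M : ∀ n → n ℕ.≤ m → ∣ E n ∣ ≤ M)
    (Q-large : M * (Q * ν + (b + 4ℚ² * (M * b))) + M * (4ℚ² * (Q * ν) + 4ℚ² * 4ℚ² * (M * b)) ≤ Q)
    (Γ : ℕ → ℚ) (hΓ : Bounded b Γ) where

    -- Each factor adds at most Q ν³ 4^k. As the number of factors is at most 1/ν, the accumulated
    -- error is at most Q ν² 4^k; this bounds the partial product to which the next factor is
    -- applied.
    perturbation : ∀ ks → All (ℕ._≤ m) ks → ι (length ks) * ν ≤ 1ℚ → ∀ k →
      ∣ ∏ g ks Γ k - (Γ k + ∑ᴬ E ks * (ν * ν) * Γ (k ℕ.+ 2)) ∣ ≤ ι (length ks) * (Q * (ν * (ν * ν)) * 4ℚ ^ k)
    perturbation [] [] _ k = ≤-reflexive (trans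
      (cong ∣_∣ (lem (Γ k) (ν * ν) (Γ (k ℕ.+ 2))))
      (sym (trans (cong (_* (Q * (ν * (ν * ν)) * 4ℚ ^ k)) ι-0) (*-zeroˡ (Q * (ν * (ν * ν)) * 4ℚ ^ k)))))
      where
      lem : ∀ a v c → a - (a + 0ℚ * v * c) ≡ 0ℚ
      lem = solve-∀ ℚ-ring
    perturbation (n ∷ ks) (n≤m ∷ ks≤m) hν k = begin
      ∣ op (g n) y k - (Γ k + (E n + S) * (ν * ν) * Γ (k ℕ.+ 2)) ∣
        -- In the second-order term y (k + 2) is traded for Γ (k + 2), at the cost of the inductive
        -- error and of a term in Γ (k + 4).
        ≡⟨ cong ∣_∣ (lem₁ (op (g n) y k) (Γ k) (E n) S (ν * ν) (y k) (y (k ℕ.+ 2)) (Γ (k ℕ.+ 2)) (Γ (k ℕ.+ 2 ℕ.+ 2))) ⟩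
      ∣ (op (g n) y k - (y k + E n * (ν * ν) * y (k ℕ.+ 2)) + E n * (ν * ν) * (δ (k ℕ.+ 2) + S * (ν * ν) * Γ (k ℕ.+ 2 ℕ.+ 2))) + δ k ∣
        ≤⟨ ∣+∣-mono (∣+∣-mono (≤-trans (op-expand n y b′ k 0≤b′ hy)
             (*-monoˡ-≤ 0≤ν³ (*-monoʳ-≤ (0≤4^ k) (*-monoʳ-≤ 0≤b′ (g≤M n n≤m)))))
             (∣*∣-mono (∣*∣-mono {E n} (E≤M n n≤m) (≤-reflexive (0≤p⇒∣p∣≡p 0≤ν²)))
               (∣+∣-mono {δ (k ℕ.+ 2)} (IH (k ℕ.+ 2)) (SΓ (k ℕ.+ 2)))))
             (perturbation ks ks≤m hν′ k) ⟩
      (ν * (ν * ν) * (M * b′ * 4ℚ ^ k)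
        + M * (ν * ν) * (Q * (ν * ν) * 4ℚ ^ (k ℕ.+ 2) + M * ν * b * (4ℚ² * 4ℚ ^ (k ℕ.+ 2))))
        + ι (length ks) * (Q * (ν * (ν * ν)) * 4ℚ ^ k)
        ≡⟨ cong (λ z → (ν * (ν * ν) * (M * b′ * 4ℚ ^ k) + M * (ν * ν) * (Q * (ν * ν) * z + M * ν * b * (4ℚ² * z)))
                       + ι (length ks) * (Q * (ν * (ν * ν)) * 4ℚ ^ k)) (4^+2 k) ⟩
      (ν * (ν * ν) * (M * b′ * 4ℚ ^ k)
        + M * (ν * ν) * (Q * (ν * ν) * (4ℚ² * 4ℚ ^ k) + M * ν * b * (4ℚ² * (4ℚ² * 4ℚ ^ k))))
        + ι (length ks) * (Q * (ν * (ν * ν)) * 4ℚ ^ k)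
        ≡⟨ lem₂ ν M b Q (4ℚ ^ k) 4ℚ² (ι (length ks) * (Q * (ν * (ν * ν)) * 4ℚ ^ k)) ⟩
      ν * (ν * ν) * (4ℚ ^ k) * (M * (Q * ν + (b + 4ℚ² * (M * b))) + M * (4ℚ² * (Q * ν) + 4ℚ² * 4ℚ² * (M * b)))
        + ι (length ks) * (Q * (ν * (ν * ν)) * 4ℚ ^ k)
        ≤⟨ +-monoˡ-≤ (ι (length ks) * (Q * (ν * (ν * ν)) * 4ℚ ^ k)) (*-monoˡ-≤ (0≤p*q 0≤ν³ (0≤4^ k)) Q-large) ⟩
      ν * (ν * ν) * (4ℚ ^ k) * Q + ι (length ks) * (Q * (ν * (ν * ν)) * 4ℚ ^ k)
        ≡⟨ lem₃ (ν * (ν * ν)) (4ℚ ^ k) Q (ι (length ks)) ⟩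
      (1ℚ + ι (length ks)) * (Q * (ν * (ν * ν)) * 4ℚ ^ k)
        ≡⟨ cong (_* (Q * (ν * (ν * ν)) * 4ℚ ^ k)) (ι-suc (length ks)) ⟨
      ι (length (n ∷ ks)) * (Q * (ν * (ν * ν)) * 4ℚ ^ k) ∎
      where
      open ≤-Reasoning
      y = ∏ g ks Γ
      S = ∑ᴬ E ks
      -- Bounds the partial product: its error, Γ itself, and the second-order term, where the shift
      -- by two costs 4².
      b′ = Q * ν + (b + 4ℚ² * (M * b))
      δ : ℕ → ℚ
      δ k = y k - (Γ k + S * (ν * ν) * Γ (k ℕ.+ 2))
      lem₁ : ∀ o γ e s v y y₂ γ₂ γ₄ → o - (γ + (e + s) * v * γ₂) ≡
        (o - (y + e * v * y₂) + e * v * ((y₂ - (γ₂ + s * v * γ₄)) + s * v * γ₄)) + (y - (γ + s * v * γ₂))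
      lem₁ = solve-∀ ℚ-ring
      lem₂ : ∀ v M b Q x f r → (v * (v * v) * (M * (Q * v + (b + f * (M * b))) * x)
          + M * (v * v) * (Q * (v * v) * (f * x) + M * v * b * (f * (f * x)))) + r
        ≡ v * (v * v) * x * (M * (Q * v + (b + f * (M * b))) + M * (f * (Q * v) + f * f * (M * b))) + r
      lem₂ = solve-∀ ℚ-ring
      lem₃ : ∀ v x Q l → v * x * Q + l * (Q * v * x) ≡ (1ℚ + l) * (Q * v * x)
      lem₃ = solve-∀ ℚ-ring
      hν′ : ι (length ks) * ν ≤ 1ℚ
      hν′ = ≤-trans (*-monoʳ-≤ 0≤ν (ι-mono (ℕ.n≤1+n (length ks)))) hν
      0≤b′ : 0ℚ ≤ b′
      0≤b′ = 0≤p+q (0≤p*q 0≤Q 0≤ν) (0≤p+q 0≤b (0≤p*q (0≤p*q (0≤ι 4) (0≤ι 4)) (0≤p*q 0≤M 0≤b)))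
      4^+2 : ∀ k → 4ℚ ^ (k ℕ.+ 2) ≡ 4ℚ² * 4ℚ ^ k
      4^+2 k = trans (^-+ 4ℚ k 2) (lem (4ℚ ^ k) 4ℚ)
        where
        lem : ∀ x f → x * (f * (f * 1ℚ)) ≡ f * f * x
        lem = solve-∀ ℚ-ring
      IH : ∀ k → ∣ δ k ∣ ≤ Q * (ν * ν) * 4ℚ ^ k
      IH k = ≤-trans (perturbation ks ks≤m hν′ k) (subst₂ _≤_ (lem (ι (length ks)) Q ν (4ℚ ^ k)) (*-identityˡ (Q * (ν * ν) * 4ℚ ^ k))
        (*-monoʳ-≤ (0≤p*q (0≤p*q 0≤Q 0≤ν²) (0≤4^ k)) hν′))
        where
        lem : ∀ l q v x → l * v * (q * (v * v) * x) ≡ l * (q * (v * (v * v)) * x)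
        lem = solve-∀ ℚ-ring
      SΓ : ∀ k → ∣ S * (ν * ν) * Γ (k ℕ.+ 2) ∣ ≤ M * ν * b * (4ℚ² * 4ℚ ^ k)
      SΓ k = ≤-trans
        (∣*∣-mono (∣*∣-mono {S} (∣∑ᴬ∣ E M ks (All.map (E≤M _) ks≤m)) (≤-reflexive (0≤p⇒∣p∣≡p 0≤ν²))) (hΓ (k ℕ.+ 2)))
        (subst₂ _≤_ (trans (lem (ι (length ks)) ν M b (4ℚ² * 4ℚ ^ k)) (cong (λ z → ι (length ks) * M * (ν * ν) * (b * z)) (sym (4^+2 k)))) (*-identityˡ _)
          (*-monoʳ-≤ (0≤p*q (0≤p*q (0≤p*q 0≤M 0≤ν) 0≤b) (0≤p*q (0≤p*q (0≤ι 4) (0≤ι 4)) (0≤4^ k))) hν′))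
        where
        lem : ∀ l v m b x → l * v * (m * v * b * x) ≡ l * m * (v * v) * (b * x)
        lem = solve-∀ ℚ-ring
      hy : Bounded b′ y
      hy k = begin
        ∣ y k ∣
          ≡⟨ cong ∣_∣ (lem (y k) (Γ k) (S * (ν * ν) * Γ (k ℕ.+ 2))) ⟩
        ∣ δ k + (Γ k + S * (ν * ν) * Γ (k ℕ.+ 2)) ∣
          ≤⟨ ∣+∣-mono {δ k} (≤-trans (IH k) (*-monoʳ-≤ (0≤4^ k) (*-monoˡ-≤ 0≤Q (subst (ν * ν ≤_) (*-identityʳ ν) (*-monoˡ-≤ 0≤ν ν≤1)))))
               (∣+∣-mono {Γ k} (hΓ k) (≤-trans (SΓ k) (*-monoʳ-≤ (0≤p*q (0≤p*q (0≤ι 4) (0≤ι 4)) (0≤4^ k)) (*-monoʳ-≤ 0≤b (subst (M * ν ≤_) (*-identityʳ M) (*-monoˡ-≤ 0≤M ν≤1)))))) ⟩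
        Q * ν * 4ℚ ^ k + (b * 4ℚ ^ k + M * b * (4ℚ² * 4ℚ ^ k))
          ≡⟨ lem′ (Q * ν) (4ℚ ^ k) b (M * b) 4ℚ² ⟩
        b′ * 4ℚ ^ k ∎
        where
        lem : ∀ y γ s → y ≡ (y - (γ + s)) + (γ + s)
        lem = solve-∀ ℚ-ring
        lem′ : ∀ q x b m f → q * x + (b * x + m * (f * x)) ≡ (q + (b + f * m)) * x
        lem′ = solve-∀ ℚ-ring

-- Growth and expansion of v_k

-- Bernoulli's inequality (1 - 1/(n+1))^j ≥ 1 - j/(n+1) with d = n - j and denominators cleared.
bernoulli : ∀ j d → suc (j ℕ.+ d) ℕ.^ j ℕ.* suc d ℕ.≤ (j ℕ.+ d) ℕ.^ j ℕ.* suc (j ℕ.+ d)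
bernoulli zero    d = ℕ.≤-refl
bernoulli (suc j) d = begin
  suc n ℕ.* suc n ℕ.^ j ℕ.* suc d         ≡⟨ lem₁ (suc n) (suc n ℕ.^ j) (suc d) ⟩
  suc n ℕ.^ j ℕ.* (suc n ℕ.* suc d)       ≤⟨ ℕ.*-monoʳ-≤ (suc n ℕ.^ j) step ⟩
  suc n ℕ.^ j ℕ.* (n ℕ.* suc (suc d))     ≡⟨ lem₂ (suc n ℕ.^ j) n (suc (suc d)) ⟩
  n ℕ.* (suc n ℕ.^ j ℕ.* suc (suc d))     ≤⟨ ℕ.*-monoʳ-≤ n (subst (λ x → suc x ℕ.^ j ℕ.* suc (suc d) ℕ.≤ x ℕ.^ j ℕ.* suc x) (ℕ.+-suc j d) (bernoulli j (suc d))) ⟩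
  n ℕ.* (n ℕ.^ j ℕ.* suc n)               ≡⟨ ℕ.*-assoc n (n ℕ.^ j) (suc n) ⟨
  n ℕ.* n ℕ.^ j ℕ.* suc n                 ∎
  where
  open ℕ.≤-Reasoning
  n = suc j ℕ.+ d
  lem₁ : ∀ a b c → a ℕ.* b ℕ.* c ≡ b ℕ.* (a ℕ.* c)
  lem₁ = ℕ-solve-∀
  lem₂ : ∀ a b c → a ℕ.* (b ℕ.* c) ≡ b ℕ.* (a ℕ.* c)
  lem₂ = ℕ-solve-∀
  lem₃ : ∀ j d → suc (suc (j ℕ.+ d)) ℕ.* suc d ℕ.+ j ≡ suc (j ℕ.+ d) ℕ.* suc (suc d)
  lem₃ = ℕ-solve-∀
  step : suc n ℕ.* suc d ℕ.≤ n ℕ.* suc (suc d)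
  step = subst (suc n ℕ.* suc d ℕ.≤_) (lem₃ j d) (ℕ.m≤m+n (suc n ℕ.* suc d) j)

-- Bernoulli's inequality gives (n/(n+1))^j ≥ 1 - j/(n+1), which is at least 1/2 for 2j ≤ n + 1.
[1+n]^j≤2n^j : ∀ n j → j ℕ.+ j ℕ.≤ suc n → j ℕ.≤ n → suc n ℕ.^ j ℕ.≤ 2 ℕ.* n ℕ.^ j
[1+n]^j≤2n^j n j 2j≤1+n j≤n = ℕ.*-cancelʳ-≤ (suc n ℕ.^ j) (2 ℕ.* n ℕ.^ j) (suc n) (begin
  suc n ℕ.^ j ℕ.* suc n                 ≤⟨ ℕ.*-monoʳ-≤ (suc n ℕ.^ j) 1+n≤2+2d ⟩
  suc n ℕ.^ j ℕ.* (2 ℕ.* suc d)         ≡⟨ lem₁ (suc n ℕ.^ j) (suc d) ⟩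
  2 ℕ.* (suc n ℕ.^ j ℕ.* suc d)         ≤⟨ ℕ.*-monoʳ-≤ 2 (subst (λ x → suc x ℕ.^ j ℕ.* suc d ℕ.≤ x ℕ.^ j ℕ.* suc x) (ℕ.m+[n∸m]≡n j≤n) (bernoulli j d)) ⟩
  2 ℕ.* (n ℕ.^ j ℕ.* suc n)             ≡⟨ ℕ.*-assoc 2 (n ℕ.^ j) (suc n) ⟨
  2 ℕ.* n ℕ.^ j ℕ.* suc n               ∎)
  where
  open ℕ.≤-Reasoning
  d = n ℕ.∸ j
  lem₁ : ∀ a b → a ℕ.* (2 ℕ.* b) ≡ 2 ℕ.* (a ℕ.* b)
  lem₁ = ℕ-solve-∀
  lem₂ : ∀ j d → (j ℕ.+ j) ℕ.+ 2 ℕ.* suc d ≡ 2 ℕ.+ (j ℕ.+ d) ℕ.+ (j ℕ.+ d)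
  lem₂ = ℕ-solve-∀
  1+n≤2+2d : suc n ℕ.≤ 2 ℕ.* suc d
  1+n≤2+2d = ℕ.+-cancelˡ-≤ (j ℕ.+ j) (suc n) (2 ℕ.* suc d) (begin
    j ℕ.+ j ℕ.+ suc n                     ≤⟨ ℕ.+-monoˡ-≤ (suc n) 2j≤1+n ⟩
    suc n ℕ.+ suc n                       ≡⟨ cong suc (ℕ.+-suc n n) ⟩
    2 ℕ.+ n ℕ.+ n                         ≡⟨ cong (λ x → 2 ℕ.+ x ℕ.+ x) (ℕ.m+[n∸m]≡n j≤n) ⟨
    2 ℕ.+ (j ℕ.+ d) ℕ.+ (j ℕ.+ d)         ≡⟨ lem₂ j d ⟨
    j ℕ.+ j ℕ.+ 2 ℕ.* suc d               ∎)

-- A substitute for (1 + 1/n)^k ≤ e inside the natural numbers: the two halves of k contribute a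
-- factor 2 each. This is the origin of the growth rate 4.
[1+n]^k≤4n^k : ∀ n k → k ℕ.≤ n → suc n ℕ.^ k ℕ.≤ 4 ℕ.* n ℕ.^ k
[1+n]^k≤4n^k n k k≤n = begin
  suc n ℕ.^ k                                  ≡⟨ cong (suc n ℕ.^_) (ℕ.⌊n/2⌋+⌈n/2⌉≡n k) ⟨
  suc n ℕ.^ (a ℕ.+ b)                          ≡⟨ ℕ.^-distribˡ-+-* (suc n) a b ⟩
  suc n ℕ.^ a ℕ.* suc n ℕ.^ b                  ≤⟨ ℕ.*-mono-≤ ([1+n]^j≤2n^j n a 2a≤ (ℕ.≤-trans (ℕ.⌊n/2⌋≤n k) k≤n))
                                                             ([1+n]^j≤2n^j n b 2b≤ (ℕ.≤-trans (ℕ.⌈n/2⌉≤n k) k≤n)) ⟩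
  2 ℕ.* n ℕ.^ a ℕ.* (2 ℕ.* n ℕ.^ b)            ≡⟨ lem (n ℕ.^ a) (n ℕ.^ b) ⟩
  4 ℕ.* (n ℕ.^ a ℕ.* n ℕ.^ b)                  ≡⟨ cong (4 ℕ.*_) (ℕ.^-distribˡ-+-* n a b) ⟨
  4 ℕ.* n ℕ.^ (a ℕ.+ b)                        ≡⟨ cong (λ x → 4 ℕ.* n ℕ.^ x) (ℕ.⌊n/2⌋+⌈n/2⌉≡n k) ⟩
  4 ℕ.* n ℕ.^ k                                ∎
  where
  open ℕ.≤-Reasoning
  a = ℕ.⌊ k /2⌋
  b = ℕ.⌈ k /2⌉
  lem : ∀ x y → 2 ℕ.* x ℕ.* (2 ℕ.* y) ≡ 4 ℕ.* (x ℕ.* y)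
  lem = ℕ-solve-∀
  2a≤ : a ℕ.+ a ℕ.≤ suc n
  2a≤ = ℕ.≤-trans (ℕ.+-monoʳ-≤ a (ℕ.⌊n/2⌋≤⌈n/2⌉ k)) (ℕ.≤-trans (ℕ.≤-reflexive (ℕ.⌊n/2⌋+⌈n/2⌉≡n k)) (ℕ.m≤n⇒m≤1+n k≤n))
  2b≤ : b ℕ.+ b ℕ.≤ suc n
  2b≤ = ℕ.≤-trans (ℕ.+-monoʳ-≤ b (ℕ.⌊n/2⌋≤⌈n/2⌉ (suc k))) (ℕ.≤-trans (ℕ.≤-reflexive (ℕ.⌊n/2⌋+⌈n/2⌉≡n (suc k))) (ℕ.s≤s k≤n))

-- This is v_k ≤ 4^k with N = k + d. For fixed d, raising k by one multiplies N^k d!/N! by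
-- ((N+1)/N)^k ≤ 4, with the old N and k.
[k+d]^k*d!≤ : ∀ k d → (k ℕ.+ d) ℕ.^ k ℕ.* d ! ℕ.≤ 4 ℕ.^ k ℕ.* (k ℕ.+ d) !
[k+d]^k*d!≤ zero    d = ℕ.≤-refl
[k+d]^k*d!≤ (suc k) d = begin
  suc n ℕ.* suc n ℕ.^ k ℕ.* d !            ≤⟨ ℕ.*-monoˡ-≤ (d !) (ℕ.*-monoʳ-≤ (suc n) ([1+n]^k≤4n^k n k (ℕ.m≤m+n k d))) ⟩
  suc n ℕ.* (4 ℕ.* n ℕ.^ k) ℕ.* d !        ≡⟨ lem₁ (suc n) (n ℕ.^ k) (d !) ⟩
  suc n ℕ.* 4 ℕ.* (n ℕ.^ k ℕ.* d !)        ≤⟨ ℕ.*-monoʳ-≤ (suc n ℕ.* 4) ([k+d]^k*d!≤ k d) ⟩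
  suc n ℕ.* 4 ℕ.* (4 ℕ.^ k ℕ.* n !)        ≡⟨ lem₂ (suc n) (4 ℕ.^ k) (n !) ⟩
  4 ℕ.* 4 ℕ.^ k ℕ.* (suc n ℕ.* n !)        ∎
  where
  open ℕ.≤-Reasoning
  n = k ℕ.+ d
  lem₁ : ∀ a b c → a ℕ.* (4 ℕ.* b) ℕ.* c ≡ a ℕ.* 4 ℕ.* (b ℕ.* c)
  lem₁ = ℕ-solve-∀
  lem₂ : ∀ a b c → a ℕ.* 4 ℕ.* (b ℕ.* c) ≡ 4 ℕ.* b ℕ.* (a ℕ.* c)
  lem₂ = ℕ-solve-∀

2ℚ : ℚ
2ℚ = ι 2

1≤2^ : ∀ k → 1ℚ ≤ 2ℚ ^ k
1≤2^ zero    = ≤-refl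
1≤2^ (suc k) = *-mono-≤ {1ℚ} {2ℚ} {1ℚ} (nonNegative⁻¹ 1ℚ) (0≤ι 2) (subst (_≤ 2ℚ) ι-1 (ι-mono {1} {2} (ℕ.s≤s ℕ.z≤n))) (1≤2^ k)

2ℚ≡1+1 : 2ℚ ≡ 1ℚ + 1ℚ
2ℚ≡1+1 = trans (ι-suc 1) (cong (_+_ 1ℚ) ι-1)

0≤2^ : ∀ k → 0ℚ ≤ 2ℚ ^ k
0≤2^ k = 0≤p^n k (0≤ι 2)

-- Trades polynomial factors in k for powers of 2, so that all error bounds stay geometric in k.
ι≤2^ : ∀ k → ι k ≤ 2ℚ ^ k
ι≤2^ zero    = subst (_≤ 1ℚ) (sym ι-0) (nonNegative⁻¹ 1ℚ)
ι≤2^ (suc k) = subst₂ _≤_ (sym (ι-suc k)) (trans (lem (2ℚ ^ k)) (cong (_* 2ℚ ^ k) (sym 2ℚ≡1+1)))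
  (+-mono-≤ (1≤2^ k) (ι≤2^ k))
  where
  lem : ∀ a → a + a ≡ (1ℚ + 1ℚ) * a
  lem = solve-∀ ℚ-ring

4^≡2^*2^ : ∀ k → 4ℚ ^ k ≡ 2ℚ ^ k * 2ℚ ^ k
4^≡2^*2^ k = trans (cong (_^ k) (ι-* 2 2)) (^-distribˡ-* 2ℚ 2ℚ k)

-- v k = n^k / (n (n-1) ⋯ (n-k+1)) for k ≤ n, continued by 0.
module Falling (n : ℕ) .{{_ : ℕ.NonZero n}} where

  ν : ℚ
  ν = + 1 / n

  1/n! : ℚ
  1/n! = (+ 1 / n !) {{n ℕ.!≢0}}

  v : ℕ → ℚ
  v k = ind (suc n) k * (ι (n ℕ.^ k ℕ.* (n ℕ.∸ k) !) * 1/n!)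

  0≤ν : 0ℚ ≤ ν
  0≤ν = 0≤1/ n

  nν≡1 : ι n * ν ≡ 1ℚ
  nν≡1 = 1/-inverse n

  n!1/n!≡1 : ι (n !) * 1/n! ≡ 1ℚ
  n!1/n!≡1 = 1/-inverse (n !) {{n ℕ.!≢0}}

  0≤1/n! : 0ℚ ≤ 1/n!
  0≤1/n! = 0≤1/ (n !) {{n ℕ.!≢0}}

  v-supported : ∀ l → suc n ℕ.≤ l → v l ≡ 0ℚ
  v-supported l n<l = trans (cong (_* w) (ind-≥ (suc n) l n<l)) (*-zeroˡ w)
    where w = ι (n ℕ.^ l ℕ.* (n ℕ.∸ l) !) * 1/n!

  v-≤ : ∀ k → k ℕ.≤ n → v k ≡ ι (n ℕ.^ k ℕ.* (n ℕ.∸ k) !) * 1/n!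
  v-≤ k k≤n = trans (cong (_* w) (ind-< (suc n) k (ℕ.s≤s k≤n))) (*-identityˡ w)
    where w = ι (n ℕ.^ k ℕ.* (n ℕ.∸ k) !) * 1/n!

  0≤v : ∀ k → 0ℚ ≤ v k
  0≤v k = 0≤p*q (0≤ind (suc n) k) (0≤p*q (0≤ι (n ℕ.^ k ℕ.* (n ℕ.∸ k) !)) 0≤1/n!)

  v-0 : v 0 ≡ 1ℚ
  v-0 = trans (v-≤ 0 ℕ.z≤n) (trans (cong (λ z → ι z * 1/n!) (ℕ.*-identityˡ (n !))) n!1/n!≡1)

  v≤4^ : ∀ k → v k ≤ 4ℚ ^ k
  v≤4^ k with k ℕ.≤? n
  ... | no k≰n  = subst (_≤ 4ℚ ^ k) (sym (v-supported k (ℕ.≰⇒> k≰n))) (0≤4^ k)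
  ... | yes k≤n = subst₂ _≤_ (sym (v-≤ k k≤n))
    (trans (cong (_* 1/n!) (ι-* (4 ℕ.^ k) (n !))) (trans (*-assoc (ι (4 ℕ.^ k)) (ι (n !)) 1/n!)
      (trans (cong (ι (4 ℕ.^ k) *_) n!1/n!≡1) (trans (*-identityʳ (ι (4 ℕ.^ k))) (ι-^ 4 k)))))
    (*-monoʳ-≤ 0≤1/n! (ι-mono (subst (λ x → x ℕ.^ k ℕ.* (n ℕ.∸ k) ! ℕ.≤ 4 ℕ.^ k ℕ.* x !) (ℕ.m+[n∸m]≡n k≤n)
      ([k+d]^k*d!≤ k (n ℕ.∸ k)))))

  -- This is (n - k) v(k+1) = n v(k) divided by n. Keeping v(k+1) on the right avoids the
  -- denominator n - k and displays the increment as a term with a factor ν.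
  v-suc : ∀ k → k ℕ.< n → v (suc k) ≡ v k + ι k * ν * v (suc k)
  v-suc k k<n = begin
    v (suc k)
      ≡⟨ lem₁ (ι n) ν (v (suc k)) (ι k) ⟩
    ν * ((ι n - ι k) * v (suc k)) + ι k * ν * v (suc k) + (1ℚ - ι n * ν) * v (suc k)
      ≡⟨ cong₂ (λ a b → ν * a + ι k * ν * v (suc k) + (1ℚ - b) * v (suc k)) recurrence nν≡1 ⟩
    ν * (ι n * v k) + ι k * ν * v (suc k) + (1ℚ - 1ℚ) * v (suc k)
      ≡⟨ lem₂ ν (ι n) (v k) (ι k * ν * v (suc k)) (v (suc k)) ⟩
    ι n * ν * v k + ι k * ν * v (suc k)
      ≡⟨ cong (_+ ι k * ν * v (suc k)) (trans (cong (_* v k) nν≡1) (*-identityˡ (v k))) ⟩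
    v k + ι k * ν * v (suc k) ∎
    where
    open ≡-Reasoning
    lem₁ : ∀ n ν v k → v ≡ ν * ((n - k) * v) + k * ν * v + (1ℚ - n * ν) * v
    lem₁ = solve-∀ ℚ-ring
    lem₂ : ∀ ν n v x y → ν * (n * v) + x + (1ℚ - 1ℚ) * y ≡ n * ν * v + x
    lem₂ = solve-∀ ℚ-ring
    recurrence-ℕ : (n ℕ.∸ k) ℕ.* (n ℕ.^ suc k ℕ.* (n ℕ.∸ suc k) !) ≡ n ℕ.* (n ℕ.^ k ℕ.* (n ℕ.∸ k) !)
    recurrence-ℕ = trans (lem (n ℕ.∸ k) n (n ℕ.^ k) ((n ℕ.∸ suc k) !))
      (cong (λ z → n ℕ.* (n ℕ.^ k ℕ.* z)) (trans (cong (ℕ._* (n ℕ.∸ suc k) !) eq) (cong _! (sym eq))))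
      where
      eq : n ℕ.∸ k ≡ suc (n ℕ.∸ suc k)
      eq = ℕ.+-∸-assoc 1 k<n
      lem : ∀ a b c d → a ℕ.* (b ℕ.* c ℕ.* d) ≡ b ℕ.* (c ℕ.* (a ℕ.* d))
      lem = ℕ-solve-∀
    recurrence : (ι n - ι k) * v (suc k) ≡ ι n * v k
    recurrence = begin
      (ι n - ι k) * v (suc k)
        ≡⟨ cong₂ _*_ (sym (ι-∸ (ℕ.<⇒≤ k<n))) (v-≤ (suc k) k<n) ⟩
      ι (n ℕ.∸ k) * (ι (n ℕ.^ suc k ℕ.* (n ℕ.∸ suc k) !) * 1/n!)
        ≡⟨ *-assoc (ι (n ℕ.∸ k)) (ι (n ℕ.^ suc k ℕ.* (n ℕ.∸ suc k) !)) 1/n! ⟨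
      ι (n ℕ.∸ k) * ι (n ℕ.^ suc k ℕ.* (n ℕ.∸ suc k) !) * 1/n!
        ≡⟨ cong (_* 1/n!) (trans (sym (ι-* (n ℕ.∸ k) (n ℕ.^ suc k ℕ.* (n ℕ.∸ suc k) !))) (trans (cong ι recurrence-ℕ) (ι-* n (n ℕ.^ k ℕ.* (n ℕ.∸ k) !)))) ⟩
      ι n * ι (n ℕ.^ k ℕ.* (n ℕ.∸ k) !) * 1/n!
        ≡⟨ *-assoc (ι n) (ι (n ℕ.^ k ℕ.* (n ℕ.∸ k) !)) 1/n! ⟩
      ι n * (ι (n ℕ.^ k ℕ.* (n ℕ.∸ k) !) * 1/n!)
        ≡⟨ cong (ι n *_) (v-≤ k (ℕ.<⇒≤ k<n)) ⟨
      ι n * v k ∎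

  -- The sum 1 + 2 + ⋯ + (k-1), which is the coefficient of ν in the expansion of
  -- 1/((1-ν)(1-2ν)⋯(1-(k-1)ν)).
  triangle : ℕ → ℚ
  triangle k = ι k * (ι k - 1ℚ) * ½

  triangle-suc : ∀ k → triangle (suc k) ≡ triangle k + ι k
  triangle-suc k = trans (cong (λ x → x * (x - 1ℚ) * ½) (ι-suc k)) (lem (ι k))
    where
    lem : ∀ x → (1ℚ + x) * ((1ℚ + x) - 1ℚ) * ½ ≡ x * (x - 1ℚ) * ½ + x
    lem = solve-∀ ℚ-ring

  -- For k > n, where v is cut off to 0, its expansion does not approximate it. The growth in k pays
  -- for this: each 2^k offsets one factor ν.
  1≤ν2^ : ∀ k → n ℕ.≤ k → 1ℚ ≤ ν * 2ℚ ^ k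
  1≤ν2^ k n≤k = subst (_≤ ν * 2ℚ ^ k) (trans (*-comm ν (ι n)) nν≡1) (*-monoˡ-≤ 0≤ν (≤-trans (ι-mono n≤k) (ι≤2^ k)))

  -- By `v-suc` the error grows by at most ν 2^k 4^(k+1). In units of ν 8^k that is 1 + 4 ≤ 8, with
  -- 3 to spare.
  ∣v-1∣ : ∀ k → ∣ v k - 1ℚ ∣ ≤ ν * (2ℚ ^ k * 2ℚ ^ k * 2ℚ ^ k)
  ∣v-1∣ k with k ℕ.≤? n
  ... | no k≰n  = subst (λ z → ∣ z - 1ℚ ∣ ≤ ν * (2ℚ ^ k * 2ℚ ^ k * 2ℚ ^ k)) (sym (v-supported k (ℕ.≰⇒> k≰n)))
    (≤-trans (1≤ν2^ k (ℕ.<⇒≤ (ℕ.≰⇒> k≰n))) (*-monoˡ-≤ 0≤ν (subst (_≤ z * z * z) (lem z)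
      (*-monoʳ-≤ (0≤2^ k) (*-mono-≤ (nonNegative⁻¹ 1ℚ) (0≤2^ k) (1≤2^ k) (1≤2^ k))))))
    where
    z = 2ℚ ^ k
    lem : ∀ z → 1ℚ * 1ℚ * z ≡ z
    lem = solve-∀ ℚ-ring
  ... | yes k≤n = go k k≤n
    where
    go : ∀ k → k ℕ.≤ n → ∣ v k - 1ℚ ∣ ≤ ν * (2ℚ ^ k * 2ℚ ^ k * 2ℚ ^ k)
    go zero    _   = subst (λ x → ∣ x - 1ℚ ∣ ≤ ν * (1ℚ * 1ℚ * 1ℚ)) (sym v-0) (0≤p*q 0≤ν (nonNegative⁻¹ 1ℚ))
    go (suc k) k<n = begin
      ∣ v (suc k) - 1ℚ ∣
        ≡⟨ cong (λ x → ∣ x - 1ℚ ∣) (v-suc k k<n) ⟩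
      ∣ v k + ι k * ν * v (suc k) - 1ℚ ∣
        ≡⟨ cong ∣_∣ (lem₁ (v k) (ι k * ν * v (suc k))) ⟩
      ∣ (v k - 1ℚ) + ι k * ν * v (suc k) ∣
        ≤⟨ ∣+∣-mono (go k (ℕ.<⇒≤ k<n)) (∣*∣-mono {ι k * ν}
             (≤-trans (≤-reflexive (0≤p⇒∣p∣≡p (0≤p*q (0≤ι k) 0≤ν))) (*-monoʳ-≤ 0≤ν (ι≤2^ k)))
             (≤-trans (≤-reflexive (0≤p⇒∣p∣≡p (0≤v (suc k)))) (≤-trans (v≤4^ (suc k)) (≤-reflexive (4^≡2^*2^ (suc k)))))) ⟩
      ν * (z * z * z) + z * ν * (2ℚ * z * (2ℚ * z))
        ≡⟨ cong (λ t → ν * (z * z * z) + z * ν * (t * z * (t * z))) 2ℚ≡1+1 ⟩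
      ν * (z * z * z) + z * ν * ((1ℚ + 1ℚ) * z * ((1ℚ + 1ℚ) * z))
        ≤⟨ p≤p+q (0≤p*q 0≤3 (0≤p*q 0≤ν (0≤p*q (0≤p*q (0≤2^ k) (0≤2^ k)) (0≤2^ k)))) ⟩
      ν * (z * z * z) + z * ν * ((1ℚ + 1ℚ) * z * ((1ℚ + 1ℚ) * z)) + (1ℚ + 1ℚ + 1ℚ) * (ν * (z * z * z))
        ≡⟨ lem₂ ν z ⟩
      ν * ((1ℚ + 1ℚ) * z * ((1ℚ + 1ℚ) * z) * ((1ℚ + 1ℚ) * z))
        ≡⟨ cong (λ t → ν * (t * z * (t * z) * (t * z))) 2ℚ≡1+1 ⟨
      ν * (2ℚ * z * (2ℚ * z) * (2ℚ * z)) ∎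
      where
      open ≤-Reasoning
      z = 2ℚ ^ k
      0≤3 : 0ℚ ≤ 1ℚ + 1ℚ + 1ℚ
      0≤3 = nonNegative⁻¹ (1ℚ + 1ℚ + 1ℚ)
      lem₁ : ∀ a b → a + b - 1ℚ ≡ (a - 1ℚ) + b
      lem₁ = solve-∀ ℚ-ring
      lem₂ : ∀ ν z → ν * (z * z * z) + z * ν * ((1ℚ + 1ℚ) * z * ((1ℚ + 1ℚ) * z)) + (1ℚ + 1ℚ + 1ℚ) * (ν * (z * z * z))
        ≡ ν * ((1ℚ + 1ℚ) * z * ((1ℚ + 1ℚ) * z) * ((1ℚ + 1ℚ) * z))
      lem₂ = solve-∀ ℚ-ring

  -- Subtracting the expansion from `v-suc` leaves k ν (v(k+1) - 1), which the first-order bound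
  -- makes at most ν² 2^k 8^(k+1). In units of ν² 16^k that is 1 + 8 ≤ 16, with 7 to spare.
  ∣v-1-triangle∣ : ∀ k → ∣ v k - (1ℚ + triangle k * ν) ∣ ≤ ν * ν * (2ℚ ^ k * 2ℚ ^ k * 2ℚ ^ k * 2ℚ ^ k)
  ∣v-1-triangle∣ k with k ℕ.≤? n
  ... | no k≰n  = beyond (ℕ.≰⇒> k≰n)
    where
    beyond : n ℕ.< k → ∣ v k - (1ℚ + triangle k * ν) ∣ ≤ ν * ν * (2ℚ ^ k * 2ℚ ^ k * 2ℚ ^ k * 2ℚ ^ k)
    beyond n<k = begin
      ∣ v k - (1ℚ + triangle k * ν) ∣
        ≡⟨ cong (λ x → ∣ x - (1ℚ + triangle k * ν) ∣) (v-supported k n<k) ⟩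
      ∣ 0ℚ - (1ℚ + triangle k * ν) ∣
        ≡⟨ trans (cong ∣_∣ (lem₀ (1ℚ + triangle k * ν))) (∣-p∣≡∣p∣ (1ℚ + triangle k * ν)) ⟩
      ∣ 1ℚ + triangle k * ν ∣
        ≡⟨ 0≤p⇒∣p∣≡p (0≤p+q (nonNegative⁻¹ 1ℚ) (0≤p*q 0≤triangle 0≤ν)) ⟩
      1ℚ + triangle k * ν
        ≤⟨ +-monoʳ-≤ 1ℚ (*-monoʳ-≤ 0≤ν triangle≤) ⟩
      1ℚ + z * z * ν
        -- 1 ≤ ν z supplies two factors ν for the constant 1 and the second factor ν for the other
        -- term.
        ≤⟨ +-mono-≤ {1ℚ} {ν * z * (ν * z)} (*-mono-≤ {1ℚ} {ν * z} {1ℚ} (nonNegative⁻¹ 1ℚ) (0≤p*q 0≤ν (0≤2^ k)) 1≤νz 1≤νz)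
             (subst (_≤ z * z * ν * (ν * z)) (*-identityʳ (z * z * ν)) (*-monoˡ-≤ (0≤p*q (0≤p*q (0≤2^ k) (0≤2^ k)) 0≤ν) 1≤νz)) ⟩
      ν * z * (ν * z) + z * z * ν * (ν * z)
        ≡⟨ lem₁ ν z ⟩
      ν * ν * (z * z) * (1ℚ + z)
        ≤⟨ *-monoˡ-≤ (0≤p*q (0≤p*q 0≤ν 0≤ν) (0≤p*q (0≤2^ k) (0≤2^ k))) (begin
             1ℚ + z             ≤⟨ +-monoˡ-≤ z (1≤2^ k) ⟩
             z + z              ≡⟨ lem₂ z ⟩
             (1ℚ + 1ℚ) * z      ≤⟨ *-monoʳ-≤ (0≤2^ k) 2≤z ⟩
             z * z              ∎) ⟩
      ν * ν * (z * z) * (z * z)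
        ≡⟨ lem₃ ν z ⟩
      ν * ν * (z * z * z * z) ∎
      where
      open ≤-Reasoning
      z = 2ℚ ^ k
      lem₀ : ∀ a → 0ℚ - a ≡ - a
      lem₀ = solve-∀ ℚ-ring
      lem₁ : ∀ ν z → ν * z * (ν * z) + z * z * ν * (ν * z) ≡ ν * ν * (z * z) * (1ℚ + z)
      lem₁ = solve-∀ ℚ-ring
      lem₂ : ∀ z → z + z ≡ (1ℚ + 1ℚ) * z
      lem₂ = solve-∀ ℚ-ring
      lem₃ : ∀ ν z → ν * ν * (z * z) * (z * z) ≡ ν * ν * (z * z * z * z)
      lem₃ = solve-∀ ℚ-ring
      1≤νz : 1ℚ ≤ ν * z
      1≤νz = 1≤ν2^ k (ℕ.<⇒≤ n<k)
      1≤k : 1ℚ ≤ ι k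
      1≤k = subst (_≤ ι k) ι-1 (ι-mono (ℕ.≤-trans (ℕ.s≤s ℕ.z≤n) n<k))
      0≤k-1 : 0ℚ ≤ ι k - 1ℚ
      0≤k-1 = subst (_≤ ι k - 1ℚ) (+-inverseʳ 1ℚ) (+-monoˡ-≤ (- 1ℚ) 1≤k)
      0≤triangle : 0ℚ ≤ triangle k
      0≤triangle = 0≤p*q (0≤p*q (0≤ι k) 0≤k-1) (nonNegative⁻¹ ½)
      2≤z : 1ℚ + 1ℚ ≤ z
      2≤z = pow k (ℕ.≤-trans (ℕ.s≤s ℕ.z≤n) n<k)
        where
        pow : ∀ k → 1 ℕ.≤ k → 1ℚ + 1ℚ ≤ 2ℚ ^ k
        pow (suc k) _ = subst (_≤ 2ℚ ^ suc k) (trans (*-identityʳ 2ℚ) 2ℚ≡1+1) (*-monoˡ-≤ (0≤ι 2) (1≤2^ k))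
      triangle≤ : triangle k ≤ z * z
      triangle≤ = begin
        ι k * (ι k - 1ℚ) * ½
          ≤⟨ *-monoˡ-≤ {ι k * (ι k - 1ℚ)} (0≤p*q (0≤ι k) 0≤k-1) (p≤p+q {½} {½} (nonNegative⁻¹ ½)) ⟩
        ι k * (ι k - 1ℚ) * 1ℚ
          ≡⟨ *-identityʳ (ι k * (ι k - 1ℚ)) ⟩
        ι k * (ι k - 1ℚ)
          ≤⟨ *-mono-≤ 0≤k-1 (0≤2^ k) (ι≤2^ k) (≤-trans (p-1≤p (ι k)) (ι≤2^ k)) ⟩
        z * z ∎
        where
        p-1≤p : ∀ p → p - 1ℚ ≤ p
        p-1≤p p = subst (p - 1ℚ ≤_) (+-identityʳ p) (+-monoʳ-≤ p (nonPositive⁻¹ (- 1ℚ)))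
  ... | yes k≤n = go k k≤n
    where
    go : ∀ k → k ℕ.≤ n → ∣ v k - (1ℚ + triangle k * ν) ∣ ≤ ν * ν * (2ℚ ^ k * 2ℚ ^ k * 2ℚ ^ k * 2ℚ ^ k)
    go zero    _   = subst (λ x → ∣ x ∣ ≤ ν * ν * (1ℚ * 1ℚ * 1ℚ * 1ℚ))
      (sym (trans (cong₂ (λ a b → a - (1ℚ + b * (b - 1ℚ) * ½ * ν)) v-0 ι-0) (lem ν)))
      (0≤p*q (0≤p*q 0≤ν 0≤ν) (nonNegative⁻¹ 1ℚ))
      where
      lem : ∀ a → 1ℚ - (1ℚ + 0ℚ * (0ℚ - 1ℚ) * ½ * a) ≡ 0ℚ
      lem = solve-∀ ℚ-ring
    go (suc k) k<n = begin
      ∣ v (suc k) - (1ℚ + triangle (suc k) * ν) ∣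
        ≡⟨ cong ∣_∣ (trans (cong₂ (λ x t → x - (1ℚ + t * ν)) (v-suc k k<n) (triangle-suc k))
             (lem₁ (v k) (ι k) ν (v (suc k)) (triangle k))) ⟩
      ∣ (v k - (1ℚ + triangle k * ν)) + ι k * ν * (v (suc k) - 1ℚ) ∣
        ≤⟨ ∣+∣-mono (go k (ℕ.<⇒≤ k<n)) (∣*∣-mono {ι k * ν}
             (≤-trans (≤-reflexive (0≤p⇒∣p∣≡p (0≤p*q (0≤ι k) 0≤ν))) (*-monoʳ-≤ 0≤ν (ι≤2^ k)))
             (∣v-1∣ (suc k))) ⟩
      ν * ν * (z * z * z * z) + z * ν * (ν * (2ℚ * z * (2ℚ * z) * (2ℚ * z)))
        ≡⟨ cong (λ t → ν * ν * (z * z * z * z) + z * ν * (ν * (t * z * (t * z) * (t * z)))) 2ℚ≡1+1 ⟩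
      ν * ν * (z * z * z * z) + z * ν * (ν * ((1ℚ + 1ℚ) * z * ((1ℚ + 1ℚ) * z) * ((1ℚ + 1ℚ) * z)))
        ≤⟨ p≤p+q (0≤p*q (nonNegative⁻¹ (+ 7 / 1)) (0≤p*q (0≤p*q 0≤ν 0≤ν) (0≤p*q (0≤p*q (0≤p*q (0≤2^ k) (0≤2^ k)) (0≤2^ k)) (0≤2^ k)))) ⟩
      ν * ν * (z * z * z * z) + z * ν * (ν * ((1ℚ + 1ℚ) * z * ((1ℚ + 1ℚ) * z) * ((1ℚ + 1ℚ) * z))) + (+ 7 / 1) * (ν * ν * (z * z * z * z))
        ≡⟨ lem₂ ν z ⟩
      ν * ν * ((1ℚ + 1ℚ) * z * ((1ℚ + 1ℚ) * z) * ((1ℚ + 1ℚ) * z) * ((1ℚ + 1ℚ) * z))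
        ≡⟨ cong (λ t → ν * ν * (t * z * (t * z) * (t * z) * (t * z))) 2ℚ≡1+1 ⟨
      ν * ν * (2ℚ * z * (2ℚ * z) * (2ℚ * z) * (2ℚ * z)) ∎
      where
      open ≤-Reasoning
      z = 2ℚ ^ k
      lem₁ : ∀ v k ν v′ t → v + k * ν * v′ - (1ℚ + (t + k) * ν) ≡ (v - (1ℚ + t * ν)) + k * ν * (v′ - 1ℚ)
      lem₁ = solve-∀ ℚ-ring
      lem₂ : ∀ ν z → ν * ν * (z * z * z * z) + z * ν * (ν * ((1ℚ + 1ℚ) * z * ((1ℚ + 1ℚ) * z) * ((1ℚ + 1ℚ) * z))) + (+ 7 / 1) * (ν * ν * (z * z * z * z))
        ≡ ν * ν * ((1ℚ + 1ℚ) * z * ((1ℚ + 1ℚ) * z) * ((1ℚ + 1ℚ) * z) * ((1ℚ + 1ℚ) * z))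
      lem₂ = solve-∀ ℚ-ring

  module _ (K : ℕ) (n<K : n ℕ.< K) where
    open Action ν K

    -- Reversal keeps account of degrees: coefficient i of the reversed P_q adds i to k and q - i to
    -- t. When `ks` is used up, t = n - k, so that v k = n^k t!/n!; the n^i gained on the way cancel
    -- the ν^i.
    ∏-φ : ∀ ks t k → t ℕ.+ (sum ks ℕ.+ k) ≡ n → ∏ p ks v k ≡ ι n ^ k * 1/n! * φ ks t
    ∏-φ []       t k eq = begin
      v k                                      ≡⟨ v-≤ k (subst (k ℕ.≤_) eq (ℕ.m≤n+m k t)) ⟩
      ι (n ℕ.^ k ℕ.* (n ℕ.∸ k) !) * 1/n!       ≡⟨ cong (λ b → ι (n ℕ.^ k ℕ.* b !) * 1/n!) (trans (cong (ℕ._∸ k) (sym eq)) (ℕ.m+n∸n≡m t k)) ⟩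
      ι (n ℕ.^ k ℕ.* t !) * 1/n!               ≡⟨ cong (_* 1/n!) (trans (ι-* (n ℕ.^ k) (t !)) (cong (_* ι (t !)) (ι-^ n k))) ⟩
      ι n ^ k * ι (t !) * 1/n!                 ≡⟨ lem (ι n ^ k) (ι (t !)) 1/n! ⟩
      ι n ^ k * 1/n! * ι (t !)                 ∎
      where
      open ≡-Reasoning
      lem : ∀ a b c → a * b * c ≡ a * c * b
      lem = solve-∀ ℚ-ring
    ∏-φ (q ∷ ks) t k eq = begin
      ∑< K (λ i → p q i * ν ^ i * ∏ p ks v (k ℕ.+ i))
        ≡⟨ ∑<-extend (suc q) K (λ i → p q i * ν ^ i * ∏ p ks v (k ℕ.+ i))
             (λ i q<i → trans (cong (λ z → z * ν ^ i * ∏ p ks v (k ℕ.+ i)) (p-vanishes q i q<i)) (lem₀ (ν ^ i) (∏ p ks v (k ℕ.+ i))))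
             (ℕ.≤-trans (ℕ.s≤s q≤n) n<K) ⟩
      ∑< (suc q) (λ i → p q i * ν ^ i * ∏ p ks v (k ℕ.+ i))
        ≡⟨ ∑<-cong< (suc q) term ⟩
      ∑< (suc q) (λ i → ι n ^ k * 1/n! * (P q (q ℕ.∸ i) * φ ks (t ℕ.+ (q ℕ.∸ i))))
        ≡⟨ ∑<-*ˡ (suc q) (ι n ^ k * 1/n!) (λ i → P q (q ℕ.∸ i) * φ ks (t ℕ.+ (q ℕ.∸ i))) ⟩
      ι n ^ k * 1/n! * ∑< (suc q) (λ i → P q (q ℕ.∸ i) * φ ks (t ℕ.+ (q ℕ.∸ i)))
        ≡⟨ cong (ι n ^ k * 1/n! *_) (∑<-reverse q (λ j → P q j * φ ks (t ℕ.+ j))) ⟨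
      ι n ^ k * 1/n! * φ (q ∷ ks) t ∎
      where
      open ≡-Reasoning
      lem₀ : ∀ a b → 0ℚ * a * b ≡ 0ℚ
      lem₀ = solve-∀ ℚ-ring
      q≤n : q ℕ.≤ n
      q≤n = subst (q ℕ.≤_) eq (ℕ.≤-trans (ℕ.≤-trans (ℕ.m≤m+n q (sum ks)) (ℕ.m≤m+n (q ℕ.+ sum ks) k)) (ℕ.m≤n+m (q ℕ.+ sum ks ℕ.+ k) t))
      ν^n^ : ∀ i → ν ^ i * ι n ^ i ≡ 1ℚ
      ν^n^ zero    = refl
      ν^n^ (suc i) = trans (lem ν (ν ^ i) (ι n) (ι n ^ i)) (trans (cong₂ _*_ nν≡1 (ν^n^ i)) (*-identityˡ 1ℚ))
        where
        lem : ∀ a b c d → a * b * (c * d) ≡ (c * a) * (b * d)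
        lem = solve-∀ ℚ-ring
      index : ∀ i → i ℕ.≤ q → t ℕ.+ (q ℕ.∸ i) ℕ.+ (sum ks ℕ.+ (k ℕ.+ i)) ≡ n
      index i i≤q = trans (lem t (q ℕ.∸ i) (sum ks) k i)
        (trans (cong (λ z → t ℕ.+ (z ℕ.+ sum ks ℕ.+ k)) (ℕ.m∸n+n≡m i≤q)) eq)
        where
        lem : ∀ t d s k i → t ℕ.+ d ℕ.+ (s ℕ.+ (k ℕ.+ i)) ≡ t ℕ.+ (d ℕ.+ i ℕ.+ s ℕ.+ k)
        lem = ℕ-solve-∀
      term : ∀ i → i ℕ.< suc q → p q i * ν ^ i * ∏ p ks v (k ℕ.+ i) ≡
             ι n ^ k * 1/n! * (P q (q ℕ.∸ i) * φ ks (t ℕ.+ (q ℕ.∸ i)))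
      term i (ℕ.s≤s i≤q) = begin
        p q i * ν ^ i * ∏ p ks v (k ℕ.+ i)
          ≡⟨ cong₂ (λ a b → a * ν ^ i * b) (p≡P q i i≤q) (∏-φ ks (t ℕ.+ (q ℕ.∸ i)) (k ℕ.+ i) (index i i≤q)) ⟩
        P q (q ℕ.∸ i) * ν ^ i * (ι n ^ (k ℕ.+ i) * 1/n! * φ ks (t ℕ.+ (q ℕ.∸ i)))
          ≡⟨ cong (λ z → P q (q ℕ.∸ i) * ν ^ i * (z * 1/n! * φ ks (t ℕ.+ (q ℕ.∸ i)))) (^-+ (ι n) k i) ⟩
        P q (q ℕ.∸ i) * ν ^ i * (ι n ^ k * ι n ^ i * 1/n! * φ ks (t ℕ.+ (q ℕ.∸ i)))
          ≡⟨ lem (P q (q ℕ.∸ i)) (ν ^ i) (ι n ^ k) (ι n ^ i) 1/n! (φ ks (t ℕ.+ (q ℕ.∸ i))) ⟩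
        ν ^ i * ι n ^ i * (ι n ^ k * 1/n! * (P q (q ℕ.∸ i) * φ ks (t ℕ.+ (q ℕ.∸ i))))
          ≡⟨ trans (cong (_* (ι n ^ k * 1/n! * (P q (q ℕ.∸ i) * φ ks (t ℕ.+ (q ℕ.∸ i))))) (ν^n^ i)) (*-identityˡ (ι n ^ k * 1/n! * (P q (q ℕ.∸ i) * φ ks (t ℕ.+ (q ℕ.∸ i))))) ⟩
        ι n ^ k * 1/n! * (P q (q ℕ.∸ i) * φ ks (t ℕ.+ (q ℕ.∸ i))) ∎
        where
        lem : ∀ a b c d e f → a * b * (c * d * e * f) ≡ b * d * (c * e * (a * f))
        lem = solve-∀ ℚ-ring

-- Part sizes

∑ᴬ-++ : ∀ f xs ys → ∑ᴬ f (xs ++ ys) ≡ ∑ᴬ f xs + ∑ᴬ f ys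
∑ᴬ-++ f []       ys = sym (+-identityˡ (∑ᴬ f ys))
∑ᴬ-++ f (x ∷ xs) ys = trans (cong (_+_ (f x)) (∑ᴬ-++ f xs ys)) (sym (+-assoc (f x) (∑ᴬ f xs) (∑ᴬ f ys)))

∑ᴬ-replicate : ∀ f c x → ∑ᴬ f (replicate c x) ≡ (+ c / 1) * f x
∑ᴬ-replicate f c x = trans (go c) (cong (_* f x) (ιℤ≡/1 (+ c)))
  where
  lem : ∀ a b → b + a * b ≡ (1ℚ + a) * b
  lem = solve-∀ ℚ-ring
  go : ∀ c → ∑ᴬ f (replicate c x) ≡ ι c * f x
  go zero    = sym (trans (cong (_* f x) ι-0) (*-zeroˡ (f x)))
  go (suc c) = trans (cong (_+_ (f x)) (go c)) (trans (lem (ι c) (f x)) (cong (_* f x) (sym (ι-suc c))))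

∑ᴬ-parts : ∀ f {k} (r s : Fin k → ℕ) →
  ∑ᴬ f (concat (List.tabulate λ j → replicate (r j) (s j))) ≡ ∑ℚ (λ j → (+ r j / 1) * f (s j))
∑ᴬ-parts f {zero}  r s = refl
∑ᴬ-parts f {suc k} r s = trans (∑ᴬ-++ f (replicate (r zero) (s zero)) _)
  (cong₂ _+_ (∑ᴬ-replicate f (r zero) (s zero)) (∑ᴬ-parts f (r ∘ suc) (s ∘ suc)))

sum-parts : ∀ {k} (r s : Fin k → ℕ) →
  sum (concat (List.tabulate λ j → replicate (r j) (s j))) ≡ ∑ℕ (λ j → s j ℕ.* r j)
sum-parts {zero}  r s = refl
sum-parts {suc k} r s = trans (sum-++ (replicate (r zero) (s zero)) _)
  (cong₂ ℕ._+_ (trans (sum-replicate (r zero)) (ℕ.*-comm (r zero) (s zero))) (sum-parts (r ∘ suc) (s ∘ suc)))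
  where
  sum-replicate : ∀ c → sum (replicate c (s zero)) ≡ c ℕ.* s zero
  sum-replicate zero    = refl
  sum-replicate (suc c) = cong (s zero ℕ.+_) (sum-replicate c)

partSizes-All : ∀ {m} (P : ℕ → Set) (r : Fin m → ℕ) → (∀ j → P (size {m} j)) → All P (partSizes r)
partSizes-All P r h = All.concat⁺ (All.tabulate⁺ λ j → All.replicate⁺ (r j) (h j))

length≤sum : ∀ ks → All (1 ℕ.≤_) ks → length ks ℕ.≤ sum ks
length≤sum []       []          = ℕ.z≤n
length≤sum (k ∷ ks) (1≤k ∷ 1≤ks) = ℕ.+-mono-≤ 1≤k (length≤sum ks 1≤ks)

-- Null sequences

Null : (ℕ → ℚ) → Set
Null t = ∀ ε → 0ℚ < ε → ∃[ L ] ∀ i → L ℕ.≤ i → ∣ t i ∣ < ε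

*-pos : ∀ {p q} → 0ℚ < p → 0ℚ < q → 0ℚ < p * q
*-pos {p} {q} 0<p 0<q = positive⁻¹ (p * q) {{pos*pos⇒pos p {{positive 0<p}} q {{positive 0<q}}}}

ι<ι-suc : ∀ k → ι k < ι (suc k)
ι<ι-suc k = subst₂ _<_ (+-identityˡ (ι k)) (sym (ι-suc k)) (+-monoˡ-< (ι k) (positive⁻¹ 1ℚ))

Null-+ : ∀ {s t} → Null s → Null t → Null (λ i → s i + t i)
Null-+ {s} {t} hs ht ε 0<ε =
  let 0<½ε = *-pos 0<ε (positive⁻¹ ½) ; K , h = hs (ε * ½) 0<½ε ; L , h′ = ht (ε * ½) 0<½ε in
  K ℕ.⊔ L , λ i KL≤i → ≤-<-trans (∣p+q∣≤∣p∣+∣q∣ (s i) (t i))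
    (subst (∣ s i ∣ + ∣ t i ∣ <_) (lem ε)
      (+-mono-< (h i (ℕ.m⊔n≤o⇒m≤o K L KL≤i)) (h′ i (ℕ.m⊔n≤o⇒n≤o K L KL≤i))))
  where
  lem : ∀ a → a * ½ + a * ½ ≡ a
  lem = solve-∀ ℚ-ring

Null-* : ∀ c {t} → Null t → Null (λ i → c * t i)
Null-* c {t} ht ε 0<ε = go (archimedean ∣ c ∣)
  where
  go : ∃[ k ] ∣ c ∣ ≤ ι k → ∃[ L ] ∀ i → L ℕ.≤ i → ∣ c * t i ∣ < ε
  go (k , c≤k) = let L , h = ht δ 0<δ in L , λ i L≤i → ≤-<-trans
    (≤-trans (≤-reflexive (∣p*q∣≡∣p∣*∣q∣ c (t i))) (*-mono-≤ (0≤∣p∣ (t i)) (0≤ι k) c≤k (<⇒≤ (h i L≤i))))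
    (subst (ι k * δ <_) scale (*-monoˡ-<-pos δ {{positive 0<δ}} (ι<ι-suc k)))
    where
    δ = (+ 1 / suc k) * ε
    0<δ : 0ℚ < δ
    0<δ = *-pos (positive⁻¹ (+ 1 / suc k) {{normalize-pos 1 (suc k)}}) 0<ε
    scale : ι (suc k) * δ ≡ ε
    scale = trans (sym (*-assoc (ι (suc k)) (+ 1 / suc k) ε)) (trans (cong (_* ε) (1/-inverse (suc k))) (*-identityˡ ε))

Null-bound : ∀ C {t} → (∀ i → ι (suc i) * ∣ t (suc i) ∣ ≤ C) → Null t
Null-bound C {t} h ε 0<ε = go (archimedean (C * ε⁻¹))
  where
  instance
    ε≢0 : ℚ.NonZero ε
    ε≢0 = pos⇒nonZero ε {{positive 0<ε}}
  ε⁻¹ = 1/ ε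
  go : ∃[ k ] C * ε⁻¹ ≤ ι k → ∃[ L ] ∀ i → L ℕ.≤ i → ∣ t i ∣ < ε
  go (k , le) = suc k , λ { (suc i) k≤i → *-cancelˡ-<-nonNeg (ι (suc i)) {{nonNegative (0≤ι (suc i))}}
    (≤-<-trans (h i) (≤-<-trans C≤kε (<-≤-trans (*-monoˡ-<-pos ε {{positive 0<ε}} (ι<ι-suc k)) (*-monoʳ-≤ (<⇒≤ 0<ε) (ι-mono k≤i))))) }
    where
    C≤kε : C ≤ ι k * ε
    C≤kε = subst (_≤ ι k * ε) (trans (*-assoc C ε⁻¹ ε) (trans (cong (C *_) (*-inverseˡ ε)) (*-identityʳ C)))
      (*-monoʳ-≤ (<⇒≤ 0<ε) le)

Null-≤ : ∀ {s t} L₀ → (∀ i → L₀ ℕ.≤ i → ∣ s i ∣ ≤ ∣ t i ∣) → Null t → Null s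
Null-≤ L₀ h ht ε 0<ε = let L , h′ = ht ε 0<ε in
  L₀ ℕ.⊔ L , λ i le → ≤-<-trans (h i (ℕ.m⊔n≤o⇒m≤o L₀ L le)) (h′ i (ℕ.m⊔n≤o⇒n≤o L₀ L le))

-- Serves for d = 2, the difference in length between the two partial exponential sums of the final
-- estimate.
Null-cauchy : ∀ d x → IsCauchy x → Null (λ i → x (i ℕ.∸ d) - x i)
Null-cauchy d x cx ε 0<ε = let L , h = cx ε 0<ε in
  d ℕ.+ L , λ i le → h (i ℕ.∸ d) i (ℕ.m+n≤o⇒m≤o∸n L (subst (ℕ._≤ i) (ℕ.+-comm d L) le)) (ℕ.≤-trans (ℕ.m≤n+m L d) le)

Null-∣∣ : ∀ {t} → Null t → Null (λ i → ∣ t i ∣)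
Null-∣∣ {t} ht ε 0<ε = let L , h = ht ε 0<ε in L , λ i le → subst (_< ε) (sym (∣∣p∣∣≡∣p∣ (t i))) (h i le)

term≤∑< : ∀ n (f : ℕ → ℚ) → (∀ i → 0ℚ ≤ f i) → ∀ i → i ℕ.< n → f i ≤ ∑< n f
term≤∑< (suc n) f h zero    _           = p≤p+q (∑<-nonNeg n (h ∘ suc))
term≤∑< (suc n) f h (suc i) (ℕ.s≤s i<n) = ≤-trans (term≤∑< n (f ∘ suc) (h ∘ suc) i i<n) (p≤q+p (h 0))

-- Bounds for truncated exponential sums

16ℚ : ℚ
16ℚ = ι 16

-- Termwise |μ| c ≤ 16 a, so one X serves the weights 2, 4, 8 and 16 and every admissible mean μ,
-- whatever r is.
∑<-expTerm-bound : ∀ {a X} → (∀ n → ∑< n (expTerm (a * 16ℚ)) ≤ X) → ∀ μ → ∣ μ ∣ ≤ a →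
  ∀ c → c ℕ.≤ 16 → ∀ n → ∑< n (λ i → ∣ expTerm μ i ∣ * ι c ^ i) ≤ X
∑<-expTerm-bound hX μ hμ c c≤16 n = ≤-trans
  (∑<-mono n λ i → ≤-trans
    (≤-reflexive (trans (cong (_* ι c ^ i) (∣expTerm∣ μ i)) (sym (expTerm-* ∣ μ ∣ (ι c) i))))
    (expTerm-mono i (0≤p*q (0≤∣p∣ μ) (0≤ι c)) (*-mono-≤ (0≤ι c) (≤-trans (0≤∣p∣ μ) hμ) hμ (ι-mono c≤16))))
  (hX n)

-- The difference is nonzero only for l ≥ K, and then K ≤ l ≤ 2^l: the tail gains a factor 1/K in
-- exchange for a weight 2^l.
ind-weight : ∀ K l → ι K * ∣ 1ℚ - ind K l ∣ ≤ 2ℚ ^ l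
ind-weight K l with K ℕ.≤? l
... | yes K≤l = subst (λ z → ι K * ∣ 1ℚ - z ∣ ≤ 2ℚ ^ l) (sym (ind-≥ K l K≤l))
  (subst (_≤ 2ℚ ^ l) (sym (*-identityʳ (ι K))) (≤-trans (ι-mono K≤l) (ι≤2^ l)))
... | no K≰l  = subst (λ z → ι K * ∣ 1ℚ - z ∣ ≤ 2ℚ ^ l) (sym (ind-< K l (ℕ.≰⇒> K≰l)))
  (subst (_≤ 2ℚ ^ l) (sym (*-zeroʳ (ι K))) (0≤2^ l))

-- The truncated product differs from the Cauchy product by the terms with i + j ≥ K,
-- for which K ≤ 2^i 2^j.
exp-inverse : ∀ {X} μ → (∀ n → ∑< n (λ i → ∣ expTerm μ i ∣ * 2ℚ ^ i) ≤ X) →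
  (∀ n → ∑< n (λ i → ∣ expTerm (- μ) i ∣ * 2ℚ ^ i) ≤ X) → Null (λ i → expSum μ i * expSum (- μ) i - 1ℚ)
exp-inverse {X} μ h h′ = Null-bound (X * X) λ k → bound (suc k) (ones k)
  where
  e = expTerm μ
  f = expTerm (- μ)
  0≤X : 0ℚ ≤ X
  0≤X = h 0
  ones : ∀ k → ∑< (suc k) (conv e f) ≡ 1ℚ
  ones k = trans
    (∑<-cong (suc k) λ i → trans (conv-expTerm μ (- μ) i) (cong (λ z → expTerm z i) (+-inverseʳ μ)))
    (trans (cong (_+_ 1ℚ) (∑<-zero k expTerm-zero)) (+-identityʳ 1ℚ))
  bound : ∀ K → ∑< K (conv e f) ≡ 1ℚ → ι K * ∣ expSum μ K * expSum (- μ) K - 1ℚ ∣ ≤ X * X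
  bound K eq = begin
    ι K * ∣ expSum μ K * expSum (- μ) K - 1ℚ ∣
      ≡⟨ cong (λ z → ι K * ∣ z ∣) difference ⟩
    ι K * ∣ ∑< K (λ i → e i * W i) ∣
      ≤⟨ *-monoˡ-≤ (0≤ι K) (∣∑<∣ K (λ i → e i * W i)) ⟩
    ι K * ∑< K (λ i → ∣ e i * W i ∣)
      ≡⟨ ∑<-*ˡ K (ι K) (λ i → ∣ e i * W i ∣) ⟨
    ∑< K (λ i → ι K * ∣ e i * W i ∣)
      ≤⟨ ∑<-mono K (λ i → ≤-trans
           (≤-reflexive (trans (cong (ι K *_) (∣p*q∣≡∣p∣*∣q∣ (e i) (W i))) (lem₁ (ι K) ∣ e i ∣ ∣ W i ∣)))
           (≤-trans (*-monoˡ-≤ (0≤∣p∣ (e i)) (W-bound i)) (≤-reflexive (sym (*-assoc ∣ e i ∣ (2ℚ ^ i) X))))) ⟩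
    ∑< K (λ i → ∣ e i ∣ * 2ℚ ^ i * X)
      ≡⟨ ∑<-*ʳ K X (λ i → ∣ e i ∣ * 2ℚ ^ i) ⟩
    ∑< K (λ i → ∣ e i ∣ * 2ℚ ^ i) * X
      ≤⟨ *-monoʳ-≤ 0≤X (h K) ⟩
    X * X ∎
    where
    open ≤-Reasoning
    W : ℕ → ℚ
    W i = ∑< K (λ j → f j * (1ℚ - ind K (i ℕ.+ j)))
    lem₁ : ∀ a b c → a * (b * c) ≡ b * (a * c)
    lem₁ = solve-∀ ℚ-ring
    lem₂ : ∀ f i → f * (1ℚ - i) + f * i ≡ f
    lem₂ = solve-∀ ℚ-ring
    lem₃ : ∀ a b → a + b - b ≡ a
    lem₃ = solve-∀ ℚ-ring
    U : ℕ → ℚ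
    U i = ∑< K (λ j → f j * ind K (i ℕ.+ j))
    W+U : ∀ i → W i + U i ≡ ∑< K f
    W+U i = trans (sym (∑<-+ K (λ j → f j * (1ℚ - ind K (i ℕ.+ j))) (λ j → f j * ind K (i ℕ.+ j))))
      (∑<-cong K λ j → lem₂ (f j) (ind K (i ℕ.+ j)))
    difference : expSum μ K * expSum (- μ) K - 1ℚ ≡ ∑< K (λ i → e i * W i)
    difference = begin-equality
      expSum μ K * expSum (- μ) K - 1ℚ
        ≡⟨ cong₂ _-_ (cong₂ _*_ (expSum≡∑< μ K) (expSum≡∑< (- μ) K)) (trans (sym eq) (∑<-conv K e f)) ⟩
      ∑< K e * ∑< K f - ∑< K (λ i → e i * U i)
        ≡⟨ cong (_- ∑< K (λ i → e i * U i)) (trans (sym (∑<-*ʳ K (∑< K f) e))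
             (trans (∑<-cong K λ i → trans (cong (e i *_) (sym (W+U i))) (*-distribˡ-+ (e i) (W i) (U i)))
               (∑<-+ K (λ i → e i * W i) (λ i → e i * U i)))) ⟩
      ∑< K (λ i → e i * W i) + ∑< K (λ i → e i * U i) - ∑< K (λ i → e i * U i)
        ≡⟨ lem₃ (∑< K (λ i → e i * W i)) (∑< K (λ i → e i * U i)) ⟩
      ∑< K (λ i → e i * W i) ∎
    W-bound : ∀ i → ι K * ∣ W i ∣ ≤ 2ℚ ^ i * X
    W-bound i = begin
      ι K * ∣ W i ∣
        ≤⟨ *-monoˡ-≤ (0≤ι K) (∣∑<∣ K (λ j → f j * (1ℚ - ind K (i ℕ.+ j)))) ⟩
      ι K * ∑< K (λ j → ∣ f j * (1ℚ - ind K (i ℕ.+ j)) ∣)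
        ≡⟨ ∑<-*ˡ K (ι K) (λ j → ∣ f j * (1ℚ - ind K (i ℕ.+ j)) ∣) ⟨
      ∑< K (λ j → ι K * ∣ f j * (1ℚ - ind K (i ℕ.+ j)) ∣)
        ≤⟨ ∑<-mono K (λ j → ≤-trans
             (≤-reflexive (trans (cong (ι K *_) (∣p*q∣≡∣p∣*∣q∣ (f j) (1ℚ - ind K (i ℕ.+ j))))
               (lem₁ (ι K) ∣ f j ∣ ∣ 1ℚ - ind K (i ℕ.+ j) ∣)))
             (≤-trans (*-monoˡ-≤ (0≤∣p∣ (f j)) (ind-weight K (i ℕ.+ j)))
               (≤-reflexive (trans (cong (∣ f j ∣ *_) (^-+ 2ℚ i j)) (lem₁ ∣ f j ∣ (2ℚ ^ i) (2ℚ ^ j)))))) ⟩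
      ∑< K (λ j → 2ℚ ^ i * (∣ f j ∣ * 2ℚ ^ j))
        ≡⟨ ∑<-*ˡ K (2ℚ ^ i) (λ j → ∣ f j ∣ * 2ℚ ^ j) ⟩
      2ℚ ^ i * ∑< K (λ j → ∣ f j ∣ * 2ℚ ^ j)
        ≤⟨ *-monoˡ-≤ (0≤2^ i) (h′ K) ⟩
      2ℚ ^ i * X ∎

-- The estimate, with constants depending on m alone

8ℚ : ℚ
8ℚ = ι 8

8^≡ : ∀ k → 8ℚ ^ k ≡ 2ℚ ^ k * 2ℚ ^ k * 2ℚ ^ k
8^≡ k = trans (cong (_^ k) (ι-* 4 2)) (trans (^-distribˡ-* 4ℚ 2ℚ k) (cong (_* 2ℚ ^ k) (4^≡2^*2^ k)))

16^≡ : ∀ k → 16ℚ ^ k ≡ 2ℚ ^ k * 2ℚ ^ k * 2ℚ ^ k * 2ℚ ^ k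
16^≡ k = trans (cong (_^ k) (ι-* 8 2)) (trans (^-distribˡ-* 8ℚ 2ℚ k) (cong (_* 2ℚ ^ k) (8^≡ k)))

-- Sums in place of maxima over the sizes n ≤ m; only an upper bound is wanted.
maxA maxE maxp : ℕ → ℚ
maxA m = ∑< (suc m) (λ n → ∣ A n ∣)
maxE m = ∑< (suc m) (λ n → ∣ E n ∣)
maxp m = ∑< (suc m) (λ n → norm (suc n) (p n))

module Estimate (m : ℕ) (X : ℚ) (hX : ∀ n → ∑< n (expTerm (maxA m * 16ℚ)) ≤ X) where

  -- M dominates |E_n| as well as the norm of `g n`, the latter by submultiplicativity. R₀ is the
  -- left side of `Q-large` without its terms in Q ν. Taking Q = 2 R₀ leaves R₀ for those, which is
  -- enough once N ≥ 2 (M + 16 M).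
  M R₀ Q C₁ 64ℚ : ℚ
  64ℚ = 2ℚ * 2ℚ * 2ℚ * (2ℚ * 2ℚ * 2ℚ)
  M = X * maxp m + maxE m
  R₀ = M * (X + 4ℚ² * (M * X)) + M * (4ℚ² * 4ℚ² * (M * X))
  Q = R₀ + R₀
  -- The errors of `step₁`, `step₂` and `step₃`, the last one multiplied by |μ′| ≤ M; 64 = 8² is the
  -- price of the shift by two.
  C₁ = Q + X + M * (64ℚ * X)

  0≤X : 0ℚ ≤ X
  0≤X = hX 0

  0≤4ℚ² : 0ℚ ≤ 4ℚ²
  0≤4ℚ² = 0≤p*q (0≤ι 4) (0≤ι 4)

  0≤maxp : 0ℚ ≤ maxp m
  0≤maxp = ∑<-nonNeg (suc m) (λ n → 0≤norm (suc n) (p n))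

  0≤maxE : 0ℚ ≤ maxE m
  0≤maxE = ∑<-nonNeg (suc m) (λ n → 0≤∣p∣ (E n))

  0≤M : 0ℚ ≤ M
  0≤M = 0≤p+q (0≤p*q 0≤X 0≤maxp) 0≤maxE

  0≤MX : 0ℚ ≤ M * X
  0≤MX = 0≤p*q 0≤M 0≤X

  0≤R₀ : 0ℚ ≤ R₀
  0≤R₀ = 0≤p+q (0≤p*q 0≤M (0≤p+q 0≤X (0≤p*q 0≤4ℚ² 0≤MX))) (0≤p*q 0≤M (0≤p*q (0≤p*q 0≤4ℚ² 0≤4ℚ²) 0≤MX))

  0≤Q : 0ℚ ≤ Q
  0≤Q = 0≤p+q 0≤R₀ 0≤R₀

  A≤maxA : ∀ n → n ℕ.≤ m → ∣ A n ∣ ≤ maxA m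
  A≤maxA n n≤m = term≤∑< (suc m) (λ n → ∣ A n ∣) (λ n → 0≤∣p∣ (A n)) n (ℕ.s≤s n≤m)

  E≤maxE : ∀ n → n ℕ.≤ m → ∣ E n ∣ ≤ maxE m
  E≤maxE n n≤m = term≤∑< (suc m) (λ n → ∣ E n ∣) (λ n → 0≤∣p∣ (E n)) n (ℕ.s≤s n≤m)

  E≤M : ∀ n → n ℕ.≤ m → ∣ E n ∣ ≤ M
  E≤M n n≤m = ≤-trans (E≤maxE n n≤m) (p≤q+p (0≤p*q 0≤X 0≤maxp))

  exp-bound : ∀ μ → ∣ μ ∣ ≤ maxA m → ∀ c → c ℕ.≤ 16 → ∀ n → ∑< n (λ i → ∣ expTerm μ i ∣ * ι c ^ i) ≤ X
  exp-bound = ∑<-expTerm-bound hX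

  g≤M : ∀ K → m ℕ.< K → ∀ n → n ℕ.≤ m → norm K (g n) ≤ M
  g≤M K m<K n n≤m = begin
    norm K (g n)
      ≤⟨ norm-conv K (expTerm (- A n)) (p n) ⟩
    norm K (expTerm (- A n)) * norm K (p n)
      ≤⟨ *-mono-≤ (0≤norm K (p n)) 0≤X
           (exp-bound (- A n) (subst (_≤ maxA m) (sym (∣-p∣≡∣p∣ (A n))) (A≤maxA n n≤m)) 4 (ℕ.m≤m+n 4 12) K)
           (≤-trans (≤-reflexive (∑<-extend (suc n) K (λ i → ∣ p n i ∣ * 4ℚ ^ i)
               (λ i n<i → trans (cong (λ z → ∣ z ∣ * 4ℚ ^ i) (p-vanishes n i n<i)) (*-zeroˡ (4ℚ ^ i)))
               (ℕ.≤-trans (ℕ.s≤s n≤m) m<K)))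
             (term≤∑< (suc m) (λ n → norm (suc n) (p n)) (λ n → 0≤norm (suc n) (p n)) n (ℕ.s≤s n≤m))) ⟩
    X * maxp m
      ≤⟨ p≤p+q 0≤maxE ⟩
    M ∎
    where open ≤-Reasoning

  module _ (n : ℕ) .{{_ : ℕ.NonZero n}} (m≤n : m ℕ.≤ n) (n-large : (M + M * 4ℚ²) * (1ℚ + 1ℚ) ≤ ι n)
    (ks : List ℕ) (sum≡n : sum ks ≡ n) (ks≤m : All (ℕ._≤ m) ks) (length≤n : length ks ℕ.≤ n)
    (μ μ′ : ℚ) (μ≡ : μ ≡ (+ 1 / n) * ∑ᴬ A ks) (μ′≡ : μ′ ≡ (+ 1 / n) * ∑ᴬ E ks) where

    open Falling n

    s d : ℚ
    s = 1ℚ + (μ′ + μ * μ * ½) * ν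
    d = 1/n! * φ ks 0

    mean≤ : ∀ f a → 0ℚ ≤ a → All (λ k → ∣ f k ∣ ≤ a) ks → ∣ ν * ∑ᴬ f ks ∣ ≤ a
    mean≤ f a 0≤a h = begin
      ∣ ν * ∑ᴬ f ks ∣             ≤⟨ ∣*∣-mono {ν} (≤-reflexive (0≤p⇒∣p∣≡p 0≤ν)) (≤-trans (∣∑ᴬ∣ f a ks h) (*-monoʳ-≤ 0≤a (ι-mono length≤n))) ⟩
      ν * (ι n * a)               ≡⟨ *-assoc ν (ι n) a ⟨
      ν * ι n * a                 ≡⟨ cong (_* a) (trans (*-comm ν (ι n)) nν≡1) ⟩
      1ℚ * a                      ≡⟨ *-identityˡ a ⟩
      a                           ∎
      where open ≤-Reasoning

    ∣μ∣≤ : ∣ μ ∣ ≤ maxA m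
    ∣μ∣≤ = subst (λ z → ∣ z ∣ ≤ maxA m) (sym μ≡)
      (mean≤ A (maxA m) (∑<-nonNeg (suc m) (λ n → 0≤∣p∣ (A n))) (All.map (A≤maxA _) ks≤m))

    ∣μ′∣≤ : ∣ μ′ ∣ ≤ M
    ∣μ′∣≤ = subst (λ z → ∣ z ∣ ≤ M) (sym μ′≡) (mean≤ E M 0≤M (All.map (E≤M _) ks≤m))

    ν≤1 : ν ≤ 1ℚ
    ν≤1 = subst₂ _≤_ (*-identityʳ ν) (trans (*-comm ν (ι n)) nν≡1)
      (*-monoˡ-≤ 0≤ν (subst (_≤ ι n) ι-1 (ι-mono {1} {n} (ℕ.>-nonZero⁻¹ n))))

    Q-large : M * (Q * ν + (X + 4ℚ² * (M * X))) + M * (4ℚ² * (Q * ν) + 4ℚ² * 4ℚ² * (M * X)) ≤ Q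
    Q-large = begin
      M * (Q * ν + (X + 4ℚ² * (M * X))) + M * (4ℚ² * (Q * ν) + 4ℚ² * 4ℚ² * (M * X))
        ≡⟨ lem₁ M (X + 4ℚ² * (M * X)) 4ℚ² (4ℚ² * 4ℚ² * (M * X)) Q ν ⟩
      R₀ + (M + M * 4ℚ²) * ν * Q
        ≡⟨ cong (_+_ R₀) (lem₂ (M + M * 4ℚ²) ν R₀) ⟩
      R₀ + (M + M * 4ℚ²) * (1ℚ + 1ℚ) * ν * R₀
        ≤⟨ +-monoʳ-≤ R₀ (*-monoʳ-≤ 0≤R₀ (*-monoʳ-≤ 0≤ν n-large)) ⟩
      R₀ + ι n * ν * R₀
        ≡⟨ cong (_+_ R₀) (trans (cong (_* R₀) nν≡1) (*-identityˡ R₀)) ⟩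
      R₀ + R₀ ∎
      where
      open ≤-Reasoning
      lem₁ : ∀ M Y f Z Q ν → M * (Q * ν + Y) + M * (f * (Q * ν) + Z) ≡ (M * Y + M * Z) + (M + M * f) * ν * Q
      lem₁ = solve-∀ ℚ-ring
      lem₂ : ∀ a ν r → a * ν * (r + r) ≡ a * (1ℚ + 1ℚ) * ν * r
      lem₂ = solve-∀ ℚ-ring

    module _ (K : ℕ) (n<K : n ℕ.< 3 ℕ.+ K) where
      open Action ν (3 ℕ.+ K)

      private
        K₃ = 3 ℕ.+ K
        e = expTerm μ
        -- Two terms shorter than `e₃`, since the factor i (i-1) lowers the index of `e` by two.
        e₁ = ∑< (1 ℕ.+ K) e
        e₃ = ∑< K₃ e

      Γ : ℕ → ℚ
      Γ = op (expTerm (∑ᴬ A ks)) v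

      -- ν times the sum of A over the parts is the mean μ, so Γ is e^(μ x) v.
      Γ≡ : ∀ k → Γ k ≡ ∑< K₃ (λ i → e i * v (k ℕ.+ i))
      Γ≡ k = ∑<-cong K₃ λ i → cong (_* v (k ℕ.+ i))
        (trans (sym (expTerm-* (∑ᴬ A ks) ν i)) (cong (λ z → expTerm z i) (trans (*-comm (∑ᴬ A ks) ν) (sym μ≡))))

      v-supp : Supported v
      v-supp l K≤l = v-supported l (ℕ.≤-trans n<K K≤l)

      hΓ : Bounded X Γ
      hΓ k = begin
        ∣ Γ k ∣                                       ≡⟨ cong ∣_∣ (Γ≡ k) ⟩
        ∣ ∑< K₃ (λ i → e i * v (k ℕ.+ i)) ∣           ≤⟨ ∣∑<∣ K₃ (λ i → e i * v (k ℕ.+ i)) ⟩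
        ∑< K₃ (λ i → ∣ e i * v (k ℕ.+ i) ∣)
          ≤⟨ ∑<-mono K₃ (λ i → ≤-trans
               (∣*∣-mono {e i} ≤-refl (≤-trans (≤-reflexive (0≤p⇒∣p∣≡p (0≤v (k ℕ.+ i)))) (v≤4^ (k ℕ.+ i))))
               (≤-reflexive (trans (cong (∣ e i ∣ *_) (^-+ 4ℚ k i)) (lem ∣ e i ∣ (4ℚ ^ k) (4ℚ ^ i))))) ⟩
        ∑< K₃ (λ i → ∣ e i ∣ * 4ℚ ^ i * 4ℚ ^ k)       ≡⟨ ∑<-*ʳ K₃ (4ℚ ^ k) (λ i → ∣ e i ∣ * 4ℚ ^ i) ⟩
        ∑< K₃ (λ i → ∣ e i ∣ * 4ℚ ^ i) * 4ℚ ^ k       ≤⟨ *-monoʳ-≤ (0≤4^ k) (exp-bound μ ∣μ∣≤ 4 (ℕ.m≤m+n 4 12) K₃) ⟩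
        X * 4ℚ ^ k                                    ∎
        where
        open ≤-Reasoning
        lem : ∀ a b c → a * (b * c) ≡ a * c * b
        lem = solve-∀ ℚ-ring

      d≡ : d ≡ ∏ g ks Γ 0
      d≡ = trans (cong (_* φ ks 0) (sym (*-identityˡ 1/n!)))
        (trans (sym (∏-φ K₃ n<K ks 0 0 (trans (ℕ.+-identityʳ (sum ks)) sum≡n))) (∏-p ks v v-supp 0))

      step₁ : ∣ d - (Γ 0 + ∑ᴬ E ks * (ν * ν) * Γ 2) ∣ ≤ ν * ν * Q
      step₁ = begin
        ∣ d - (Γ 0 + ∑ᴬ E ks * (ν * ν) * Γ 2) ∣
          ≡⟨ cong (λ z → ∣ z - (Γ 0 + ∑ᴬ E ks * (ν * ν) * Γ 2) ∣) d≡ ⟩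
        ∣ ∏ g ks Γ 0 - (Γ 0 + ∑ᴬ E ks * (ν * ν) * Γ 2) ∣
          ≤⟨ Perturbation.perturbation ν 0≤ν ν≤1 K m M X Q 0≤M 0≤X 0≤Q
               (g≤M K₃ (ℕ.≤-trans (ℕ.s≤s m≤n) n<K)) E≤M Q-large Γ hΓ ks ks≤m
               (≤-trans (*-monoʳ-≤ 0≤ν (ι-mono length≤n)) (≤-reflexive nν≡1)) 0 ⟩
        ι (length ks) * (Q * (ν * (ν * ν)) * 1ℚ)
          ≤⟨ *-monoʳ-≤ (0≤p*q (0≤p*q 0≤Q (0≤p*q 0≤ν (0≤p*q 0≤ν 0≤ν))) (nonNegative⁻¹ 1ℚ)) (ι-mono length≤n) ⟩
        ι n * (Q * (ν * (ν * ν)) * 1ℚ)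
          ≡⟨ lem (ι n) Q ν ⟩
        ι n * ν * (ν * ν * Q)
          ≡⟨ trans (cong (_* (ν * ν * Q)) nν≡1) (*-identityˡ (ν * ν * Q)) ⟩
        ν * ν * Q ∎
        where
        open ≤-Reasoning
        lem : ∀ n q v → n * (q * (v * (v * v)) * 1ℚ) ≡ n * v * (v * v * q)
        lem = solve-∀ ℚ-ring

      -- i (i-1) μ^i/i! = μ² μ^(i-2)/(i-2)!, obtained by applying the recurrence of `expTerm` twice.
      -- This is the source of μ₁²/2.
      ∑-triangle : ∑< K₃ (λ i → e i * triangle i) ≡ μ * μ * ½ * e₁
      ∑-triangle = trans (cong₂ (λ x y → e 0 * (x * (x - 1ℚ) * ½) + (e 1 * (y * (y - 1ℚ) * ½) + ∑< (1 ℕ.+ K) (λ i → e (2 ℕ.+ i) * triangle (2 ℕ.+ i)))) ι-0 ι-1)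
        (trans (lem₀ (e 0) (e 1) (∑< (1 ℕ.+ K) (λ i → e (2 ℕ.+ i) * triangle (2 ℕ.+ i))))
          (trans (∑<-cong (1 ℕ.+ K) term) (∑<-*ˡ (1 ℕ.+ K) (μ * μ * ½) e)))
        where
        lem₀ : ∀ a b c → a * (0ℚ * (0ℚ - 1ℚ) * ½) + (b * (1ℚ * (1ℚ - 1ℚ) * ½) + c) ≡ c
        lem₀ = solve-∀ ℚ-ring
        lem₁ : ∀ e x y → e * (x * ((1ℚ + y) - 1ℚ) * ½) ≡ x * e * y * ½
        lem₁ = solve-∀ ℚ-ring
        lem₂ : ∀ m e y → m * e * y * ½ ≡ m * (y * e) * ½
        lem₂ = solve-∀ ℚ-ring
        lem₃ : ∀ m e → m * (m * e) * ½ ≡ m * m * ½ * e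
        lem₃ = solve-∀ ℚ-ring
        term : ∀ i → e (2 ℕ.+ i) * triangle (2 ℕ.+ i) ≡ μ * μ * ½ * e i
        term i = begin
          e (2 ℕ.+ i) * (ι (2 ℕ.+ i) * (ι (2 ℕ.+ i) - 1ℚ) * ½)
            ≡⟨ cong (λ z → e (2 ℕ.+ i) * (ι (2 ℕ.+ i) * (z - 1ℚ) * ½)) (ι-suc (suc i)) ⟩
          e (2 ℕ.+ i) * (ι (2 ℕ.+ i) * ((1ℚ + ι (suc i)) - 1ℚ) * ½)
            ≡⟨ lem₁ (e (2 ℕ.+ i)) (ι (2 ℕ.+ i)) (ι (suc i)) ⟩
          ι (2 ℕ.+ i) * e (2 ℕ.+ i) * ι (suc i) * ½
            ≡⟨ cong (λ z → z * ι (suc i) * ½) (expTerm-suc μ (suc i)) ⟩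
          μ * e (suc i) * ι (suc i) * ½
            ≡⟨ lem₂ μ (e (suc i)) (ι (suc i)) ⟩
          μ * (ι (suc i) * e (suc i)) * ½
            ≡⟨ cong (λ z → μ * z * ½) (expTerm-suc μ i) ⟩
          μ * (μ * e i) * ½
            ≡⟨ lem₃ μ (e i) ⟩
          μ * μ * ½ * e i ∎
          where open ≡-Reasoning

      ∑<-diff : ∀ (f g h : ℕ → ℚ) → (∀ i → f i - g i ≡ h i) → ∑< K₃ f - ∑< K₃ g ≡ ∑< K₃ h
      ∑<-diff f g h eq = begin
        ∑< K₃ f - ∑< K₃ g                      ≡⟨ cong (_- ∑< K₃ g) (∑<-cong K₃ λ i → trans (lem₁ (f i) (g i)) (cong (_+ g i) (eq i))) ⟩
        ∑< K₃ (λ i → h i + g i) - ∑< K₃ g      ≡⟨ cong (_- ∑< K₃ g) (∑<-+ K₃ h g) ⟩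
        ∑< K₃ h + ∑< K₃ g - ∑< K₃ g            ≡⟨ lem₂ (∑< K₃ h) (∑< K₃ g) ⟩
        ∑< K₃ h                                ∎
        where
        open ≡-Reasoning
        lem₁ : ∀ a b → a ≡ (a - b) + b
        lem₁ = solve-∀ ℚ-ring
        lem₂ : ∀ a b → a + b - b ≡ a
        lem₂ = solve-∀ ℚ-ring

      weighted-bound : ∀ (u : ℕ → ℚ) c t → c ℕ.≤ 16 → 0ℚ ≤ t → (∀ i → ∣ u i ∣ ≤ t * ι c ^ i) →
                       ∣ ∑< K₃ (λ i → e i * u i) ∣ ≤ t * X
      weighted-bound u c t c≤16 0≤t h = begin
        ∣ ∑< K₃ (λ i → e i * u i) ∣               ≤⟨ ∣∑<∣ K₃ (λ i → e i * u i) ⟩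
        ∑< K₃ (λ i → ∣ e i * u i ∣)               ≤⟨ ∑<-mono K₃ (λ i → ≤-trans (∣*∣-mono {e i} ≤-refl (h i)) (≤-reflexive (lem ∣ e i ∣ t (ι c ^ i)))) ⟩
        ∑< K₃ (λ i → t * (∣ e i ∣ * ι c ^ i))     ≡⟨ ∑<-*ˡ K₃ t (λ i → ∣ e i ∣ * ι c ^ i) ⟩
        t * ∑< K₃ (λ i → ∣ e i ∣ * ι c ^ i)       ≤⟨ *-monoˡ-≤ 0≤t (exp-bound μ ∣μ∣≤ c c≤16 K₃) ⟩
        t * X                                     ∎
        where
        open ≤-Reasoning
        lem : ∀ a b c → a * (b * c) ≡ b * (a * c)
        lem = solve-∀ ℚ-ring

      step₂ : ∣ Γ 0 - (e₃ + ν * (μ * μ * ½) * e₁) ∣ ≤ ν * ν * X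
      step₂ = subst (λ z → ∣ z ∣ ≤ ν * ν * X) (sym eq)
        (weighted-bound (λ i → v i - (1ℚ + triangle i * ν)) 16 (ν * ν) ℕ.≤-refl (0≤p*q 0≤ν 0≤ν)
          (λ i → subst (λ z → ∣ v i - (1ℚ + triangle i * ν) ∣ ≤ ν * ν * z) (sym (16^≡ i)) (∣v-1-triangle∣ i)))
        where
        lem₁ : ∀ e t ν → e + ν * (e * t) ≡ e * (1ℚ + t * ν)
        lem₁ = solve-∀ ℚ-ring
        lem₂ : ∀ e v w → e * v - e * w ≡ e * (v - w)
        lem₂ = solve-∀ ℚ-ring
        main≡ : e₃ + ν * (μ * μ * ½) * e₁ ≡ ∑< K₃ (λ i → e i * (1ℚ + triangle i * ν))
        main≡ = trans (cong (_+_ e₃) (trans (*-assoc ν (μ * μ * ½) e₁) (trans (cong (ν *_) (sym ∑-triangle)) (sym (∑<-*ˡ K₃ ν (λ i → e i * triangle i))))))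
          (trans (sym (∑<-+ K₃ e (λ i → ν * (e i * triangle i)))) (∑<-cong K₃ λ i → lem₁ (e i) (triangle i) ν))
        eq : Γ 0 - (e₃ + ν * (μ * μ * ½) * e₁) ≡ ∑< K₃ (λ i → e i * (v i - (1ℚ + triangle i * ν)))
        eq = trans (cong₂ _-_ (Γ≡ 0) main≡)
          (∑<-diff (λ i → e i * v i) (λ i → e i * (1ℚ + triangle i * ν)) (λ i → e i * (v i - (1ℚ + triangle i * ν)))
            λ i → lem₂ (e i) (v i) (1ℚ + triangle i * ν))

      -- Γ 2 enters with the coefficient ν² S = ν μ′, so an error of order ν suffices here.
      step₃ : ∣ Γ 2 - e₃ ∣ ≤ ν * (64ℚ * X)
      step₃ = subst₂ (λ y z → ∣ y ∣ ≤ z) (sym eq) (*-assoc ν 64ℚ X)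
        (weighted-bound (λ i → v (2 ℕ.+ i) - 1ℚ) 8 (ν * 64ℚ) (ℕ.m≤m+n 8 8)
          (0≤p*q 0≤ν (0≤p*q (0≤p*q (0≤p*q (0≤ι 2) (0≤ι 2)) (0≤ι 2)) (0≤p*q (0≤p*q (0≤ι 2) (0≤ι 2)) (0≤ι 2))))
          (λ i → subst (∣ v (2 ℕ.+ i) - 1ℚ ∣ ≤_) (trans (lem₁ ν 2ℚ (2ℚ ^ i)) (cong (ν * 64ℚ *_) (sym (8^≡ i)))) (∣v-1∣ (2 ℕ.+ i))))
        where
        lem₁ : ∀ ν t z → ν * (t * (t * z) * (t * (t * z)) * (t * (t * z))) ≡ ν * (t * t * t * (t * t * t)) * (z * z * z)
        lem₁ = solve-∀ ℚ-ring
        lem₂ : ∀ e v → e * v - e ≡ e * (v - 1ℚ)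
        lem₂ = solve-∀ ℚ-ring
        eq : Γ 2 - e₃ ≡ ∑< K₃ (λ i → e i * (v (2 ℕ.+ i) - 1ℚ))
        eq = trans (cong (_- e₃) (Γ≡ 2))
          (∑<-diff (λ i → e i * v (2 ℕ.+ i)) e (λ i → e i * (v (2 ℕ.+ i) - 1ℚ)) λ i → lem₂ (e i) (v (2 ℕ.+ i)))

      -- The second summand is the mismatch between `e₁` and `e₃`. For fixed n it tends to 0 with
      -- growing K, so it does not affect the constant.
      estimate : ∣ d - expSum μ K₃ * s ∣ ≤ ν * ν * C₁ + ∣ ν * (μ * μ * ½) * (expSum μ (1 ℕ.+ K) - expSum μ K₃) ∣
      estimate = begin
        ∣ d - expSum μ K₃ * s ∣
          ≡⟨ cong₂ (λ x y → ∣ d - x * (1ℚ + (y + μ * μ * ½) * ν) ∣) (expSum≡∑< μ K₃) μ′≡ ⟩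
        ∣ d - e₃ * (1ℚ + (ν * S + μ * μ * ½) * ν) ∣
          ≡⟨ cong ∣_∣ (lem₁ d e₁ e₃ ν S (μ * μ * ½) (Γ 0) (Γ 2)) ⟩
        ∣ (d - (Γ 0 + S * (ν * ν) * Γ 2)) + (Γ 0 - (e₃ + ν * (μ * μ * ½) * e₁)) + ν * S * (ν * (Γ 2 - e₃)) + ν * (μ * μ * ½) * (e₁ - e₃) ∣
          ≡⟨ cong (λ z → ∣ (d - (Γ 0 + S * (ν * ν) * Γ 2)) + (Γ 0 - (e₃ + ν * (μ * μ * ½) * e₁)) + z * (ν * (Γ 2 - e₃)) + ν * (μ * μ * ½) * (e₁ - e₃) ∣) (sym μ′≡) ⟩
        ∣ (d - (Γ 0 + S * (ν * ν) * Γ 2)) + (Γ 0 - (e₃ + ν * (μ * μ * ½) * e₁)) + μ′ * (ν * (Γ 2 - e₃)) + ν * (μ * μ * ½) * (e₁ - e₃) ∣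
          ≤⟨ ∣+∣-mono {(d - (Γ 0 + S * (ν * ν) * Γ 2)) + (Γ 0 - (e₃ + ν * (μ * μ * ½) * e₁)) + μ′ * (ν * (Γ 2 - e₃))}
               (∣+∣-mono {(d - (Γ 0 + S * (ν * ν) * Γ 2)) + (Γ 0 - (e₃ + ν * (μ * μ * ½) * e₁))}
                 (∣+∣-mono {d - (Γ 0 + S * (ν * ν) * Γ 2)} step₁ step₂)
                 (∣*∣-mono {μ′} ∣μ′∣≤ (∣*∣-mono {ν} (≤-reflexive (0≤p⇒∣p∣≡p 0≤ν)) step₃)))
               ≤-refl ⟩
        ν * ν * Q + ν * ν * X + M * (ν * (ν * (64ℚ * X))) + ∣ ν * (μ * μ * ½) * (e₁ - e₃) ∣
          ≡⟨ cong₂ _+_ (lem₂ ν Q X M (64ℚ * X)) (cong₂ (λ x y → ∣ ν * (μ * μ * ½) * (x - y) ∣) (sym (expSum≡∑< μ (1 ℕ.+ K))) (sym (expSum≡∑< μ K₃))) ⟩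
        ν * ν * C₁ + ∣ ν * (μ * μ * ½) * (expSum μ (1 ℕ.+ K) - expSum μ K₃) ∣ ∎
        where
        open ≤-Reasoning
        S = ∑ᴬ E ks
        lem₁ : ∀ d e₁ e₃ ν S h γ₀ γ₂ → d - e₃ * (1ℚ + (ν * S + h) * ν) ≡
          (d - (γ₀ + S * (ν * ν) * γ₂)) + (γ₀ - (e₃ + ν * h * e₁)) + ν * S * (ν * (γ₂ - e₃)) + ν * h * (e₁ - e₃)
        lem₁ = solve-∀ ℚ-ring
        lem₂ : ∀ ν q x m y → ν * ν * q + ν * ν * x + m * (ν * (ν * y)) ≡ ν * ν * (q + x + m * y)
        lem₂ = solve-∀ ℚ-ring

-- The error term R and the uniform constant

theorem7 : ∀ (m : ℕ) → 1 ℕ.≤ m →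
  ∃[ C ] ∃[ N₀ ] ∀ (r : Fin m → ℕ) .{{_ : NonZero (N r)}} → N₀ ℕ.≤ N r →
    ∃[ R ]
      ⟦ + D r / 1 ⟧ ≈ᴿ
        exp (μ₁ r) *ᴿ ⟦ + (N r !) / 1 ⟧
          *ᴿ (⟦ 1ℚ + (μ₂ r + μ₁ r * μ₁ r * ½) * (+ 1 / N r) ⟧ +ᴿ R)
      × ∣ R ∣ᴿ ≤ᴿ ⟦ C * (+ 1 / N r) * (+ 1 / N r) ⟧
theorem7 m _ = from-bound (expSum-bounded (maxA m * 16ℚ) 0≤16a)
  where
  0≤16a : 0ℚ ≤ maxA m * 16ℚ
  0≤16a = 0≤p*q (∑<-nonNeg (suc m) (λ n → 0≤∣p∣ (A n))) (0≤ι 16)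

  from-bound : ∃[ X ] (∀ n → ∑< n (expTerm (maxA m * 16ℚ)) ≤ X) → _
  from-bound (X , hX) = from-large (archimedean ((M + M * 4ℚ²) * (1ℚ + 1ℚ)))
    where
    open Estimate m X hX using (M; C₁; exp-bound; ∣μ∣≤; estimate)

    from-large : ∃[ k ] (M + M * 4ℚ²) * (1ℚ + 1ℚ) ≤ ι k → _
    -- N ≥ k yields `Q-large`, and N ≥ m makes the truncation length exceed every part size. The
    -- factor X bounds e^(-μ), by which the estimate is multiplied.
    from-large (k , M≤k) = X * C₁ , k ℕ.⊔ m , asymptotics
      where
      module _ (r : Fin m → ℕ) .{{_ : NonZero (N r)}} (N₀≤N : k ℕ.⊔ m ℕ.≤ N r) where
        open Falling (N r) using (ν; 1/n!; n!1/n!≡1; 0≤ν)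
        n = N r
        ks = partSizes r
        μ = μ₁ r
        μ′ = μ₂ r

        ks≤m : All (ℕ._≤ m) ks
        ks≤m = partSizes-All (ℕ._≤ m) r Fin.toℕ<n

        sum≡n : sum ks ≡ n
        sum≡n = sum-parts r size

        length≤n : length ks ℕ.≤ n
        length≤n = subst (length ks ℕ.≤_) sum≡n (length≤sum ks (partSizes-All (1 ℕ.≤_) r (λ j → ℕ.s≤s ℕ.z≤n)))

        m≤n : m ℕ.≤ n
        m≤n = ℕ.m⊔n≤o⇒n≤o k m N₀≤N

        n-large : (M + M * 4ℚ²) * (1ℚ + 1ℚ) ≤ ι n
        n-large = ≤-trans M≤k (ι-mono (ℕ.m⊔n≤o⇒m≤o k m N₀≤N))

        μ≡ : μ ≡ (+ 1 / n) * ∑ᴬ A ks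
        μ≡ = cong ((+ 1 / n) *_) (sym (∑ᴬ-parts A r size))

        μ′≡ : μ′ ≡ (+ 1 / n) * ∑ᴬ E ks
        μ′≡ = cong ((+ 1 / n) *_) (sym (∑ᴬ-parts E r size))

        s d : ℚ
        s = 1ℚ + (μ′ + μ * μ * ½) * ν
        d = 1/n! * φ ks 0

        ∣μ∣≤a : ∣ μ ∣ ≤ maxA m
        ∣μ∣≤a = ∣μ∣≤ n m≤n n-large ks sum≡n ks≤m length≤n μ μ′ μ≡ μ′≡

        ∣-μ∣≤a : ∣ - μ ∣ ≤ maxA m
        ∣-μ∣≤a = subst (_≤ maxA m) (sym (∣-p∣≡∣p∣ μ)) ∣μ∣≤a

        R : ℝ
        -- The value forced by the equation, with e^(-μ) for division by e^μ. The equation then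
        -- needs only e^μ e^(-μ) = 1, and the estimate is spent on the size of R.
        R = exp (- μ) *ᴿ ⟦ d ⟧ +ᴿ ⟦ - s ⟧

        D≡ : + D r / 1 ≡ (+ (n !) / 1) * d
        D≡ = begin
          + D r / 1                   ≡⟨ ιℤ≡/1 (+ D r) ⟨
          ι (D r)                     ≡⟨ #acyclicOrientations≡φ ks ⟩
          φ ks 0                      ≡⟨ *-identityˡ (φ ks 0) ⟨
          1ℚ * φ ks 0                 ≡⟨ cong (_* φ ks 0) n!1/n!≡1 ⟨
          ι (n !) * 1/n! * φ ks 0     ≡⟨ *-assoc (ι (n !)) 1/n! (φ ks 0) ⟩
          ι (n !) * d                 ≡⟨ cong (_* d) (ιℤ≡/1 (+ (n !))) ⟩
          (+ (n !) / 1) * d           ∎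
          where open ≡-Reasoning

        inverse : Null (λ i → expSum μ i * expSum (- μ) i - 1ℚ)
        inverse = exp-inverse μ (exp-bound μ ∣μ∣≤a 2 (ℕ.m≤m+n 2 14)) (exp-bound (- μ) ∣-μ∣≤a 2 (ℕ.m≤m+n 2 14))

        identity : ⟦ + D r / 1 ⟧ ≈ᴿ exp μ *ᴿ ⟦ + (n !) / 1 ⟧ *ᴿ (⟦ s ⟧ +ᴿ R)
        identity = Null-≤ 0 (λ i _ → ≤-reflexive (cong ∣_∣ (trans
          (cong (_- expSum μ i * (+ (n !) / 1) * (s + (expSum (- μ) i * d + - s))) D≡)
          (lem (+ (n !) / 1) d (expSum μ i) (expSum (- μ) i) s))))
          (Null-* (- ((+ (n !) / 1) * d)) inverse)
          where
          lem : ∀ f d e e′ s → f * d - e * f * (s + (e′ * d + - s)) ≡ - (f * d) * (e * e′ - 1ℚ)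
          lem = solve-∀ ℚ-ring

        ∣expSum∣≤X : ∀ i → ∣ expSum (- μ) i ∣ ≤ X
        ∣expSum∣≤X i = begin
          ∣ expSum (- μ) i ∣                            ≡⟨ cong ∣_∣ (expSum≡∑< (- μ) i) ⟩
          ∣ ∑< i (expTerm (- μ)) ∣                      ≤⟨ ∣∑<∣ i (expTerm (- μ)) ⟩
          ∑< i (λ j → ∣ expTerm (- μ) j ∣)
            ≤⟨ ∑<-mono i (λ j → subst (_≤ ∣ expTerm (- μ) j ∣ * 2ℚ ^ j) (*-identityʳ ∣ expTerm (- μ) j ∣)
                 (*-monoˡ-≤ (0≤∣p∣ (expTerm (- μ) j)) (1≤2^ j))) ⟩
          ∑< i (λ j → ∣ expTerm (- μ) j ∣ * 2ℚ ^ j)     ≤⟨ exp-bound (- μ) ∣-μ∣≤a 2 (ℕ.m≤m+n 2 14) i ⟩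
          X                                             ∎
          where open ≤-Reasoning

        c : ℚ
        c = ν * (μ * μ * ½)

        lag : ℕ → ℚ
        lag i = c * (expSum μ (i ℕ.∸ 2) - expSum μ i)

        -- r is fixed at this point and only the index i of the approximating sequences grows.
        error-null : Null (λ i → X * ∣ lag i ∣ + ∣ s * (expSum μ i * expSum (- μ) i - 1ℚ) ∣)
        error-null = Null-+ (Null-* X (Null-∣∣ (Null-* c (Null-cauchy 2 (expSum μ) (cauchy (exp μ))))))
          (Null-∣∣ (Null-* s inverse))

        bound : ∀ i → 3 ℕ.+ n ℕ.≤ i → ∣ expSum (- μ) i * d + - s ∣ ≤
          X * C₁ * ν * ν + (X * ∣ lag i ∣ + ∣ s * (expSum μ i * expSum (- μ) i - 1ℚ) ∣)
        bound (suc (suc (suc K))) (ℕ.s≤s (ℕ.s≤s (ℕ.s≤s n≤K))) = begin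
          ∣ e′ * d + - s ∣
            -- The estimate concerns d - e s. Multiplying it by e′ gives e′ d - s up to the defect
            -- of e e′ = 1 for partial sums.
            ≡⟨ cong ∣_∣ (lem₁ e e′ d s) ⟩
          ∣ e′ * (d - e * s) + s * (e * e′ - 1ℚ) ∣
            ≤⟨ ∣+∣-mono {e′ * (d - e * s)} (∣*∣-mono {e′} (∣expSum∣≤X (3 ℕ.+ K))
                 (estimate n m≤n n-large ks sum≡n ks≤m length≤n μ μ′ μ≡ μ′≡ K (ℕ.≤-trans (ℕ.s≤s n≤K) (ℕ.m≤n+m (suc K) 2))))
                 ≤-refl ⟩
          X * (ν * ν * C₁ + ∣ lag (3 ℕ.+ K) ∣) + ∣ s * (e * e′ - 1ℚ) ∣
            ≡⟨ lem₂ X ν C₁ ∣ lag (3 ℕ.+ K) ∣ ∣ s * (e * e′ - 1ℚ) ∣ ⟩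
          X * C₁ * ν * ν + (X * ∣ lag (3 ℕ.+ K) ∣ + ∣ s * (e * e′ - 1ℚ) ∣) ∎
          where
          open ≤-Reasoning
          e  = expSum μ (3 ℕ.+ K)
          e′ = expSum (- μ) (3 ℕ.+ K)
          lem₁ : ∀ e e′ d s → e′ * d + - s ≡ e′ * (d - e * s) + s * (e * e′ - 1ℚ)
          lem₁ = solve-∀ ℚ-ring
          lem₂ : ∀ x ν c l t → x * (ν * ν * c + l) + t ≡ x * c * ν * ν + (x * l + t)
          lem₂ = solve-∀ ℚ-ring

        R-small : ∣ R ∣ᴿ ≤ᴿ ⟦ X * C₁ * ν * ν ⟧
        R-small ε 0<ε = let L , h = error-null ε 0<ε in
          L ℕ.⊔ (3 ℕ.+ n) , λ i le → ≤-trans (bound i (ℕ.m⊔n≤o⇒n≤o L (3 ℕ.+ n) le))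
            (+-monoʳ-≤ (X * C₁ * ν * ν) (≤-trans (p≤∣p∣ _) (<⇒≤ (h i (ℕ.m⊔n≤o⇒m≤o L (3 ℕ.+ n) le)))))

        asymptotics : ∃[ R ] ⟦ + D r / 1 ⟧ ≈ᴿ exp μ *ᴿ ⟦ + (n !) / 1 ⟧ *ᴿ (⟦ s ⟧ +ᴿ R)
          × ∣ R ∣ᴿ ≤ᴿ ⟦ X * C₁ * ν * ν ⟧
        asymptotics = R , identity , R-small
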